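{- There exists $P_0$ such that for every real $P \ge P_0$ there is a $K_5$-free graph $G$ with $\rho(G) \le P$ and $\chi_f(G) > P^2/82$.
   Context: Graphs are finite and simple. A graph is $K_5$-free if it contains no complete graph on $5$ vertices as a subgraph. For a graph $G$, $v(G)$ is its number of vertices and $\alpha(G)$ is the size of a largest independent set. The Hall ratio of $G$ is $\rho(G) := \max_{\emptyset\neq H\subseteq G} \frac{v(H)}{\alpha(H)}$, the maximum over all subgraphs $H$ of $G$ with at least one vertex. The fractional chromatic number $\chi_f(G)$ is the optimal value of the linear program: minimize $\sum_{I} x_I$ over nonnegative reals $x_I$ indexed by the independent sets $I$ of $G$, subject to $\sum_{I\ni v} x_I\ge 1$ for every vertex $v$. Equivalently, by LP duality, it is the maximum of $\sum_{v\in V(G)} y(v)$ over $y:V(G)\to[0,\infty)$ with $\sum_{v\in I} y(v)\le 1$ for every independent set $I$ of $G$. -}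

module Defs where

open import Data.Bool.Base using (true; false)
open import Data.Fin.Base using (Fin; zero)
open import Data.Fin.Properties using (all?)
import Data.Fin.Properties as Fin
open import Data.Fin.Subset using (Subset; inside; outside; _∈_; ∣_∣; ⁅_⁆)
open import Data.Fin.Subset.Properties using (_∈?_; x∈⁅y⁆⇒x≡y; ∣⁅x⁆∣≡1)
open import Data.Integer.Base using (+_)
open import Data.List.Base using (List; []; _∷_; _++_; map; filter; foldr)
open import Data.List.Extrema.Nat using (max; v≤max⁺)
import Data.List.Membership.Propositional as List
open import Data.List.Membership.Propositional.Properties
  using (∈-map⁺; ∈-++⁺ˡ; ∈-++⁺ʳ; ∈-filter⁺)
import Data.List.Relation.Unary.Any as Any
open import Data.Nat.Base as ℕ using (ℕ; suc)
import Data.Nat.Properties as ℕ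
open import Data.Product.Base using (Σ; ∃; _×_; _,_)
open import Data.Rational.Base as ℚ using (ℚ; 0ℚ; 1ℚ; ½; _/_; 1/_)
import Data.Rational.Properties as ℚ
open import Data.Rational.Solver using (module +-*-Solver)
open import Data.Sum.Base using (inj₂)
open import Data.Vec.Base using ([]; _∷_)
open import Function.Definitions using (Injective)
open import Level using (0ℓ)
open import Relation.Binary.Core using (Rel)
open import Relation.Binary.Definitions using (Decidable; Symmetric)
open import Relation.Binary.PropositionalEquality
  using (_≡_; _≢_; refl; sym; trans; cong; cong₂; subst)
open import Relation.Nullary using (¬_; Dec)
open import Relation.Nullary.Decidable using (¬?; _→-dec_)

-- Real numbers, as Cauchy sequences of rationals (each with a modulus of
-- convergence) compared up to the equality _≃_ below.

Cauchy : (ℕ → ℚ) → Set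
Cauchy s = ∀ ε → 0ℚ ℚ.< ε →
  ∃ λ N → ∀ m n → N ℕ.≤ m → N ℕ.≤ n → ℚ.∣ s m ℚ.- s n ∣ ℚ.≤ ε

record ℝ : Set where
  constructor mkℝ
  field
    seq    : ℕ → ℚ
    cauchy : Cauchy seq

open ℝ public

infix 4 _≤_ _<_ _≃_

_≤_ : Rel ℝ 0ℓ
x ≤ y = ∀ ε → 0ℚ ℚ.< ε → ∃ λ N → ∀ n → N ℕ.≤ n → seq x n ℚ.≤ seq y n ℚ.+ ε

_<_ : Rel ℝ 0ℓ
x < y = ∃ λ ε → 0ℚ ℚ.< ε × ∃ λ N → ∀ n → N ℕ.≤ n → seq x n ℚ.+ ε ℚ.≤ seq y n

_≃_ : Rel ℝ 0ℓ
x ≃ y = x ≤ y × y ≤ x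

private
  cauchy-const : ∀ q → Cauchy (λ _ → q)
  cauchy-const q ε 0<ε = 0 , λ _ _ _ _ →
    subst (ℚ._≤ ε) (sym (cong ℚ.∣_∣ (ℚ.+-inverseʳ q))) (ℚ.<⇒≤ 0<ε)

  *-pos : ∀ {p q} → 0ℚ ℚ.< p → 0ℚ ℚ.< q → 0ℚ ℚ.< p ℚ.* q
  *-pos {p} {q} 0<p 0<q = ℚ.positive⁻¹ (p ℚ.* q)
    {{ℚ.pos*pos⇒pos p {{ℚ.positive 0<p}} q {{ℚ.positive 0<q}}}}

  halves : ∀ ε → ½ ℚ.* ε ℚ.+ ½ ℚ.* ε ≡ ε
  halves ε = trans (sym (ℚ.*-distribʳ-+ ε ½ ½)) (ℚ.*-identityˡ ε)

  *-mono-≤ : ∀ {p q r s} → 0ℚ ℚ.≤ p → 0ℚ ℚ.≤ s → p ℚ.≤ q → r ℚ.≤ s →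
             p ℚ.* r ℚ.≤ q ℚ.* s
  *-mono-≤ {p} {s = s} 0≤p 0≤s p≤q r≤s = ℚ.≤-trans
    (ℚ.*-monoˡ-≤-nonNeg p {{ℚ.nonNegative 0≤p}} r≤s)
    (ℚ.*-monoʳ-≤-nonNeg s {{ℚ.nonNegative 0≤s}} p≤q)

  quotient : ∀ {p q} → 0ℚ ℚ.< p → 0ℚ ℚ.< q → ∃ λ r → 0ℚ ℚ.< r × r ℚ.* q ≡ p
  quotient {p} {q} 0<p 0<q = p ℚ.* 1/ q
    , *-pos 0<p (ℚ.positive⁻¹ (1/ q) {{ℚ.1/pos⇒pos q}})
    , trans (ℚ.*-assoc p (1/ q) q)
        (trans (cong (p ℚ.*_) (ℚ.*-inverseˡ q)) (ℚ.*-identityʳ p))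
    where
    instance
      _ = ℚ.positive 0<q
      _ = ℚ.pos⇒nonZero q

  eventuallyBounded : ∀ x → ∃ λ B → 0ℚ ℚ.< B ×
    ∃ λ N → ∀ n → N ℕ.≤ n → ℚ.∣ seq x n ∣ ℚ.≤ B
  eventuallyBounded x with cauchy x 1ℚ (ℚ.positive⁻¹ 1ℚ)
  ... | N , close = 1ℚ ℚ.+ ℚ.∣ a ∣ , 0<B , N , λ n N≤n → begin
      ℚ.∣ seq x n ∣                     ≡⟨ cong ℚ.∣_∣ (split (seq x n) a) ⟩
      ℚ.∣ (seq x n ℚ.- a) ℚ.+ a ∣       ≤⟨ ℚ.∣p+q∣≤∣p∣+∣q∣ (seq x n ℚ.- a) a ⟩
      ℚ.∣ seq x n ℚ.- a ∣ ℚ.+ ℚ.∣ a ∣   ≤⟨ ℚ.+-monoˡ-≤ ℚ.∣ a ∣ (close n N N≤n ℕ.≤-refl) ⟩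
      1ℚ ℚ.+ ℚ.∣ a ∣                    ∎
    where
    open ℚ.≤-Reasoning
    a = seq x N
    split : ∀ p q → p ≡ (p ℚ.- q) ℚ.+ q
    split = solve 2 (λ p q → p := (p :- q) :+ q) refl where open +-*-Solver
    0<B : 0ℚ ℚ.< 1ℚ ℚ.+ ℚ.∣ a ∣
    0<B = ℚ.+-mono-<-≤ (ℚ.positive⁻¹ 1ℚ) (ℚ.0≤∣p∣ a)

  *-close : ∀ a b c d {A B δ} → 0ℚ ℚ.≤ B → 0ℚ ℚ.≤ δ →
            ℚ.∣ a ∣ ℚ.≤ A → ℚ.∣ d ∣ ℚ.≤ B →
            ℚ.∣ a ℚ.- c ∣ ℚ.≤ δ → ℚ.∣ b ℚ.- d ∣ ℚ.≤ δ →
            ℚ.∣ a ℚ.* b ℚ.- c ℚ.* d ∣ ℚ.≤ δ ℚ.* (A ℚ.+ B)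
  *-close a b c d {A} {B} {δ} 0≤B 0≤δ ∣a∣≤A ∣d∣≤B ∣a-c∣≤δ ∣b-d∣≤δ = begin
    ℚ.∣ a ℚ.* b ℚ.- c ℚ.* d ∣
      ≡⟨ cong ℚ.∣_∣ (split a b c d) ⟩
    ℚ.∣ a ℚ.* (b ℚ.- d) ℚ.+ (a ℚ.- c) ℚ.* d ∣
      ≤⟨ ℚ.∣p+q∣≤∣p∣+∣q∣ (a ℚ.* (b ℚ.- d)) ((a ℚ.- c) ℚ.* d) ⟩
    ℚ.∣ a ℚ.* (b ℚ.- d) ∣ ℚ.+ ℚ.∣ (a ℚ.- c) ℚ.* d ∣
      ≡⟨ cong₂ ℚ._+_ (ℚ.∣p*q∣≡∣p∣*∣q∣ a (b ℚ.- d)) (ℚ.∣p*q∣≡∣p∣*∣q∣ (a ℚ.- c) d) ⟩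
    ℚ.∣ a ∣ ℚ.* ℚ.∣ b ℚ.- d ∣ ℚ.+ ℚ.∣ a ℚ.- c ∣ ℚ.* ℚ.∣ d ∣
      ≤⟨ ℚ.+-mono-≤ (*-mono-≤ (ℚ.0≤∣p∣ a) 0≤δ ∣a∣≤A ∣b-d∣≤δ)
                    (*-mono-≤ (ℚ.0≤∣p∣ (a ℚ.- c)) 0≤B ∣a-c∣≤δ ∣d∣≤B) ⟩
    A ℚ.* δ ℚ.+ δ ℚ.* B
      ≡⟨ cong (ℚ._+ δ ℚ.* B) (ℚ.*-comm A δ) ⟩
    δ ℚ.* A ℚ.+ δ ℚ.* B
      ≡⟨ sym (ℚ.*-distribˡ-+ δ A B) ⟩
    δ ℚ.* (A ℚ.+ B) ∎
    where
    open ℚ.≤-Reasoning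
    split : ∀ a b c d → a ℚ.* b ℚ.- c ℚ.* d ≡ a ℚ.* (b ℚ.- d) ℚ.+ (a ℚ.- c) ℚ.* d
    split = solve 4 (λ a b c d →
        a :* b :- c :* d := a :* (b :- d) :+ (a :- c) :* d) refl
      where open +-*-Solver

abstract
  cauchy-+ : ∀ x y → Cauchy (λ n → seq x n ℚ.+ seq y n)
  cauchy-+ x y ε 0<ε
    with cauchy x (½ ℚ.* ε) (*-pos (ℚ.positive⁻¹ ½) 0<ε)
       | cauchy y (½ ℚ.* ε) (*-pos (ℚ.positive⁻¹ ½) 0<ε)
  ... | M , closeˣ | N , closeʸ = M ℕ.⊔ N , λ m n ≤m ≤n → begin
      ℚ.∣ (seq x m ℚ.+ seq y m) ℚ.- (seq x n ℚ.+ seq y n) ∣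
        ≡⟨ cong ℚ.∣_∣ (split (seq x m) (seq y m) (seq x n) (seq y n)) ⟩
      ℚ.∣ (seq x m ℚ.- seq x n) ℚ.+ (seq y m ℚ.- seq y n) ∣
        ≤⟨ ℚ.∣p+q∣≤∣p∣+∣q∣ (seq x m ℚ.- seq x n) (seq y m ℚ.- seq y n) ⟩
      ℚ.∣ seq x m ℚ.- seq x n ∣ ℚ.+ ℚ.∣ seq y m ℚ.- seq y n ∣
        ≤⟨ ℚ.+-mono-≤
             (closeˣ m n (ℕ.m⊔n≤o⇒m≤o M N ≤m) (ℕ.m⊔n≤o⇒m≤o M N ≤n))
             (closeʸ m n (ℕ.m⊔n≤o⇒n≤o M N ≤m) (ℕ.m⊔n≤o⇒n≤o M N ≤n)) ⟩
      ½ ℚ.* ε ℚ.+ ½ ℚ.* ε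
        ≡⟨ halves ε ⟩
      ε ∎
    where
    open ℚ.≤-Reasoning
    split : ∀ a b c d → (a ℚ.+ b) ℚ.- (c ℚ.+ d) ≡ (a ℚ.- c) ℚ.+ (b ℚ.- d)
    split = solve 4 (λ a b c d → (a :+ b) :- (c :+ d) := (a :- c) :+ (b :- d)) refl
      where open +-*-Solver

  cauchy-* : ∀ x y → Cauchy (λ n → seq x n ℚ.* seq y n)
  cauchy-* x y ε 0<ε =
    let A , 0<A , K , boundˣ = eventuallyBounded x
        B , 0<B , L , boundʸ = eventuallyBounded y
        δ , 0<δ , δ*[A+B]≡ε = quotient 0<ε (ℚ.+-mono-< 0<A 0<B)
        M , closeˣ = cauchy x δ 0<δ
        N , closeʸ = cauchy y δ 0<δ
    in K ℕ.⊔ L ℕ.⊔ (M ℕ.⊔ N) , λ m n ≤m ≤n →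
      let KL≤m = ℕ.m⊔n≤o⇒m≤o (K ℕ.⊔ L) (M ℕ.⊔ N) ≤m
          KL≤n = ℕ.m⊔n≤o⇒m≤o (K ℕ.⊔ L) (M ℕ.⊔ N) ≤n
          MN≤m = ℕ.m⊔n≤o⇒n≤o (K ℕ.⊔ L) (M ℕ.⊔ N) ≤m
          MN≤n = ℕ.m⊔n≤o⇒n≤o (K ℕ.⊔ L) (M ℕ.⊔ N) ≤n
      in subst (ℚ.∣ seq x m ℚ.* seq y m ℚ.- seq x n ℚ.* seq y n ∣ ℚ.≤_) δ*[A+B]≡ε
           (*-close (seq x m) (seq y m) (seq x n) (seq y n) (ℚ.<⇒≤ 0<B) (ℚ.<⇒≤ 0<δ)
             (boundˣ m (ℕ.m⊔n≤o⇒m≤o K L KL≤m))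
             (boundʸ n (ℕ.m⊔n≤o⇒n≤o K L KL≤n))
             (closeˣ m n (ℕ.m⊔n≤o⇒m≤o M N MN≤m) (ℕ.m⊔n≤o⇒m≤o M N MN≤n))
             (closeʸ m n (ℕ.m⊔n≤o⇒n≤o M N MN≤m) (ℕ.m⊔n≤o⇒n≤o M N MN≤n)))

fromℚ : ℚ → ℝ
fromℚ q = mkℝ (λ _ → q) (cauchy-const q)

0ℝ 1ℝ : ℝ
0ℝ = fromℚ 0ℚ
1ℝ = fromℚ 1ℚ

infixl 6 _+_
infixl 7 _*_

_+_ : ℝ → ℝ → ℝ
x + y = mkℝ (λ n → seq x n ℚ.+ seq y n) (cauchy-+ x y)

_*_ : ℝ → ℝ → ℝ
x * y = mkℝ (λ n → seq x n ℚ.* seq y n) (cauchy-* x y)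

IsMinimum IsMaximum : ∀ {ℓ} → (ℝ → Set ℓ) → ℝ → Set ℓ
IsMinimum S m = S m × (∀ x → S x → m ≤ x)
IsMaximum S m = S m × (∀ x → S x → x ≤ m)

record Graph : Set₁ where
  field
    order  : ℕ
    Adj    : Rel (Fin order) 0ℓ
    adj?   : Decidable Adj
    symm   : Symmetric Adj
    irrefl : ∀ v → ¬ Adj v v

open Graph public

-- H is a (not necessarily induced) subgraph of G, up to isomorphism.
record _⊆ᴳ_ (H G : Graph) : Set where
  field
    vertex    : Fin (order H) → Fin (order G)
    injective : Injective _≡_ _≡_ vertex
    edge      : ∀ {u v} → Adj H u v → Adj G (vertex u) (vertex v)

complete : ℕ → Graph
complete n = record
  { order  = n
  ; Adj    = _≢_
  ; adj?   = λ u v → ¬? (u Fin.≟ v)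
  ; symm   = λ u≢v v≡u → u≢v (sym v≡u)
  ; irrefl = λ _ v≢v → v≢v refl
  }

CliqueFree : ℕ → Graph → Set
CliqueFree r G = ¬ (complete r ⊆ᴳ G)

module _ (G : Graph) where

  Independent : Subset (order G) → Set
  Independent I = ∀ u v → u ∈ I → v ∈ I → ¬ Adj G u v

  independent? : ∀ I → Dec (Independent I)
  independent? I = all? λ u → all? λ v →
    (u ∈? I) →-dec ((v ∈? I) →-dec ¬? (adj? G u v))

subsets : ∀ n → List (Subset n)
subsets 0       = [] ∷ []
subsets (suc n) = map (inside ∷_) (subsets n) ++ map (outside ∷_) (subsets n)

∈-subsets : ∀ {n} (I : Subset n) → I List.∈ subsets n
∈-subsets []          = Any.here refl
∈-subsets (true  ∷ I) = ∈-++⁺ˡ (∈-map⁺ (inside ∷_) (∈-subsets I))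
∈-subsets (false ∷ I) =
  ∈-++⁺ʳ (map (inside ∷_) (subsets _)) (∈-map⁺ (outside ∷_) (∈-subsets I))

independentSets : ∀ G → List (Subset (order G))
independentSets G = filter (independent? G) (subsets (order G))

α : Graph → ℕ
α G = max 0 (map ∣_∣ (independentSets G))

α-nonZero : ∀ G .{{_ : ℕ.NonZero (order G)}} → ℕ.NonZero (α G)
α-nonZero G = ℕ.>-nonZero (v≤max⁺ 0 _ (inj₂ (Any.map
    (λ eq → ℕ.≤-reflexive (trans (sym (∣⁅x⁆∣≡1 v)) eq))
    (∈-map⁺ ∣_∣ (∈-filter⁺ (independent? G) (∈-subsets ⁅ v ⁆) independent)))))
  where
  firstVertex : ∀ n .{{_ : ℕ.NonZero n}} → Fin n
  firstVertex (suc n) = zero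

  v = firstVertex (order G)

  independent : Independent G ⁅ v ⁆
  independent a b a∈ b∈
    with refl ← x∈⁅y⁆⇒x≡y v a∈ | refl ← x∈⁅y⁆⇒x≡y v b∈ = irrefl G v

vertexIndependenceRatio : ∀ H .{{_ : ℕ.NonZero (order H)}} → ℚ
vertexIndependenceRatio H = + order H / α H
  where instance _ = α-nonZero H

SubgraphRatio : Graph → ℝ → Set₁
SubgraphRatio G r = Σ Graph λ H → Σ (ℕ.NonZero (order H)) λ nonEmpty →
  H ⊆ᴳ G × r ≃ fromℚ (vertexIndependenceRatio H {{nonEmpty}})

IsHallRatio : Graph → ℝ → Set₁
IsHallRatio G = IsMaximum (SubgraphRatio G)

module _ (G : Graph) where

  total : (Subset (order G) → ℝ) → List (Subset (order G)) → ℝ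
  total x = foldr (λ I s → x I + s) 0ℝ

  -- Only the values of x at independent sets matter.
  IsFractionalColouring : (Subset (order G) → ℝ) → Set
  IsFractionalColouring x =
    (∀ I → Independent G I → 0ℝ ≤ x I) ×
    (∀ v → 1ℝ ≤ total x (filter (v ∈?_) (independentSets G)))

  FractionalColouringValue : ℝ → Set
  FractionalColouringValue r = ∃ λ (x : Subset (order G) → ℝ) →
    IsFractionalColouring x × r ≃ total x (independentSets G)

  IsFractionalChromaticNumber : ℝ → Set
  IsFractionalChromaticNumber = IsMinimum FractionalColouringValue

module Submission where

-- Let M + 1 ≤ P / 4 be an integer close to P / 4. In an outer graph F on 0, …, k − 1, replace
-- each vertex i by a graph Gᵢ (a lexicographic sum), where F and all Gᵢ are triangle-free
-- with M < χ_f ≤ M + 1. Then K₅ is excluded by pigeonhole, and χ_f multiplies, so that it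
-- exceeds M². The Gᵢ are chosen such that any set of at most |G₀| + … + |G_{i−1}| vertices
-- of Gᵢ spans a bipartite graph. In a subgraph H consider the last block i in which H exceeds
-- this bound: the earlier blocks are smaller than H ∩ Gᵢ, and the later ones are bipartite,
-- hence jointly 2 (M + 1)-colourable fractionally through F. So ρ ≤ 4 (M + 1) ≤ P.
--
-- The building blocks are iterated generalised Mycielski graphs with many levels: a small
-- set of vertices misses some level, hence is bipartite if the previous graph is so
-- locally; and χ_f grows at each step by at most 1 and by an amount bounded below in terms
-- of an upper bound on χ_f.

-- The construction exploits that χ_f of a lexicographic sum does not see how many vertices the
-- blocks have, whereas v(H) / α(H) counts vertices. With equal blocks v / α would be multiplicative
-- as well; with rapidly growing orders a single block outweighs everything before it. The pieces of
-- a subgraph contribute factors 1, 1 and 2, hence the 4 in the bound on ρ, and every constant above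
-- 16 could replace 82 once P is large. As reals are Cauchy sequences, ρ and χ_f have to be
-- exhibited as attained optima. Both are rational: ρ is a maximum over finitely many vertex
-- sequences, χ_f the minimum of a rational linear programme, found by Fourier-Motzkin elimination.
-- Rationality also turns a fractional colouring into a finite list of independent sets, so that the
-- graph arguments become counting in ℕ and `Colourable` becomes decidable. Lower bounds on χ_f need
-- no dual weights: a cheap colouring of a cone or of a lexicographic sum is converted into an
-- impossibly cheap one of a constituent.

open import Data.Bool.Base using (Bool; T; _∧_; _∨_; false; if_then_else_; not; true)
open import Data.List.Base
  using (List; []; _++_; _∷_; allFin; cartesianProductWith; concatMap; filter; length; map; mapMaybe; replicate; upTo)
open import Data.List.Relation.Unary.All using (All; []; _∷_)
open import Data.List.Relation.Unary.AllPairs using ([]; _∷_)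
open import Data.List.Relation.Unary.Any using (here; there)
open import Data.Product.Base using (_,_; _×_; proj₁; proj₂; Σ; ∃; ∃₂)
open import Data.Sum.Base using ([_,_]′; _⊎_; inj₁; inj₂)
open import Function.Base using (_∘_)
open import Relation.Binary.PropositionalEquality
  using (_≡_; _≢_; cong; cong₂; module ≡-Reasoning; refl; subst; subst₂; sym; trans)
open import Relation.Nullary using (Dec; contradiction; does; no; yes; ¬?; ¬_)

-- Finite sums over lists

module ListSums where

  open import Algebra.Structures using (IsCommutativeMonoid)
  open import Data.List.Membership.Propositional using (_∈_)
  import Data.List.Relation.Unary.All as All
  open import Data.List.Relation.Unary.Unique.Propositional using (Unique)
  open import Data.Nat.Base as ℕ using (ℕ; suc; z≤n)
  import Data.Nat.Properties as ℕ
  open import Relation.Binary.Definitions using (DecidableEquality)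
  open import Relation.Unary using (Pred; Decidable)

  -- Instantiated in ℕ to count classes and vertices, and in ℚ to evaluate linear forms.
  module ListSum {C : Set} {_+_ : C → C → C} {0# : C}
                 (+-isCommutativeMonoid : IsCommutativeMonoid _≡_ _+_ 0#) where

    open IsCommutativeMonoid +-isCommutativeMonoid using (identityˡ; assoc; comm)

    ∑ : {A : Set} → List A → (A → C) → C
    ∑ []       f = 0#
    ∑ (x ∷ xs) f = f x + ∑ xs f

    ∑-cong : ∀ {A} (xs : List A) {f g : A → C} → (∀ x → f x ≡ g x) → ∑ xs f ≡ ∑ xs g
    ∑-cong []       f≗g = refl
    ∑-cong (x ∷ xs) f≗g = cong₂ _+_ (f≗g x) (∑-cong xs f≗g)

    ∑-congᴬ : ∀ {A} {xs : List A} {f g : A → C} → All (λ x → f x ≡ g x) xs → ∑ xs f ≡ ∑ xs g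
    ∑-congᴬ []       = refl
    ∑-congᴬ (e ∷ es) = cong₂ _+_ e (∑-congᴬ es)

    ∑-++ : ∀ {A} (xs ys : List A) (f : A → C) → ∑ (xs ++ ys) f ≡ ∑ xs f + ∑ ys f
    ∑-++ []       ys f = sym (identityˡ (∑ ys f))
    ∑-++ (x ∷ xs) ys f =
      trans (cong (f x +_) (∑-++ xs ys f)) (sym (assoc (f x) (∑ xs f) (∑ ys f)))

    ∑-zero : ∀ {A} (xs : List A) → ∑ xs (λ _ → 0#) ≡ 0#
    ∑-zero []       = refl
    ∑-zero (x ∷ xs) = trans (identityˡ _) (∑-zero xs)

    ∑-distrib-+ : ∀ {A} (xs : List A) (f g : A → C) → ∑ xs (λ x → f x + g x) ≡ ∑ xs f + ∑ xs g
    ∑-distrib-+ []       f g = sym (identityˡ 0#)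
    ∑-distrib-+ (x ∷ xs) f g = begin
      (f x + g x) + ∑ xs (λ y → f y + g y)  ≡⟨ cong ((f x + g x) +_) (∑-distrib-+ xs f g) ⟩
      (f x + g x) + (∑ xs f + ∑ xs g)       ≡⟨ assoc (f x) (g x) _ ⟩
      f x + (g x + (∑ xs f + ∑ xs g))       ≡⟨ cong (f x +_) (swap (g x) (∑ xs f) (∑ xs g)) ⟩
      f x + (∑ xs f + (g x + ∑ xs g))       ≡⟨ sym (assoc (f x) (∑ xs f) _) ⟩
      (f x + ∑ xs f) + (g x + ∑ xs g)       ∎
      where
      open ≡-Reasoning
      swap : ∀ a b c → a + (b + c) ≡ b + (a + c)
      swap a b c = trans (sym (assoc a b c)) (trans (cong (_+ c) (comm a b)) (assoc b a c))

    ∑-map : ∀ {A B} (h : B → A) xs (f : A → C) → ∑ (map h xs) f ≡ ∑ xs (λ x → f (h x))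
    ∑-map h []       f = refl
    ∑-map h (x ∷ xs) f = cong (f (h x) +_) (∑-map h xs f)

    ∑-concatMap : ∀ {A B} (h : B → List A) xs (f : A → C) →
                  ∑ (concatMap h xs) f ≡ ∑ xs (λ x → ∑ (h x) f)
    ∑-concatMap h []       f = refl
    ∑-concatMap h (x ∷ xs) f =
      trans (∑-++ (h x) (concatMap h xs) f) (cong (∑ (h x) f +_) (∑-concatMap h xs f))

    ∑-swap : ∀ {A B} (xs : List A) (ys : List B) (f : A → B → C) →
             ∑ xs (λ x → ∑ ys (f x)) ≡ ∑ ys (λ y → ∑ xs (λ x → f x y))
    ∑-swap []       ys f = sym (∑-zero ys)
    ∑-swap (x ∷ xs) ys f =
      trans (cong (∑ ys (f x) +_) (∑-swap xs ys f))
            (sym (∑-distrib-+ ys (f x) (λ y → ∑ xs (λ z → f z y))))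

    ∑-filter : ∀ {A} {p} {P : Pred A p} (P? : Decidable P) xs (f : A → C) →
               ∑ (filter P? xs) f ≡ ∑ xs (λ x → if does (P? x) then f x else 0#)
    ∑-filter P? []       f = refl
    ∑-filter P? (x ∷ xs) f with does (P? x)
    ... | true  = cong (f x +_) (∑-filter P? xs f)
    ... | false = trans (∑-filter P? xs f) (sym (identityˡ _))

    module _ {A : Set} (_≟_ : DecidableEquality A) where

      ∑-δ-∉ : ∀ {xs y} (f : A → C) → All (y ≢_) xs →
              ∑ xs (λ x → if does (x ≟ y) then f x else 0#) ≡ 0#
      ∑-δ-∉ f [] = refl
      ∑-δ-∉ {x ∷ _} {y} f (y≢x ∷ y∉) with x ≟ y
      ... | yes refl = contradiction refl y≢x
      ... | no  _    = trans (identityˡ _) (∑-δ-∉ f y∉)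

      ∑-δ : ∀ {xs y} (f : A → C) → Unique xs → y ∈ xs →
            ∑ xs (λ x → if does (x ≟ y) then f x else 0#) ≡ f y
      ∑-δ {x ∷ _} {y} f (x∉ ∷ _) (here refl) with y ≟ y
      ... | yes _  = trans (cong (f y +_) (∑-δ-∉ f x∉)) (trans (comm _ _) (identityˡ _))
      ... | no y≢y = contradiction refl y≢y
      ∑-δ {x ∷ _} {y} f (x∉ ∷ u) (there y∈) with x ≟ y
      ... | yes refl = contradiction refl (All.lookup x∉ y∈)
      ... | no  _    = trans (identityˡ _) (∑-δ f u y∈)

  open ListSum ℕ.+-0-isCommutativeMonoid public

  ⟦_⟧ : Bool → ℕ
  ⟦ b ⟧ = if b then 1 else 0

  module _ where
    open import Data.Nat.Base using (_+_; _*_; _≤_; _<_)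

    ∑-mono : ∀ {A : Set} (xs : List A) {f g} → (∀ x → f x ≤ g x) → ∑ xs f ≤ ∑ xs g
    ∑-mono []       f≤g = z≤n
    ∑-mono (x ∷ xs) f≤g = ℕ.+-mono-≤ (f≤g x) (∑-mono xs f≤g)

    ∑-monoᴬ : ∀ {A : Set} {xs : List A} {f g} → All (λ x → f x ≤ g x) xs → ∑ xs f ≤ ∑ xs g
    ∑-monoᴬ []       = z≤n
    ∑-monoᴬ (l ∷ ls) = ℕ.+-mono-≤ l (∑-monoᴬ ls)

    ∑-const : ∀ {A : Set} (xs : List A) c → ∑ xs (λ _ → c) ≡ length xs * c
    ∑-const []       c = refl
    ∑-const (x ∷ xs) c = cong (c +_) (∑-const xs c)

    *-distribˡ-∑ : ∀ {A : Set} c (xs : List A) f → c * ∑ xs f ≡ ∑ xs (λ x → c * f x)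
    *-distribˡ-∑ c []       f = ℕ.*-zeroʳ c
    *-distribˡ-∑ c (x ∷ xs) f =
      trans (ℕ.*-distribˡ-+ c (f x) (∑ xs f)) (cong (c * f x +_) (*-distribˡ-∑ c xs f))

    length-∑ : ∀ {A : Set} (xs : List A) → length xs ≡ ∑ xs (λ _ → 1)
    length-∑ xs = sym (trans (∑-const xs 1) (ℕ.*-identityʳ _))

    average≤max : ∀ {A : Set} x (xs : List A) f c → length (x ∷ xs) * c ≤ ∑ (x ∷ xs) f →
                  ∃ λ y → y ∈ x ∷ xs × c ≤ f y
    average≤max x []       f c le =
      x , here refl , subst₂ _≤_ (ℕ.+-identityʳ c) (ℕ.+-identityʳ (f x)) le
    average≤max x (y ∷ ys) f c le with c ℕ.≤? f x
    ... | yes c≤fx = x , here refl , c≤fx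
    ... | no  c≰fx =
      let z , z∈ , c≤fz = average≤max y ys f c (ℕ.+-cancelˡ-≤ c _ _
            (ℕ.≤-trans le (ℕ.+-monoˡ-≤ (∑ (y ∷ ys) f) (ℕ.<⇒≤ (ℕ.≰⇒> c≰fx)))))
      in z , there z∈ , c≤fz

    ∑-δ≤1 : ∀ {A : Set} (_≟_ : DecidableEquality A) {xs} y → Unique xs →
            ∑ xs (λ x → ⟦ does (x ≟ y) ⟧) ≤ 1
    ∑-δ≤1 _≟_ y [] = z≤n
    ∑-δ≤1 _≟_ {x ∷ xs} y (x∉ ∷ u) with x ≟ y
    ... | yes refl = ℕ.≤-reflexive (cong suc (∑-δ-∉ _≟_ (λ _ → 1) x∉))
    ... | no  _    = ∑-δ≤1 _≟_ y u

-- Linear programming over ℚ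

module LinearProgramming where

  open ListSums using (module ListSum)
  import Data.List.Relation.Unary.All as All
  import Data.List.Relation.Unary.All.Properties as All
  open import Data.List.Relation.Unary.Unique.Propositional using (Unique)
  open import Data.Rational.Base
  open import Data.Rational.Properties
  open import Data.Rational.Solver using (module +-*-Solver)
  open import Data.Unit.Base using (⊤; tt)
  open import Relation.Binary.Definitions using (DecidableEquality; tri<; tri≈; tri>)

  module ℚ-sum = ListSum +-0-isCommutativeMonoid
  open ℚ-sum public using () renaming (∑ to ∑ℚ)

  -- This is the back substitution of the elimination: start from the minimum of 0 and the upper
  -- bounds, and raise it to each lower bound in turn. No lower bound exceeds an upper bound, so the
  -- upper bounds survive.
  between : ∀ ls us → All (λ l → All (l ≤_) us) ls →
            ∃ λ x → All (_≤ x) ls × All (x ≤_) us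
  between []       []       _          = 0ℚ , [] , []
  between []       (u ∷ us) _          =
    let x , _ , x≤us = between [] us []
    in x ⊓ u , [] , p⊓q≤q x u ∷ All.map (≤-trans (p⊓q≤p x u)) x≤us
  between (l ∷ ls) us       (l≤ ∷ ls≤) =
    let x , ls≤x , x≤us = between ls us ls≤
    in x ⊔ l
     , p≤q⊔p x l ∷ All.map (λ z≤x → ≤-trans z≤x (p≤p⊔q x l)) ls≤x
     , All.zipWith (λ (x≤u , l≤u) → ⊔-lub x≤u l≤u) (x≤us , l≤)

  module _ where
    open ≤-Reasoning
    open +-*-Solver

    0≤x+y⇒-y≤x : ∀ {x y} → 0ℚ ≤ x + y → - y ≤ x
    0≤x+y⇒-y≤x {x} {y} 0≤ = begin
      - y            ≡⟨ sym (+-identityʳ (- y)) ⟩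
      - y + 0ℚ       ≤⟨ +-monoʳ-≤ (- y) 0≤ ⟩
      - y + (x + y)  ≡⟨ solve 2 (λ x y → :- y :+ (x :+ y) := x) refl x y ⟩
      x              ∎

    -y≤x⇒0≤x+y : ∀ {x y} → - y ≤ x → 0ℚ ≤ x + y
    -y≤x⇒0≤x+y {x} {y} le = begin
      0ℚ       ≡⟨ sym (+-inverseˡ y) ⟩
      - y + y  ≤⟨ +-monoˡ-≤ y le ⟩
      x + y    ∎

    0≤*⁺ : ∀ {r x} → 0ℚ < r → 0ℚ ≤ x → 0ℚ ≤ r * x
    0≤*⁺ {r} {x} 0<r 0≤x = begin
      0ℚ      ≡⟨ sym (*-zeroʳ r) ⟩
      r * 0ℚ  ≤⟨ *-monoˡ-≤-nonNeg r {{nonNegative (<⇒≤ 0<r)}} 0≤x ⟩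
      r * x   ∎

  0<1/ : ∀ {c} (0<c : 0ℚ < c) → 0ℚ < (1/ c) {{>-nonZero 0<c}}
  0<1/ {c} 0<c = positive⁻¹ _ {{1/pos⇒pos c {{positive 0<c}}}}

  recip : ∀ {c} → 0ℚ < c → ∃ λ r → 0ℚ < r × r * c ≡ 1ℚ
  recip {c} 0<c = (1/ c) {{>-nonZero 0<c}} , 0<1/ 0<c , *-inverseˡ c {{>-nonZero 0<c}}

  module _ where
    open +-*-Solver

    scaled : ∀ r c x e → r * c ≡ 1ℚ → r * (c * x + e) ≡ x + r * e
    scaled r c x e rc≡1 = begin
      r * (c * x + e)    ≡⟨ solve 4 (λ r c x e → r :* (c :* x :+ e) := (r :* c) :* x :+ r :* e) refl r c x e ⟩
      r * c * x + r * e  ≡⟨ cong (λ s → s * x + r * e) rc≡1 ⟩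
      1ℚ * x + r * e     ≡⟨ cong (_+ r * e) (*-identityˡ x) ⟩
      x + r * e          ∎
      where open ≡-Reasoning

    unscaled : ∀ r c x e → r * c ≡ 1ℚ → c * (x + r * e) ≡ c * x + e
    unscaled r c x e rc≡1 = begin
      c * (x + r * e)    ≡⟨ solve 4 (λ r c x e → c :* (x :+ r :* e) := c :* x :+ (r :* c) :* e) refl r c x e ⟩
      c * x + r * c * e  ≡⟨ cong (λ s → c * x + s * e) rc≡1 ⟩
      c * x + 1ℚ * e     ≡⟨ cong (c * x +_) (*-identityˡ e) ⟩
      c * x + e          ∎
      where open ≡-Reasoning

    neg-involutive : ∀ x → - (- x) ≡ x
    neg-involutive = solve 1 (λ x → :- (:- x) := x) refl

    negated : ∀ c x → c * x ≡ - c * - x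
    negated = solve 2 (λ c x → c :* x := :- c :* :- x) refl

  -- One step of Fourier–Motzkin elimination: a pair (c , e) stands for the
  -- constraint 0 ≤ c · x + val e on the variable x to be eliminated.
  module Elimination {E Env : Set} (val : Env → E → ℚ)
    (_⊕_ : E → E → E) (val-⊕ : ∀ ρ e f → val ρ (e ⊕ f) ≡ val ρ e + val ρ f)
    (_⊙_ : ℚ → E → E) (val-⊙ : ∀ ρ c e → val ρ (c ⊙ e) ≡ c * val ρ e) where

    record Split : Set where
      constructor mkSplit
      field lowers uppers rests : List E

    open Split public

    -- Division by the absolute value of c makes the coefficient of x equal to 1 or -1. A lower l
    -- then means x ≥ - val l, and an upper u means x ≤ val u.
    split : List (ℚ × E) → Split
    split [] = mkSplit [] [] []
    split ((c , e) ∷ C) with <-cmp 0ℚ c | split C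
    ... | tri< 0<c _ _ | mkSplit ls us zs = mkSplit (proj₁ (recip 0<c) ⊙ e ∷ ls) us zs
    ... | tri≈ _ _ _   | mkSplit ls us zs = mkSplit ls us (e ∷ zs)
    ... | tri> _ _ c<0 | mkSplit ls us zs =
      mkSplit ls (proj₁ (recip (neg-antimono-< c<0)) ⊙ e ∷ us) zs

    Sat : Env → ℚ → List (ℚ × E) → Set
    Sat ρ x = All (λ (c , e) → 0ℚ ≤ c * x + val ρ e)

    record SatSplit (ρ : Env) (x : ℚ) (S : Split) : Set where
      constructor mkSat
      field
        above : All (λ l → 0ℚ ≤ x + val ρ l) (lowers S)
        below : All (λ u → 0ℚ ≤ - x + val ρ u) (uppers S)
        free  : All (λ z → 0ℚ ≤ val ρ z) (rests S)

    private
      zeroTerm : ∀ {c} x e → 0ℚ ≡ c → c * x + e ≡ e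
      zeroTerm x e refl = trans (cong (_+ e) (*-zeroˡ x)) (+-identityˡ e)

    split⁺ : ∀ {ρ x} C → Sat ρ x C → SatSplit ρ x (split C)
    split⁺ [] [] = mkSat [] [] []
    split⁺ {ρ} {x} ((c , e) ∷ C) (s ∷ ss) with <-cmp 0ℚ c | split C | split⁺ C ss
    ... | tri< 0<c _ _ | mkSplit _ _ _ | mkSat a b f =
      let r , 0<r , rc≡1 = recip 0<c in
      mkSat (subst (0ℚ ≤_) (trans (scaled r c x (val ρ e) rc≡1) (cong (x +_) (sym (val-⊙ ρ r e))))
                   (0≤*⁺ 0<r s) ∷ a) b f
    ... | tri≈ _ 0≡c _ | mkSplit _ _ _ | mkSat a b f =
      mkSat a b (subst (0ℚ ≤_) (zeroTerm x (val ρ e) 0≡c) s ∷ f)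
    ... | tri> _ _ c<0 | mkSplit _ _ _ | mkSat a b f =
      let r , 0<r , rc≡1 = recip (neg-antimono-< c<0) in
      mkSat a (subst (0ℚ ≤_)
        (trans (cong (λ y → r * (y + val ρ e)) (negated c x))
          (trans (scaled r (- c) (- x) (val ρ e) rc≡1) (cong (- x +_) (sym (val-⊙ ρ r e)))))
        (0≤*⁺ 0<r s) ∷ b) f

    split⁻ : ∀ {ρ x} C → SatSplit ρ x (split C) → Sat ρ x C
    split⁻ [] _ = []
    split⁻ {ρ} {x} ((c , e) ∷ C) s with <-cmp 0ℚ c | split C | split⁻ {ρ} {x} C
    split⁻ {ρ} {x} ((c , e) ∷ C) (mkSat (l ∷ a) b f) | tri< 0<c _ _ | mkSplit _ _ _ | rec =
      let r , 0<r , rc≡1 = recip 0<c in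
      subst (0ℚ ≤_)
        (trans (cong (λ y → c * (x + y)) (val-⊙ ρ r e)) (unscaled r c x (val ρ e) rc≡1))
        (0≤*⁺ 0<c l) ∷ rec (mkSat a b f)
    split⁻ {ρ} {x} ((c , e) ∷ C) (mkSat a b (z ∷ f)) | tri≈ _ 0≡c _ | mkSplit _ _ _ | rec =
      subst (0ℚ ≤_) (sym (zeroTerm x (val ρ e) 0≡c)) z ∷ rec (mkSat a b f)
    split⁻ {ρ} {x} ((c , e) ∷ C) (mkSat a (u ∷ b) f) | tri> _ _ c<0 | mkSplit _ _ _ | rec =
      let r , 0<r , rc≡1 = recip (neg-antimono-< c<0) in
      subst (0ℚ ≤_)
        (trans (cong (λ y → - c * (- x + y)) (val-⊙ ρ r e))
          (trans (unscaled r (- c) (- x) (val ρ e) rc≡1) (cong (_+ val ρ e) (sym (negated c x)))))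
        (0≤*⁺ (neg-antimono-< c<0) u) ∷ rec (mkSat a b f)

    -- Adding a lower l to an upper u cancels x and leaves - val l ≤ val u. These inequalities, for
    -- all pairs, are exactly what `between` needs in order to recover x.
    project : List (ℚ × E) → List E
    project C = rests S ++ concatMap (λ l → map (l ⊕_) (uppers S)) (lowers S)
      where S = split C

    private
      combine : ∀ x l u → (x + l) + (- x + u) ≡ l + u
      combine = solve 3 (λ x l u → (x :+ l) :+ (:- x :+ u) := l :+ u) refl
        where open +-*-Solver

    project⁺ : ∀ {ρ x} C → Sat ρ x C → All (λ e → 0ℚ ≤ val ρ e) (project C)
    project⁺ {ρ} {x} C s with mkSat above below free ← split⁺ {ρ} {x} C s =
      All.++⁺ free (All.concat⁺ (All.map⁺ (All.map (λ {l} 0≤l → All.map⁺ (All.map (λ {u} 0≤u →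
        subst (0ℚ ≤_) (trans (combine x (val ρ l) (val ρ u)) (sym (val-⊕ ρ l u)))
              (+-mono-≤ 0≤l 0≤u)) below)) above)))

    project⁻ : ∀ {ρ} C → All (λ e → 0ℚ ≤ val ρ e) (project C) → ∃ λ x → Sat ρ x C
    project⁻ {ρ} C s =
      let S = split C
          free , pairs = All.++⁻ (rests S) s
          x , ls≤x , x≤us = between (map (λ l → - val ρ l) (lowers S)) (map (val ρ) (uppers S))
            (All.map⁺ (All.map (λ {l} s → All.map⁺ (All.map (λ {u} 0≤ →
                0≤x+y⇒-y≤x (subst (0ℚ ≤_) (trans (val-⊕ ρ l u) (+-comm (val ρ l) (val ρ u))) 0≤))
              (All.map⁻ s))) (All.map⁻ (All.concat⁻ pairs))))
      in x , split⁻ C (mkSat (All.map -y≤x⇒0≤x+y (All.map⁻ ls≤x))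
                             (All.map (λ {u} x≤u → subst (0ℚ ≤_) (+-comm (val ρ u) (- x))
                                (-y≤x⇒0≤x+y (subst (_≤ val ρ u) (sym (neg-involutive x)) x≤u)))
                                (All.map⁻ x≤us))
                             free)

  module LinearProgram {A : Set} (_≟_ : DecidableEquality A) where

    -- The affine form Σ φ a · x a + τ · t + d in the variables x and the objective t.
    Form : Set
    Form = (A → ℚ) × ℚ × ℚ

    value : List A → (A → ℚ) × ℚ → Form → ℚ
    value xs (x , t) (φ , τ , d) = ∑ℚ xs (λ a → φ a * x a) + (τ * t + d)

    Feasible : List A → List Form → (A → ℚ) → ℚ → Set
    Feasible xs C x t = All (λ e → 0ℚ ≤ value xs (x , t) e) C

    private
      _⊕_ : Form → Form → Form
      (φ , τ , d) ⊕ (φ′ , τ′ , d′) = (λ a → φ a + φ′ a) , τ + τ′ , d + d′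

      _⊙_ : ℚ → Form → Form
      r ⊙ (φ , τ , d) = (λ a → r * φ a) , r * τ , r * d

      value-[] : ∀ x t τ d φ → value [] (x , t) (φ , τ , d) ≡ τ * t + d
      value-[] x t τ d φ = +-identityˡ (τ * t + d)

      value-∷ : ∀ a xs x t e → value (a ∷ xs) (x , t) e ≡ proj₁ e a * x a + value xs (x , t) e
      value-∷ a xs x t (φ , τ , d) = +-assoc (φ a * x a) (∑ℚ xs (λ a → φ a * x a)) (τ * t + d)

      add₀ : ∀ t τ d τ′ d′ → (τ + τ′) * t + (d + d′) ≡ (τ * t + d) + (τ′ * t + d′)
      add₀ = solve 5 (λ t τ d τ′ d′ → (τ :+ τ′) :* t :+ (d :+ d′) :=
        (τ :* t :+ d) :+ (τ′ :* t :+ d′)) refl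
        where open +-*-Solver

      add₁ : ∀ p q y v w → (p + q) * y + (v + w) ≡ (p * y + v) + (q * y + w)
      add₁ = solve 5 (λ p q y v w → (p :+ q) :* y :+ (v :+ w) :=
        (p :* y :+ v) :+ (q :* y :+ w)) refl
        where open +-*-Solver

      scale₁ : ∀ r p y v → (r * p) * y + r * v ≡ r * (p * y + v)
      scale₁ = solve 4 (λ r p y v → (r :* p) :* y :+ r :* v := r :* (p :* y :+ v)) refl
        where open +-*-Solver

      value-⊕ : ∀ xs ρ e f → value xs ρ (e ⊕ f) ≡ value xs ρ e + value xs ρ f
      value-⊕ [] (x , t) (φ , τ , d) (φ′ , τ′ , d′) = begin
        value [] (x , t) ((φ , τ , d) ⊕ (φ′ , τ′ , d′))
          ≡⟨ value-[] x t (τ + τ′) (d + d′) (λ a → φ a + φ′ a) ⟩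
        (τ + τ′) * t + (d + d′)
          ≡⟨ add₀ t τ d τ′ d′ ⟩
        (τ * t + d) + (τ′ * t + d′)
          ≡⟨ sym (cong₂ _+_ (value-[] x t τ d φ) (value-[] x t τ′ d′ φ′)) ⟩
        value [] (x , t) (φ , τ , d) + value [] (x , t) (φ′ , τ′ , d′) ∎
        where open ≡-Reasoning
      value-⊕ (a ∷ xs) ρ@(x , t) e@(φ , τ , d) f@(φ′ , τ′ , d′) = begin
        value (a ∷ xs) ρ (e ⊕ f)
          ≡⟨ value-∷ a xs x t (e ⊕ f) ⟩
        (φ a + φ′ a) * x a + value xs ρ (e ⊕ f)
          ≡⟨ cong ((φ a + φ′ a) * x a +_) (value-⊕ xs ρ e f) ⟩
        (φ a + φ′ a) * x a + (value xs ρ e + value xs ρ f)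
          ≡⟨ add₁ (φ a) (φ′ a) (x a) (value xs ρ e) (value xs ρ f) ⟩
        (φ a * x a + value xs ρ e) + (φ′ a * x a + value xs ρ f)
          ≡⟨ sym (cong₂ _+_ (value-∷ a xs x t e) (value-∷ a xs x t f)) ⟩
        value (a ∷ xs) ρ e + value (a ∷ xs) ρ f ∎
        where open ≡-Reasoning

      value-⊙ : ∀ xs ρ r e → value xs ρ (r ⊙ e) ≡ r * value xs ρ e
      value-⊙ [] (x , t) r (φ , τ , d) = begin
        value [] (x , t) (r ⊙ (φ , τ , d))  ≡⟨ value-[] x t (r * τ) (r * d) (λ a → r * φ a) ⟩
        (r * τ) * t + r * d                 ≡⟨ scale₁ r τ t d ⟩
        r * (τ * t + d)                     ≡⟨ sym (cong (r *_) (value-[] x t τ d φ)) ⟩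
        r * value [] (x , t) (φ , τ , d)    ∎
        where open ≡-Reasoning
      value-⊙ (a ∷ xs) ρ@(x , t) r e@(φ , τ , d) = begin
        value (a ∷ xs) ρ (r ⊙ e)                ≡⟨ value-∷ a xs x t (r ⊙ e) ⟩
        (r * φ a) * x a + value xs ρ (r ⊙ e)    ≡⟨ cong ((r * φ a) * x a +_) (value-⊙ xs ρ r e) ⟩
        (r * φ a) * x a + r * value xs ρ e      ≡⟨ scale₁ r (φ a) (x a) (value xs ρ e) ⟩
        r * (φ a * x a + value xs ρ e)          ≡⟨ sym (cong (r *_) (value-∷ a xs x t e)) ⟩
        r * value (a ∷ xs) ρ e                  ∎
        where open ≡-Reasoning

      _[_≔_] : (A → ℚ) → A → ℚ → A → ℚ
      (x [ a ≔ v ]) b = if does (b ≟ a) then v else x b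

      ∑-fresh : ∀ {a xs} (φ x : A → ℚ) v → All (a ≢_) xs →
                ∑ℚ xs (λ b → φ b * (x [ a ≔ v ]) b) ≡ ∑ℚ xs (λ b → φ b * x b)
      ∑-fresh φ x v [] = refl
      ∑-fresh {a} {b ∷ _} φ x v (a≢b ∷ a∉) with b ≟ a
      ... | yes refl = contradiction refl a≢b
      ... | no  _    = cong (φ b * x b +_) (∑-fresh φ x v a∉)

      value-≔ : ∀ {a xs} x v t e → All (a ≢_) xs →
                value (a ∷ xs) (x [ a ≔ v ] , t) e ≡ proj₁ e a * v + value xs (x , t) e
      value-≔ {a} {xs} x v t (φ , τ , d) a∉ with a ≟ a
      ... | yes _  = trans (+-assoc (φ a * v) _ _)
                           (cong (λ s → φ a * v + (s + (τ * t + d))) (∑-fresh φ x v a∉))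
      ... | no a≢a = contradiction refl a≢a

      module Step xs = Elimination (value xs) _⊕_ (value-⊕ xs) _⊙_ (value-⊙ xs)

      eliminate : A → List A → List Form → List Form
      eliminate a xs C = Step.project xs (map (λ e → proj₁ e a , e) C)

      eliminate⁺ : ∀ a xs C {x t} → Feasible (a ∷ xs) C x t → Feasible xs (eliminate a xs C) x t
      eliminate⁺ a xs C {x} {t} s = Step.project⁺ xs {x = x a} (map (λ e → proj₁ e a , e) C)
        (All.map⁺ (All.map (λ {e} → subst (0ℚ ≤_) (value-∷ a xs x t e)) s))

      eliminate⁻ : ∀ {a xs} C {x t} → All (a ≢_) xs → Feasible xs (eliminate a xs C) x t →
                   ∃ λ y → Feasible (a ∷ xs) C y t
      eliminate⁻ {a} {xs} C {x} {t} a∉ s =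
        let v , s′ = Step.project⁻ xs (map (λ e → proj₁ e a , e) C) s
        in x [ a ≔ v ] , All.map (λ {e} → subst (0ℚ ≤_) (sym (value-≔ x v t e a∉))) (All.map⁻ s′)

      module Base = Elimination {ℚ} {⊤} (λ _ e → e) _+_ (λ _ _ _ → refl) _*_ (λ _ _ _ → refl)

      -- Counting 0 among the lower bounds gives a maximum even of an empty list. It does no harm
      -- because `minimum` assumes that feasible objectives are nonnegative.
      leastAbove : ∀ ls → ∃ λ m → 0ℚ ≤ m × All (λ l → 0ℚ ≤ m + l) ls ×
                   (∀ {t} → 0ℚ ≤ t → All (λ l → 0ℚ ≤ t + l) ls → m ≤ t)
      leastAbove [] = 0ℚ , ≤-refl , [] , λ 0≤t _ → 0≤t
      leastAbove (l ∷ ls) =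
        let m , 0≤m , above , least = leastAbove ls
        in m ⊔ - l
         , ≤-trans 0≤m (p≤p⊔q m (- l))
         , -y≤x⇒0≤x+y (p≤q⊔p m (- l))
           ∷ All.map (λ {k} 0≤ → ≤-trans 0≤ (+-monoˡ-≤ k (p≤p⊔q m (- l)))) above
         , λ { 0≤t (a ∷ as) → ⊔-lub (least 0≤t as) (0≤x+y⇒-y≤x a) }

      constants : List Form → List (ℚ × ℚ)
      constants = map proj₂

      base⁺ : ∀ {C x t} → Feasible [] C x t → Base.Sat tt t (constants C)
      base⁺ {x = x} {t} s = All.map⁺ (All.map (λ {e} → subst (0ℚ ≤_) (value-[] x t (proj₁ (proj₂ e)) (proj₂ (proj₂ e)) (proj₁ e))) s)

      base⁻ : ∀ {C x t} → Base.Sat tt t (constants C) → Feasible [] C x t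
      base⁻ {x = x} {t} s = All.map (λ {e} → subst (0ℚ ≤_) (sym (value-[] x t (proj₁ (proj₂ e)) (proj₂ (proj₂ e)) (proj₁ e)))) (All.map⁻ s)

    -- The objective t is an additional variable that is never eliminated. Once all x are gone, the
    -- constraints bound t alone, the largest lower bound is optimal, and `eliminate⁻` extends it
    -- back to the x. Nonnegativity of feasible objectives excludes an unbounded programme.
    minimum : ∀ {xs} → Unique xs → ∀ C x t → Feasible xs C x t →
              (∀ y s → Feasible xs C y s → 0ℚ ≤ s) →
              ∃₂ λ y m → Feasible xs C y m × (∀ z s → Feasible xs C z s → m ≤ s)
    minimum {[]} _ C x t s 0≤
      with Base.mkSat above below free ← Base.split⁺ {tt} {t} (constants C) (base⁺ {C} {x} {t} s) =
      let m , _ , above′ , least = leastAbove (Base.lowers (Base.split (constants C)))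
          m≤t = least (0≤ x t s) above
          -- Moving down from the feasible t to m cannot violate an upper bound.
          below′ = All.map (λ {u} 0≤u → ≤-trans 0≤u (+-monoˡ-≤ u (neg-antimono-≤ m≤t))) below
      in x , m , base⁻ {C} {x} {m} (Base.split⁻ {tt} {m} (constants C) (Base.mkSat above′ below′ free))
       , λ z s s′ → least (0≤ z s s′)
           (Base.SatSplit.above (Base.split⁺ {tt} {s} (constants C) (base⁺ {C} {z} {s} s′)))
    minimum {a ∷ xs} (a∉ ∷ u) C x t s 0≤ =
      let y , m , s′ , least = minimum u (eliminate a xs C) x t (eliminate⁺ a xs C {x} {t} s)
            (λ y r s″ → let z , s‴ = eliminate⁻ C {y} {r} a∉ s″ in 0≤ z r s‴)
          z , s″ = eliminate⁻ C {y} {m} a∉ s′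
      in z , m , s″ , λ v r s‴ → least v r (eliminate⁺ a xs C {v} {r} s‴)

-- The embedding of ℕ in ℚ and denominators

module NaturalsInℚ where

  open ListSums using (∑)
  open LinearProgramming using (∑ℚ)
  open import Data.Integer.Base as ℤ using (+_; -[1+_])
  import Data.Integer.Properties as ℤ
  open import Data.Nat.Base as ℕ using (ℕ; suc)
  import Data.Nat.Properties as ℕ
  open import Data.Rational.Base
  open import Data.Rational.Literals using (fromℤ)
  open import Data.Rational.Properties
  import Data.Rational.Unnormalised.Base as ℚᵘ
  import Data.Rational.Unnormalised.Properties as ℚᵘ

  cast : ℕ → ℚ
  cast n = fromℤ (+ n)

  cast-+ : ∀ m n → cast (m ℕ.+ n) ≡ cast m + cast n
  cast-+ m n = toℚᵘ-injective (ℚᵘ.≃-trans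
    (ℚᵘ.*≡* (cong (ℤ._* + 1) (sym (cong₂ ℤ._+_ (ℤ.*-identityʳ (+ m)) (ℤ.*-identityʳ (+ n))))))
    (ℚᵘ.≃-sym (toℚᵘ-homo-+ (cast m) (cast n))))

  cast-* : ∀ m n → cast (m ℕ.* n) ≡ cast m * cast n
  cast-* m n = toℚᵘ-injective (ℚᵘ.≃-trans
    (ℚᵘ.*≡* (cong (ℤ._* + 1) (ℤ.pos-* m n)))
    (ℚᵘ.≃-sym (toℚᵘ-homo-* (cast m) (cast n))))

  cast-mono : ∀ {m n} → m ℕ.≤ n → cast m ≤ cast n
  cast-mono {m} {n} m≤n = *≤* (ℤ.*-monoʳ-≤-nonNeg (+ 1) (ℤ.+≤+ m≤n))

  cast-cancel : ∀ {m n} → cast m ≤ cast n → m ℕ.≤ n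
  cast-cancel {m} {n} (*≤* le) = ℤ.drop‿+≤+ (ℤ.*-cancelʳ-≤-pos (+ m) (+ n) (+ 1) le)

  0≤cast : ∀ n → 0ℚ ≤ cast n
  0≤cast n = cast-mono ℕ.z≤n

  cast-∑ : ∀ {A : Set} (xs : List A) f → cast (∑ xs f) ≡ ∑ℚ xs (λ x → cast (f x))
  cast-∑ []       f = refl
  cast-∑ (x ∷ xs) f = trans (cast-+ (f x) (∑ xs f)) (cong (λ s → cast (f x) + s) (cast-∑ xs f))

  clearDenominator : ∀ q → 0ℚ ≤ q → ∃₂ λ d n → cast (suc d) * q ≡ cast n
  clearDenominator q@(mkℚ (+ n) d _) _ = d , n , toℚᵘ-injective (ℚᵘ.≃-trans
    (toℚᵘ-homo-* (cast (suc d)) q)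
    (ℚᵘ.*≡* (begin
      + suc d ℤ.* + n ℤ.* + 1         ≡⟨ ℤ.*-identityʳ _ ⟩
      + suc d ℤ.* + n                 ≡⟨ ℤ.*-comm (+ suc d) (+ n) ⟩
      + n ℤ.* + suc d                 ≡⟨ cong (λ k → + n ℤ.* + suc k) (sym (ℕ.+-identityʳ d)) ⟩
      + n ℤ.* + (suc d ℕ.+ 0)         ∎)))
    where open ≡-Reasoning
  clearDenominator (mkℚ -[1+ n ] d _) (*≤* ())

  /-≤-cast : ∀ m n k .{{_ : ℕ.NonZero n}} → m ℕ.≤ k ℕ.* n → + m / n ≤ cast k
  /-≤-cast m n@(suc n-1) k m≤kn = toℚᵘ-cancel-≤ (ℚᵘ.≤-respˡ-≃
    (ℚᵘ.≃-sym (toℚᵘ-fromℚᵘ (ℚᵘ.mkℚᵘ (+ m) n-1)))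
    (ℚᵘ.*≤* (subst₂ ℤ._≤_ (sym (ℤ.*-identityʳ (+ m))) (ℤ.pos-* k n) (ℤ.+≤+ m≤kn))))

  /-mono-≤ : ∀ m {a b} .{{_ : ℕ.NonZero a}} .{{_ : ℕ.NonZero b}} → a ℕ.≤ b → + m / b ≤ + m / a
  /-mono-≤ m {a@(suc a-1)} {b@(suc b-1)} a≤b = toℚᵘ-cancel-≤
    (ℚᵘ.≤-respˡ-≃ (ℚᵘ.≃-sym (toℚᵘ-fromℚᵘ (ℚᵘ.mkℚᵘ (+ m) b-1)))
    (ℚᵘ.≤-respʳ-≃ (ℚᵘ.≃-sym (toℚᵘ-fromℚᵘ (ℚᵘ.mkℚᵘ (+ m) a-1)))
    (ℚᵘ.*≤* (ℤ.*-monoˡ-≤-nonNeg (+ m) (ℤ.+≤+ a≤b)))))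

  archimedean : ∀ q → ∃ λ n → q ≤ cast n
  archimedean q@(mkℚ (+ n) d _) = n , *≤* (begin
    + n ℤ.* + 1          ≤⟨ ℤ.*-monoˡ-≤-nonNeg (+ n) (ℤ.+≤+ (ℕ.s≤s ℕ.z≤n)) ⟩
    + n ℤ.* + suc d      ∎)
    where open ℤ.≤-Reasoning
  archimedean q@(mkℚ -[1+ n ] d _) = 0 , *≤* ℤ.-≤+

-- Fractional colourings as lists of independent sets

module Colourings where

  open ListSums
  open import Data.List.Properties using (length-++; length-map)
  import Data.List.Relation.Unary.All as All
  import Data.List.Relation.Unary.All.Properties as All
  open import Data.Nat.Base
  open import Data.Nat.Properties

  -- Boolean predicates serve for every vertex type, such as levels with an apex or pairs of a block
  -- and a vertex, and are pulled back along maps by composition.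
  Stable : {V : Set} → (V → V → Set) → (V → Bool) → Set
  Stable E J = ∀ u v → J u ≡ true → J v ≡ true → ¬ E u v

  depth : {V : Set} → List (V → Bool) → V → ℕ
  depth L v = ∑ L (λ J → ⟦ J v ⟧)

  depth-++ : ∀ {V : Set} (L M : List (V → Bool)) v → depth (L ++ M) v ≡ depth L v + depth M v
  depth-++ L M v = ∑-++ L M (λ J → ⟦ J v ⟧)

  -- A q-term fractional p-fold colouring, i.e. a fractional colouring of value q / p.
  record Colouring {V : Set} (E : V → V → Set) (q p : ℕ) : Set where
    constructor mkColouring
    field
      classes : List (V → Bool)
      stable  : All (Stable E) classes
      size    : length classes ≤ q
      covers  : ∀ v → p ≤ depth classes v

  open Colouring public

  -- This expresses χ_f ≤ k for a natural number k, as `colourable⇒χ≤` and `χ≤⇒colourable` show.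
  -- Writing `suc p` keeps the multiplicity positive.
  Colourable : {V : Set} → (V → V → Set) → ℕ → Set
  Colourable E k = ∃ λ p → Colouring E (k * suc p) (suc p)

  length-concatMap : ∀ {A B : Set} (h : A → List B) xs → length (concatMap h xs) ≡ ∑ xs (λ x → length (h x))
  length-concatMap h []       = refl
  length-concatMap h (x ∷ xs) =
    trans (length-++ (h x)) (cong (length (h x) +_) (length-concatMap h xs))

  pullback : ∀ {V W : Set} {E : V → V → Set} {E′ : W → W → Set} {q p} (h : W → V) →
             (∀ {u v} → E′ u v → E (h u) (h v)) → Colouring E q p → Colouring E′ q p
  pullback h hom c = mkColouring
    (map (λ J w → J (h w)) (classes c))
    (All.map⁺ (All.map (λ s u v u∈ v∈ e → s (h u) (h v) u∈ v∈ (hom e)) (stable c)))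
    (subst (_≤ _) (sym (length-map _ (classes c))) (size c))
    (λ w → subst (_ ≤_) (sym (∑-map _ (classes c) _)) (covers c (h w)))

  enlarge : ∀ {V : Set} {E : V → V → Set} {q q′ p} → q ≤ q′ → Colouring E q p → Colouring E q′ p
  enlarge q≤q′ c = record { Colouring c ; size = ≤-trans (size c) q≤q′ }

-- The fractional chromatic number as a rational linear programme

module FractionalChromatic where

  open ListSums
  open LinearProgramming
  open NaturalsInℚ
  open Colourings
  import Data.Integer.Base as ℤ
  open import Defs
    using (Graph; Adj; order; Independent; independent?; subsets; ∈-subsets;
           independentSets; irrefl)
  import Data.Bool.Properties as Bool
  open import Data.Fin.Base using (Fin; zero; suc)
  open import Data.Fin.Subset using (Subset; inside; outside; _∈_; ⁅_⁆)
  open import Data.Fin.Subset.Properties using (_∈?_; x∈⁅y⁆⇒x≡y; x∈⁅x⁆)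
  open import Data.List.Properties using (length-replicate)
  import Data.List.Membership.Propositional as List
  open import Data.List.Membership.Propositional.Properties
    using (∈-filter⁺; ∈-filter⁻; ∈-map⁻; ∈-allFin)
  import Data.List.Relation.Unary.All as All
  import Data.List.Relation.Unary.All.Properties as All
  open import Data.List.Relation.Unary.Unique.Propositional using (Unique)
  import Data.List.Relation.Unary.Unique.Propositional.Properties as Unique
  open import Data.Nat.Base as ℕ using (ℕ; suc; zero)
  import Data.Nat.Properties as ℕ
  open import Data.Rational.Base
  open import Data.Rational.Properties
  open import Data.Vec.Base using ([]; _∷_; tabulate; lookup)
  open import Data.Vec.Properties using (≡-dec; lookup∘tabulate; []=⇒lookup; lookup⇒[]=)
  open import Relation.Binary.Definitions using (DecidableEquality)

  _≟ˢ_ : ∀ {n} → DecidableEquality (Subset n)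
  _≟ˢ_ = ≡-dec Bool._≟_

  subsets-unique : ∀ n → Unique (subsets n)
  subsets-unique zero    = [] ∷ []
  subsets-unique (suc n) = Unique.++⁺
    (Unique.map⁺ (λ { refl → refl }) (subsets-unique n))
    (Unique.map⁺ (λ { refl → refl }) (subsets-unique n))
    λ (∈ˡ , ∈ʳ) → case-heads (∈-map⁻ _ ∈ˡ) (∈-map⁻ _ ∈ʳ)
    where
    case-heads : ∀ {I : Subset (suc n)} → (∃ λ J → J List.∈ subsets n × I ≡ inside ∷ J) →
                 ¬ (∃ λ J → J List.∈ subsets n × I ≡ outside ∷ J)
    case-heads (_ , _ , refl) (_ , _ , ())

  *-distribˡ-∑ℚ : ∀ {A : Set} r (xs : List A) f → r * ∑ℚ xs f ≡ ∑ℚ xs (λ x → r * f x)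
  *-distribˡ-∑ℚ r []       f = *-zeroʳ r
  *-distribˡ-∑ℚ r (x ∷ xs) f =
    trans (*-distribˡ-+ r (f x) (∑ℚ xs f)) (cong (r * f x +_) (*-distribˡ-∑ℚ r xs f))

  module FractionalColourings (G : Graph) where

    private
      n  = order G
      Is = independentSets G

    Is-unique : Unique Is
    Is-unique = Unique.filter⁺ (independent? G) (subsets-unique n)

    ∈-Is⁺ : ∀ {I} → Independent G I → I List.∈ Is
    ∈-Is⁺ {I} ind = ∈-filter⁺ (independent? G) (∈-subsets I) ind

    ∈-Is⁻ : ∀ {I} → I List.∈ Is → Independent G I
    ∈-Is⁻ I∈ = proj₂ (∈-filter⁻ (independent? G) {xs = subsets n} I∈)

    at : Fin n → List (Subset n)
    at v = filter (v ∈?_) Is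

    singleton∈at : ∀ v → ⁅ v ⁆ List.∈ at v
    singleton∈at v = ∈-filter⁺ (v ∈?_) (∈-Is⁺ ind) (x∈⁅x⁆ v)
      where
      ind : Independent G ⁅ v ⁆
      ind a b a∈ b∈ with refl ← x∈⁅y⁆⇒x≡y v a∈ | refl ← x∈⁅y⁆⇒x≡y v b∈ = irrefl G v

    record Fractional (x : Subset n → ℚ) : Set where
      constructor mkFractional
      field
        nonneg : All (λ I → 0ℚ ≤ x I) Is
        covers : ∀ v → 1ℚ ≤ ∑ℚ (at v) x

    private
      open LinearProgram (_≟ˢ_ {n})

      nonnegForm : Subset n → Form
      nonnegForm I = (λ J → if does (J ≟ˢ I) then 1ℚ else 0ℚ) , 0ℚ , 0ℚ

      coverForm : Fin n → Form
      coverForm v = (λ J → if does (v ∈? J) then 1ℚ else 0ℚ) , 0ℚ , - 1ℚ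

      -- This encodes Σ x ≤ t: minimising the sum becomes minimising the variable t under one
      -- further constraint.
      objective : Form
      objective = (λ _ → - 1ℚ) , 1ℚ , 0ℚ

      forms : List Form
      forms = objective ∷ map nonnegForm Is ++ map coverForm (allFin n)

      if-* : ∀ b y → (if b then 1ℚ else 0ℚ) * y ≡ (if b then y else 0ℚ)
      if-* true  y = *-identityˡ y
      if-* false y = *-zeroˡ y

      0*+ : ∀ t d → 0ℚ * t + d ≡ d
      0*+ t d = trans (cong (_+ d) (*-zeroˡ t)) (+-identityˡ d)

      value-nonneg : ∀ x t {I} → I List.∈ Is → value Is (x , t) (nonnegForm I) ≡ x I
      value-nonneg x t {I} I∈ = begin
        ∑ℚ Is (λ J → (if does (J ≟ˢ I) then 1ℚ else 0ℚ) * x J) + (0ℚ * t + 0ℚ)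
          ≡⟨ cong₂ _+_ (ℚ-sum.∑-cong Is (λ J → if-* (does (J ≟ˢ I)) (x J))) (0*+ t 0ℚ) ⟩
        ∑ℚ Is (λ J → if does (J ≟ˢ I) then x J else 0ℚ) + 0ℚ
          ≡⟨ +-identityʳ _ ⟩
        ∑ℚ Is (λ J → if does (J ≟ˢ I) then x J else 0ℚ)
          ≡⟨ ℚ-sum.∑-δ _≟ˢ_ x Is-unique I∈ ⟩
        x I ∎
        where open ≡-Reasoning

      value-cover : ∀ x t v → value Is (x , t) (coverForm v) ≡ ∑ℚ (at v) x + - 1ℚ
      value-cover x t v = cong₂ _+_
        (trans (ℚ-sum.∑-cong Is (λ J → if-* (does (v ∈? J)) (x J)))
               (sym (ℚ-sum.∑-filter (v ∈?_) Is x)))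
        (0*+ t (- 1ℚ))

      value-objective : ∀ x t → value Is (x , t) objective ≡ t + - ∑ℚ Is x
      value-objective x t = begin
        ∑ℚ Is (λ J → - 1ℚ * x J) + (1ℚ * t + 0ℚ)
          ≡⟨ cong₂ _+_ (sym (*-distribˡ-∑ℚ (- 1ℚ) Is x))
                       (trans (+-identityʳ (1ℚ * t)) (*-identityˡ t)) ⟩
        - 1ℚ * ∑ℚ Is x + t
          ≡⟨ +-comm _ t ⟩
        t + - 1ℚ * ∑ℚ Is x
          ≡⟨ cong (t +_) (trans (sym (neg-distribˡ-* 1ℚ (∑ℚ Is x))) (cong -_ (*-identityˡ (∑ℚ Is x)))) ⟩
        t + - ∑ℚ Is x ∎
        where open ≡-Reasoning

      feasible⁺ : ∀ x t → Fractional x → ∑ℚ Is x ≤ t → Feasible Is forms x t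
      feasible⁺ x t (mkFractional nonneg covers) ∑≤t =
        subst (0ℚ ≤_) (sym (value-objective x t))
          (-y≤x⇒0≤x+y (subst (_≤ t) (sym (neg-involutive (∑ℚ Is x))) ∑≤t)) ∷
        All.++⁺
          (All.map⁺ (All.tabulate λ {I} I∈ →
            subst (0ℚ ≤_) (sym (value-nonneg x t I∈)) (All.lookup nonneg I∈)))
          (All.map⁺ (All.tabulate λ {v} _ →
            subst (0ℚ ≤_) (sym (value-cover x t v))
              (-y≤x⇒0≤x+y (subst (_≤ ∑ℚ (at v) x) (sym (neg-involutive 1ℚ)) (covers v)))))

      feasible⁻ : ∀ x t → Feasible Is forms x t → Fractional x × ∑ℚ Is x ≤ t
      feasible⁻ x t (obj ∷ rest) =
        let nonnegs , covers = All.++⁻ (map nonnegForm Is) rest in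
        mkFractional
          (All.tabulate λ {I} I∈ →
            subst (0ℚ ≤_) (value-nonneg x t I∈) (All.lookup (All.map⁻ nonnegs) I∈))
          (λ v → subst (_≤ ∑ℚ (at v) x) (neg-involutive 1ℚ)
            (0≤x+y⇒-y≤x (subst (0ℚ ≤_) (value-cover x t v) (All.lookup (All.map⁻ covers) (∈-allFin v)))))
        , subst (_≤ t) (neg-involutive (∑ℚ Is x))
            (0≤x+y⇒-y≤x (subst (0ℚ ≤_) (value-objective x t) obj))

      0≤1 : 0ℚ ≤ 1ℚ
      0≤1 = 0≤cast 1

      0≤∑ : ∀ {A : Set} {xs : List A} {f} → All (λ x → 0ℚ ≤ f x) xs → 0ℚ ≤ ∑ℚ xs f
      0≤∑ []       = ≤-refl
      0≤∑ (p ∷ ps) = +-mono-≤ p (0≤∑ ps)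

      ones : Fractional (λ _ → 1ℚ)
      ones = mkFractional (All.tabulate λ _ → 0≤1) (λ v → large (singleton∈at v))
        where
        large : ∀ {A : Set} {x : A} {xs} → x List.∈ xs → 1ℚ ≤ ∑ℚ xs (λ _ → 1ℚ)
        large {xs = _ ∷ xs} _ = +-mono-≤ {1ℚ} {1ℚ} ≤-refl (0≤∑ {xs = xs} (All.tabulate λ _ → 0≤1))

    abstract
      optimum : ∃ λ x → Fractional x × (∀ y → Fractional y → ∑ℚ Is x ≤ ∑ℚ Is y)
      optimum =
        let x , t , s , least = minimum Is-unique forms (λ _ → 1ℚ) (∑ℚ Is (λ _ → 1ℚ))
              (feasible⁺ _ _ ones ≤-refl)
              (λ y r s → let fy , ∑≤r = feasible⁻ y r s in ≤-trans (0≤∑ (Fractional.nonneg fy)) ∑≤r)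
            fx , ∑≤t = feasible⁻ x t s
        in x , fx , λ y fy → ≤-trans ∑≤t (least y (∑ℚ Is y) (feasible⁺ y (∑ℚ Is y) fy ≤-refl))

    χ : ℚ
    χ = ∑ℚ Is (proj₁ optimum)

    private
      ∈-tabulate⁺ : ∀ (J : Fin n → Bool) {v} → J v ≡ true → v ∈ tabulate J
      ∈-tabulate⁺ J {v} Jv = lookup⇒[]= v (tabulate J) (trans (lookup∘tabulate J v) Jv)

      ∈-tabulate⁻ : ∀ (J : Fin n → Bool) {v} → v ∈ tabulate J → J v ≡ true
      ∈-tabulate⁻ J {v} v∈ = trans (sym (lookup∘tabulate J v)) ([]=⇒lookup v∈)

      tabulate∈Is : ∀ {J} → Stable (Adj G) J → tabulate J List.∈ Is
      tabulate∈Is {J} s = ∈-Is⁺ λ u v u∈ v∈ → s u v (∈-tabulate⁻ J u∈) (∈-tabulate⁻ J v∈)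

    -- Weight each independent set by the number of classes that equal it, divided by the
    -- multiplicity p + 1. Every class is independent, hence occurs exactly once in `Is`, so that
    -- the weights sum to the number of classes divided by p + 1.
    colouring⇒χ≤ : ∀ {q p} → Colouring (Adj G) q (suc p) → χ * cast (suc p) ≤ cast q
    colouring⇒χ≤ {q} {p} (mkColouring L stable size covers) = begin
      χ * cast (suc p)
        ≤⟨ *-monoʳ-≤-nonNeg (cast (suc p)) (proj₂ (proj₂ optimum) x (mkFractional nonneg covers′)) ⟩
      ∑ℚ Is x * cast (suc p)
        ≡⟨ cong (_* cast (suc p)) (∑x Is) ⟩
      r * cast (∑ Is multiplicity) * cast (suc p)
        ≡⟨ cancel (cast (∑ Is multiplicity)) ⟩
      cast (∑ Is multiplicity)
        ≤⟨ cast-mono (ℕ.≤-trans (ℕ.≤-reflexive ∑-multiplicity) size) ⟩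
      cast q ∎
      where
      open ≤-Reasoning
      multiplicity : Subset n → ℕ
      multiplicity I = ∑ L (λ J → ⟦ does (I ≟ˢ tabulate J) ⟧)

      inverse = recip {cast (suc p)} (positive⁻¹ (cast (suc p)))
      r = proj₁ inverse
      0<r = proj₁ (proj₂ inverse)
      r*p≡1 = proj₂ (proj₂ inverse)

      x : Subset n → ℚ
      x I = r * cast (multiplicity I)

      ∑x : ∀ Js → ∑ℚ Js x ≡ r * cast (∑ Js multiplicity)
      ∑x Js = trans (sym (*-distribˡ-∑ℚ r Js _)) (cong (r *_) (sym (cast-∑ Js multiplicity)))

      cancel : ∀ y → r * y * cast (suc p) ≡ y
      cancel y = trans (cong (_* cast (suc p)) (*-comm r y))
        (trans (*-assoc y r (cast (suc p))) (trans (cong (y *_) r*p≡1) (*-identityʳ y)))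

      ∑-multiplicity : ∑ Is multiplicity ≡ length L
      ∑-multiplicity = trans (∑-swap Is L _) (trans
        (∑-congᴬ (All.map (λ s → ∑-δ _≟ˢ_ (λ _ → 1) Is-unique (tabulate∈Is s)) stable))
        (sym (length-∑ L)))

      nonneg : All (λ I → 0ℚ ≤ x I) Is
      nonneg = All.tabulate λ {I} _ → 0≤*⁺ 0<r (0≤cast (multiplicity I))

      counted : ∀ v {J} → Stable (Adj G) J → ⟦ J v ⟧ ℕ.≤ ∑ (at v) (λ I → ⟦ does (I ≟ˢ tabulate J) ⟧)
      counted v {J} s with J v in Jv
      ... | false = ℕ.z≤n
      ... | true  = ℕ.≤-reflexive (sym (∑-δ _≟ˢ_ (λ _ → 1)
        (Unique.filter⁺ (v ∈?_) Is-unique)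
        (∈-filter⁺ (v ∈?_) (tabulate∈Is s) (∈-tabulate⁺ J Jv))))

      covers′ : ∀ v → 1ℚ ≤ ∑ℚ (at v) x
      covers′ v = begin
        1ℚ                                  ≡⟨ sym r*p≡1 ⟩
        r * cast (suc p)                    ≤⟨ *-monoˡ-≤-nonNeg r {{nonNegative (<⇒≤ 0<r)}} (cast-mono enough) ⟩
        r * cast (∑ (at v) multiplicity)    ≡⟨ sym (∑x (at v)) ⟩
        ∑ℚ (at v) x                         ∎
        where
        enough : suc p ℕ.≤ ∑ (at v) multiplicity
        enough = ℕ.≤-trans (covers v) (ℕ.≤-trans (∑-monoᴬ (All.map (λ s → counted v s) stable))
          (ℕ.≤-reflexive (∑-swap L (at v) _)))

    colourable⇒χ≤ : ∀ {k} → Colourable (Adj G) k → χ ≤ cast k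
    colourable⇒χ≤ {k} (p , c) = *-cancelʳ-≤-pos (cast (suc p))
      (subst (χ * cast (suc p) ≤_) (cast-* k (suc p)) (colouring⇒χ≤ c))

    private
      commonDenominator : ∀ {A : Set} {xs : List A} {x : A → ℚ} → All (λ a → 0ℚ ≤ x a) xs →
                          ∃ λ d → All (λ a → ∃ λ m → cast (suc d) * x a ≡ cast m) xs
      commonDenominator [] = 0 , []
      commonDenominator {xs = a ∷ _} {x} (0≤ ∷ 0≤s) =
        let d , ms = commonDenominator 0≤s
            e , m , eq = clearDenominator (x a) 0≤
        in d ℕ.+ e ℕ.* suc d
         , (suc d ℕ.* m , trans (cong (_* x a) (cast-* (suc e) (suc d)))
             (trans (rotate (cast (suc e)) (cast (suc d)) (x a))
               (trans (cong (cast (suc d) *_) eq) (sym (cast-* (suc d) m)))))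
         ∷ All.map (λ { {b} (k , eqᵇ) → suc e ℕ.* k ,
             trans (cong (_* x b) (cast-* (suc e) (suc d)))
               (trans (*-assoc (cast (suc e)) (cast (suc d)) (x b))
                 (trans (cong (cast (suc e) *_) eqᵇ) (sym (cast-* (suc e) k)))) }) ms
        where
        rotate : ∀ a b c → a * b * c ≡ b * (a * c)
        rotate a b c = trans (cong (_* c) (*-comm a b)) (*-assoc b a c)

      does-∈? : ∀ (v : Fin n) I → does (v ∈? I) ≡ lookup I v
      does-∈? v I with v ∈? I | lookup I v in eq
      ... | yes v∈ | b     = trans (sym ([]=⇒lookup v∈)) eq
      ... | no  v∉ | true  = contradiction (lookup⇒[]= v I eq) v∉
      ... | no  v∉ | false = refl

    -- Multiply a rational optimum by a common denominator D and repeat each independent set as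
    -- often as its weight then says. The result is a D-fold colouring with D χ classes.
    χ≤⇒colourable : ∀ {k} → χ ≤ cast k → Colourable (Adj G) k
    χ≤⇒colourable {k} χ≤k = d , mkColouring L stableᴸ sizeᴸ coversᴸ
      where
      x = proj₁ optimum
      fractional = proj₁ (proj₂ optimum)
      d = proj₁ (commonDenominator (Fractional.nonneg fractional))
      D = cast (suc d)

      -- On independent sets D · x I is a natural number, hence equal to its own numerator. Reading
      -- off the numerator defines w on all subsets.
      w : Subset n → ℕ
      w I = ℤ.∣ ↥ (D * x I) ∣

      w-correct : All (λ I → D * x I ≡ cast (w I)) Is
      w-correct = All.map (λ (m , eq) → trans eq (cong (λ q → cast ℤ.∣ ↥ q ∣) (sym eq)))
        (proj₂ (commonDenominator (Fractional.nonneg fractional)))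

      ∑w : ∀ {Js} → All (λ I → D * x I ≡ cast (w I)) Js → cast (∑ Js w) ≡ D * ∑ℚ Js x
      ∑w {Js} correct = trans (cast-∑ Js w)
        (trans (sym (ℚ-sum.∑-congᴬ correct)) (sym (*-distribˡ-∑ℚ D Js x)))

      L : List (Fin n → Bool)
      L = concatMap (λ I → replicate (w I) (lookup I)) Is

      stableᴸ : All (Stable (Adj G)) L
      stableᴸ = All.concat⁺ (All.map⁺ (All.tabulate λ {I} I∈ → All.replicate⁺ (w I)
        λ u v u∈ v∈ → ∈-Is⁻ I∈ u v (lookup⇒[]= u I u∈) (lookup⇒[]= v I v∈)))

      sizeᴸ : length L ℕ.≤ k ℕ.* suc d
      sizeᴸ = cast-cancel (begin
        cast (length L)     ≡⟨ cong cast (trans (length-concatMap _ Is)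
                                                (∑-cong Is (λ I → length-replicate (w I)))) ⟩
        cast (∑ Is w)       ≡⟨ ∑w w-correct ⟩
        D * χ               ≤⟨ *-monoˡ-≤-nonNeg D χ≤k ⟩
        D * cast k          ≡⟨ *-comm D (cast k) ⟩
        cast k * D          ≡⟨ sym (cast-* k (suc d)) ⟩
        cast (k ℕ.* suc d)  ∎)
        where open ≤-Reasoning

      coversᴸ : ∀ v → suc d ℕ.≤ ∑ L (λ J → ⟦ J v ⟧)
      coversᴸ v = cast-cancel (begin
        D                                ≡⟨ sym (*-identityʳ D) ⟩
        D * 1ℚ                           ≤⟨ *-monoˡ-≤-nonNeg D (Fractional.covers fractional v) ⟩
        D * ∑ℚ (at v) x                  ≡⟨ sym (∑w (All.filter⁺ (v ∈?_) w-correct)) ⟩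
        cast (∑ (at v) w)                ≡⟨ cong cast (trans (∑-filter (v ∈?_) Is w)
                                              (trans (∑-cong Is once) (sym (∑-concatMap _ Is _)))) ⟩
        cast (∑ L (λ J → ⟦ J v ⟧))       ∎)
        where
        open ≤-Reasoning
        once : ∀ I → (if does (v ∈? I) then w I else 0) ≡ ∑ (replicate (w I) (lookup I)) (λ J → ⟦ J v ⟧)
        once I rewrite does-∈? v I = constant (w I)
          where
          constant : ∀ m → (if lookup I v then m else 0) ≡ ∑ (replicate m (lookup I)) (λ J → ⟦ J v ⟧)
          constant zero with lookup I v
          ... | true  = refl
          ... | false = refl
          constant (suc m) with lookup I v | constant m
          ... | true  | eq = cong suc eq
          ... | false | eq = eq

    -- With this the search for a tower graph of prescribed χ_f needs no excluded middle.
    colourable? : ∀ k → Dec (Colourable (Adj G) k)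
    colourable? k with χ ≤? cast k
    ... | yes χ≤k = yes (χ≤⇒colourable χ≤k)
    ... | no  χ≰k = no λ c → χ≰k (colourable⇒χ≤ c)

-- Generalised Mycielski graphs

module Cones where

  open ListSums
  open Colourings
  open import Data.Bool.Properties using (not-¬)
  open import Data.Fin.Base using (Fin; zero; suc; toℕ)
  open import Data.Fin.Properties using (toℕ<n; toℕ-injective; any?; injective⇒≤)
  import Data.Fin.Properties as Fin
  open import Data.List.Base using (lookup)
  open import Data.List.Properties using (length-++; length-map; length-replicate; length-mapMaybe)
  open import Data.List.Membership.Propositional using (_∈_; _∉_)
  import Data.List.Membership.DecPropositional as DecMembership
  open import Data.List.Membership.Propositional.Properties using (∈-map⁺)
  import Data.List.Relation.Unary.All as All
  import Data.List.Relation.Unary.All.Properties as All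
  import Data.List.Relation.Unary.Any as Any
  open import Data.List.Relation.Unary.Any.Properties using (lookup-index)
  open import Data.Maybe.Base as Maybe using (Maybe; just; nothing)
  open import Data.Nat.Base hiding (parity)
  open import Data.Nat.Properties
  open import Data.Nat.Solver using (module +-*-Solver)
  open import Relation.Nullary.Decidable using (dec-true; dec-false; decidable-stable)

  -- For a graph this says that all odd cycles are longer than s.
  LocallyBipartite : {V : Set} → (V → V → Set) → ℕ → Set
  LocallyBipartite {V} E s = ∀ (xs : List V) → length xs ≤ s →
    ∃ λ (c : V → Bool) → ∀ u v → u ∈ xs → v ∈ xs → E u v → c u ≢ c v

  missing : ∀ {m} (ls : List (Fin m)) → length ls < m → ∃ λ l → l ∉ ls
  missing {m} ls short with any? (λ l → ¬? (DecMembership._∈?_ Fin._≟_ l ls))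
  ... | yes l∉ = l∉
  ... | no  ∄  = contradiction (injective⇒≤ index-injective) (<⇒≱ short)
    where
    all∈ : ∀ l → l ∈ ls
    all∈ l = decidable-stable (DecMembership._∈?_ Fin._≟_ l ls) λ l∉ → ∄ (l , l∉)

    index-injective : ∀ {k l} → Any.index (all∈ k) ≡ Any.index (all∈ l) → k ≡ l
    index-injective {k} {l} eq = trans (lookup-index (all∈ k))
      (trans (cong (lookup ls) eq) (sym (lookup-index (all∈ l))))

  parity : ℕ → Bool
  parity zero    = false
  parity (suc n) = not (parity n)

  parity-suc : ∀ n → parity n ≢ parity (suc n)
  parity-suc n = not-¬ refl

  ∈-mapMaybe : ∀ {A B : Set} (f : A → Maybe B) {x y xs} → x ∈ xs → f x ≡ just y → y ∈ mapMaybe f xs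
  ∈-mapMaybe f {x} (here refl) fx≡ with just _ ← f x | refl ← fx≡ = here refl
  ∈-mapMaybe f {xs = z ∷ _} (there x∈) fx≡ with f z
  ... | just _  = there (∈-mapMaybe f x∈ fx≡)
  ... | nothing = ∈-mapMaybe f x∈ fx≡

  copies : ∀ {A : Set} → ℕ → List A → List A
  copies zero    xs = []
  copies (suc k) xs = xs ++ copies k xs

  length-copies : ∀ {A : Set} k (xs : List A) → length (copies k xs) ≡ k * length xs
  length-copies zero    xs = refl
  length-copies (suc k) xs = trans (length-++ xs) (cong (length xs +_) (length-copies k xs))

  depth-copies : ∀ {V : Set} k (L : List (V → Bool)) v → depth (copies k L) v ≡ k * depth L v
  depth-copies zero    L v = refl
  depth-copies (suc k) L v = trans (depth-++ L (copies k L) v) (cong (depth L v +_) (depth-copies k L v))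

  All-copies : ∀ {A : Set} {P : A → Set} k {xs : List A} → All P xs → All P (copies k xs)
  All-copies zero    ps = []
  All-copies (suc k) ps = All.++⁺ ps (All-copies k ps)

  clamp : ∀ R → ℕ → Fin (suc R)
  clamp zero    i       = zero
  clamp (suc R) zero    = zero
  clamp (suc R) (suc i) = suc (clamp R i)

  toℕ-clamp : ∀ {R i} → i ≤ R → toℕ (clamp R i) ≡ i
  toℕ-clamp {zero}  z≤n       = refl
  toℕ-clamp {suc R} z≤n       = refl
  toℕ-clamp {suc R} (s≤s i≤R) = cong suc (toℕ-clamp i≤R)

  ∧-true : ∀ {a b} → a ∧ b ≡ true → a ≡ true × b ≡ true
  ∧-true {true} {true} _ = refl , refl

  ∨-true : ∀ {a b} → a ∨ b ≡ true → a ≡ true ⊎ b ≡ true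
  ∨-true {true}  _  = inj₁ refl
  ∨-true {false} b≡ = inj₂ b≡

  -- `size` bounds the number of classes only from above, but in the cone argument this number also
  -- enters a lower bound on depths and has to be exact. Empty sets fill the gap.
  padded : ∀ {V : Set} {E : V → V → Set} {q p} → Colouring E q p →
           ∃ λ (c : Colouring E q p) → length (classes c) ≡ q
  padded {V} {E} {q} {p} (mkColouring L stable size covers) =
    mkColouring L′ (All.++⁺ stable (All.replicate⁺ (q ∸ length L) λ _ _ ()))
      (≤-reflexive length-L′) covers′ , length-L′
    where
    L′ = L ++ replicate (q ∸ length L) (λ _ → false)
    length-L′ : length L′ ≡ q
    length-L′ = trans (length-++ L)
      (trans (cong (length L +_) (length-replicate (q ∸ length L))) (m+[n∸m]≡n size))
    covers′ : ∀ v → p ≤ depth L′ v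
    covers′ v = ≤-trans (covers v) (≤-trans (m≤m+n _ _)
      (≤-reflexive (sym (depth-++ L (replicate (q ∸ length L) _) v))))

  -- `powers K d` is K^(d+1), and `gain K d` is K + K² + ... + K^(d+1). A cone with top level R over
  -- a base with χ_f ≤ K raises χ_f at least by the factor 1 + 1 / `gain K R`.
  powers gain : ℕ → ℕ → ℕ
  powers K zero    = K
  powers K (suc d) = powers K d * K
  gain K zero    = K
  gain K (suc d) = gain K d + powers K d * K

  -- The generalised Mycielski graph: R + 1 levels of copies of V, with edges of E
  -- inside level 0 and between consecutive levels, and an apex joined to level R.
  module Cone {V : Set} (E : V → V → Set) (R : ℕ) where

    Vertex : Set
    Vertex = Maybe (Fin (suc R) × V)

    data Near (i j : ℕ) : Set where
      both-0 : i ≡ 0 → j ≡ 0 → Near i j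
      up     : j ≡ suc i → Near i j
      down   : i ≡ suc j → Near i j

    data ConeAdj : Vertex → Vertex → Set where
      side  : ∀ {l u l′ v} → Near (toℕ l) (toℕ l′) → E u v → ConeAdj (just (l , u)) (just (l′ , v))
      apexʳ : ∀ {l u} → toℕ l ≡ R → ConeAdj (just (l , u)) nothing
      apexˡ : ∀ {l u} → toℕ l ≡ R → ConeAdj nothing (just (l , u))

    coneAdj-sym : (∀ {u v} → E u v → E v u) → ∀ {x y} → ConeAdj x y → ConeAdj y x
    coneAdj-sym s (side (both-0 i j) e) = side (both-0 j i) (s e)
    coneAdj-sym s (side (up eq) e)      = side (down eq) (s e)
    coneAdj-sym s (side (down eq) e)    = side (up eq) (s e)
    coneAdj-sym s (apexʳ eq)            = apexˡ eq
    coneAdj-sym s (apexˡ eq)            = apexʳ eq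

    coneAdj-irrefl : (∀ v → ¬ E v v) → ∀ x → ¬ ConeAdj x x
    coneAdj-irrefl ir (just (l , u)) (side _ e) = ir u e

    near? : ∀ i j → Dec (Near i j)
    near? i j with j ≟ suc i | i ≟ suc j | i ≟ 0 | j ≟ 0
    ... | yes eq | _      | _     | _     = yes (up eq)
    ... | no _   | yes eq | _     | _     = yes (down eq)
    ... | no _   | no _   | yes i≡ | yes j≡ = yes (both-0 i≡ j≡)
    ... | no ¬u  | no ¬d  | no ¬i | _     = no λ { (up e) → ¬u e ; (down e) → ¬d e ; (both-0 e _) → ¬i e }
    ... | no ¬u  | no ¬d  | yes _ | no ¬j = no λ { (up e) → ¬u e ; (down e) → ¬d e ; (both-0 _ e) → ¬j e }

    coneAdj? : (∀ u v → Dec (E u v)) → ∀ x y → Dec (ConeAdj x y)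
    coneAdj? E? nothing nothing = no λ ()
    coneAdj? E? nothing (just (l , u)) with toℕ l ≟ R
    ... | yes eq = yes (apexˡ eq)
    ... | no ¬eq = no λ { (apexˡ eq) → ¬eq eq }
    coneAdj? E? (just (l , u)) nothing with toℕ l ≟ R
    ... | yes eq = yes (apexʳ eq)
    ... | no ¬eq = no λ { (apexʳ eq) → ¬eq eq }
    coneAdj? E? (just (l , u)) (just (l′ , v)) with near? (toℕ l) (toℕ l′) | E? u v
    ... | yes near | yes e = yes (side near e)
    ... | no ¬near | _     = no λ { (side near _) → ¬near near }
    ... | yes _    | no ¬e = no λ { (side _ e) → ¬e e }

    -- s ≤ R vertices avoid some level m; the levels below m map homomorphically to E,
    -- and those above m are bipartite by parity of the level.
    cone-locallyBipartite : ∀ {s} → s ≤ R → LocallyBipartite E s → LocallyBipartite ConeAdj s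
    cone-locallyBipartite {s} s≤R bip xs short = c′ , proper
      where
      level : Vertex → Fin (suc R)
      level nothing        = zero
      level (just (l , _)) = l

      -- The apex is booked under level 0. Even so, at most R vertices occupy at most R of the R + 1
      -- levels.
      gap = missing (map level xs)
        (s≤s (≤-trans (≤-reflexive (length-map level xs)) (≤-trans short s≤R)))
      m = toℕ (proj₁ gap)

      level≢m : ∀ {l u} → just (l , u) ∈ xs → toℕ l ≢ m
      level≢m x∈ eq = proj₂ gap (subst (_∈ map level xs) (toℕ-injective eq) (∈-map⁺ level x∈))

      base = mapMaybe (Maybe.map proj₂) xs
      below = bip base (≤-trans (length-mapMaybe _ xs) short)
      c = proj₁ below

      -- The apex is coloured as if it formed level R + 1. Its neighbours in `xs` lie on level R,
      -- which is then occupied and therefore above the missing level.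
      c′ : Vertex → Bool
      c′ nothing        = parity (suc R)
      c′ (just (l , u)) = if does (toℕ l <? m) then c u else parity (toℕ l)

      c′-below : ∀ {l u} → toℕ l < m → c′ (just (l , u)) ≡ c u
      c′-below {l} {u} l<m = cong (if_then c u else parity (toℕ l)) (dec-true (toℕ l <? m) l<m)

      c′-above : ∀ {l u} → m < toℕ l → c′ (just (l , u)) ≡ parity (toℕ l)
      c′-above {l} {u} m<l = cong (if_then c u else parity (toℕ l)) (dec-false (toℕ l <? m) (<-asym m<l))

      R-above : ∀ {l u} → just (l , u) ∈ xs → toℕ l ≡ R → c′ (just (l , u)) ≡ parity R
      R-above x∈ l≡R = trans
        (c′-above (≤∧≢⇒< (subst (m ≤_) (sym l≡R) (≤-pred (toℕ<n (proj₁ gap)))) (λ eq → level≢m x∈ (sym eq))))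
        (cong parity l≡R)

      bothBelow : ∀ {l u l′ v} → toℕ l < m → toℕ l′ < m → just (l , u) ∈ xs → just (l′ , v) ∈ xs →
                  E u v → c′ (just (l , u)) ≢ c′ (just (l′ , v))
      bothBelow {l} {u} {l′} {v} l<m l′<m x∈ y∈ e eq = proj₂ below u v
        (∈-mapMaybe _ x∈ refl) (∈-mapMaybe _ y∈ refl) e
        (trans (sym (c′-below {l} l<m)) (trans eq (c′-below {l′} l′<m)))

      consecutive : ∀ {l u l′ v} → toℕ l′ ≡ suc (toℕ l) → just (l , u) ∈ xs → just (l′ , v) ∈ xs →
                    (toℕ l < m × toℕ l′ < m) ⊎ c′ (just (l , u)) ≢ c′ (just (l′ , v))
      consecutive {l} {u} {l′} {v} l′≡ x∈ y∈ with toℕ l <? m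
      ... | yes l<m = inj₁ (l<m , ≤∧≢⇒< (subst (_≤ m) (sym l′≡) l<m) (level≢m y∈))
      ... | no  l≮m = inj₂ λ eq → parity-suc (toℕ l)
        (trans (sym (c′-above {l} {u} m<l)) (trans eq (trans (c′-above {l′} {v} m<l′) (cong parity l′≡))))
        where
        m<l : m < toℕ l
        m<l = ≤∧≢⇒< (≮⇒≥ l≮m) (λ eq → level≢m x∈ (sym eq))
        m<l′ : m < toℕ l′
        m<l′ = subst (m <_) (sym l′≡) (s≤s (≮⇒≥ l≮m))

      proper : ∀ x y → x ∈ xs → y ∈ xs → ConeAdj x y → c′ x ≢ c′ y
      proper _ _ x∈ y∈ (side {l} {u} {l′} {v} (both-0 l≡ l′≡) e) =
        bothBelow (0<m l≡ x∈) (0<m l′≡ y∈) x∈ y∈ e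
        where
        0<m : ∀ {l u} → toℕ l ≡ 0 → just (l , u) ∈ xs → toℕ l < m
        0<m l≡ x∈ = ≤∧≢⇒< (subst (_≤ m) (sym l≡) z≤n) (level≢m x∈)
      proper _ _ x∈ y∈ (side (up l′≡) e) with consecutive l′≡ x∈ y∈
      ... | inj₁ (l< , l′<) = bothBelow l< l′< x∈ y∈ e
      ... | inj₂ c≢         = c≢
      proper _ _ x∈ y∈ (side (down l≡) e) with consecutive l≡ y∈ x∈
      ... | inj₁ (l′< , l<) = bothBelow l< l′< x∈ y∈ e
      ... | inj₂ c≢         = c≢ ∘ sym
      proper _ _ x∈ _ (apexʳ l≡R) eq = parity-suc R (trans (sym (R-above x∈ l≡R)) eq)
      proper _ _ _ y∈ (apexˡ l≡R) eq = parity-suc R (trans (sym (R-above y∈ l≡R)) (sym eq))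

    -- Off the apex, forgetting the level is a homomorphism to the base, so the classes of the base
    -- lift. The apex receives p + 1 singleton classes, which raise the value by 1.
    cone-colourable : ∀ {k} → Colourable E k → Colourable ConeAdj (suc k)
    cone-colourable {k} (p , mkColouring L stable size covers) = p , mkColouring
      (replicate (suc p) apex ++ map lift L)
      (All.++⁺ (All.replicate⁺ (suc p) apex-stable) (All.map⁺ (All.map lift-stable stable)))
      (≤-trans (≤-reflexive (trans (length-++ (replicate (suc p) apex))
          (cong₂ _+_ (length-replicate (suc p)) (length-map lift L))))
        (+-monoʳ-≤ (suc p) size))
      covers′
      where
      apex : Vertex → Bool
      apex nothing  = true
      apex (just _) = false

      lift : (V → Bool) → Vertex → Bool
      lift J nothing        = false
      lift J (just (_ , u)) = J u

      apex-stable : Stable ConeAdj apex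
      apex-stable nothing nothing _ _ ()

      lift-stable : ∀ {J} → Stable E J → Stable ConeAdj (lift J)
      lift-stable s _ _ u∈ v∈ (side {u = u} {v = v} _ e) = s u v u∈ v∈ e

      covers′ : ∀ x → suc p ≤ depth (replicate (suc p) apex ++ map lift L) x
      covers′ nothing = begin
        suc p                                                   ≡⟨ sym (*-identityʳ (suc p)) ⟩
        suc p * 1                                               ≡⟨ sym (constant (suc p)) ⟩
        depth (replicate (suc p) apex) nothing                  ≤⟨ m≤m+n _ _ ⟩
        depth (replicate (suc p) apex) nothing + depth (map lift L) nothing
                                                                ≡⟨ sym (depth-++ (replicate (suc p) apex) (map lift L) nothing) ⟩
        depth (replicate (suc p) apex ++ map lift L) nothing    ∎
        where
        open ≤-Reasoning
        constant : ∀ k → depth (replicate k apex) nothing ≡ k * 1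
        constant zero    = refl
        constant (suc k) = cong suc (constant k)
      covers′ x@(just (l , u)) = begin
        suc p                                                    ≤⟨ covers u ⟩
        depth L u                                                ≡⟨ sym (∑-map lift L (λ J → ⟦ J x ⟧)) ⟩
        depth (map lift L) x                                     ≤⟨ m≤n+m _ _ ⟩
        depth (replicate (suc p) apex) x + depth (map lift L) x  ≡⟨ sym (depth-++ (replicate (suc p) apex) (map lift L) x) ⟩
        depth (replicate (suc p) apex ++ map lift L) x           ∎
        where open ≤-Reasoning

    level : (Vertex → Bool) → ℕ → V → Bool
    level J i u = J (just (clamp R i , u))

    common : (Vertex → Bool) → ℕ → V → Bool
    common J zero    u = level J 0 u
    common J (suc i) u = common J i u ∧ level J (suc i) u

    extend : (Vertex → Bool) → ℕ → (V → Bool) → V → Bool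
    extend J i S u = common J i u ∨ (level J (suc i) u ∧ S u)

    -- If J contains the apex, it avoids level R, so `common J R` is empty and the place is free for
    -- an arbitrary stable set S of the base.
    top : (Vertex → Bool) → (V → Bool) → V → Bool
    top J S u = if J nothing then S u else common J R u

    module _ {J : Vertex → Bool} (J-stable : Stable ConeAdj J) where

      private
        common⊆level₀ : ∀ i {u} → common J i u ≡ true → level J 0 u ≡ true
        common⊆level₀ zero    u∈ = u∈
        common⊆level₀ (suc i) u∈ = common⊆level₀ i (proj₁ (∧-true u∈))

        common⊆level : ∀ i {u} → common J i u ≡ true → level J i u ≡ true
        common⊆level zero        u∈ = u∈
        common⊆level (suc i) {u} u∈ = proj₂ (∧-true {common J i u} u∈)

        levels-stable : ∀ {i j} → i ≤ R → j ≤ R → Near i j → ∀ {u v} →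
                        level J i u ≡ true → level J j v ≡ true → ¬ E u v
        levels-stable i≤R j≤R near u∈ v∈ e = J-stable _ _ u∈ v∈
          (side (subst₂ Near (sym (toℕ-clamp i≤R)) (sym (toℕ-clamp j≤R)) near) e)

      common-stable : ∀ i → Stable E (common J i)
      common-stable i u v u∈ v∈ =
        levels-stable z≤n z≤n (both-0 refl refl) (common⊆level₀ i u∈) (common⊆level₀ i v∈)

      -- The set `common J i` lies in levels 0 and i of J. Edges of E persist inside level 0, which
      -- makes it stable; they also persist between levels i and i + 1, which separates it from the
      -- part of S taken from level i + 1.
      extend-stable : ∀ {i S} → suc i ≤ R → Stable E S → Stable E (extend J i S)
      extend-stable {i} {S} i<R s u v u∈ v∈
        with ∨-true {common J i u} u∈ | ∨-true {common J i v} v∈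
      ... | inj₁ u∈ᶜ | inj₁ v∈ᶜ = common-stable i u v u∈ᶜ v∈ᶜ
      ... | inj₁ u∈ᶜ | inj₂ v∈ˢ = levels-stable (<⇒≤ i<R) i<R (up refl) (common⊆level i u∈ᶜ) (proj₁ (∧-true v∈ˢ))
      ... | inj₂ u∈ˢ | inj₁ v∈ᶜ = levels-stable i<R (<⇒≤ i<R) (down refl) (proj₁ (∧-true u∈ˢ)) (common⊆level i v∈ᶜ)
      ... | inj₂ u∈ˢ | inj₂ v∈ˢ = s u v (proj₂ (∧-true {level J (suc i) u} u∈ˢ)) (proj₂ (∧-true {level J (suc i) v} v∈ˢ))

      top-stable : ∀ {S} → Stable E S → Stable E (top J S)
      top-stable s with J nothing
      ... | true  = s
      ... | false = common-stable R

      common-empty : J nothing ≡ true → ∀ u → common J R u ≡ false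
      common-empty apex∈ u with common J R u in eq
      ... | false = refl
      ... | true  = contradiction (apexʳ (toℕ-clamp ≤-refl))
        (J-stable (just (clamp R R , u)) nothing (common⊆level R eq) apex∈)

      module _ {Ss : List (V → Bool)} {b : ℕ} {u : V} (b≤ : b ≤ depth Ss u) where

        private
          constantly : ∀ {f : (V → Bool) → ℕ} c → (∀ S → f S ≡ c) → length Ss * c ≡ ∑ Ss f
          constantly c f≡c = trans (sym (∑-const Ss c)) (sym (∑-cong Ss f≡c))

        -- A vertex of `common J i` lies in the extension for every S, and one found only on level i
        -- + 1 for at least b of them. A vertex of both kinds is counted twice on the left; the last
        -- term compensates for this.
        extend-depth : ∀ i → length Ss * ⟦ common J i u ⟧ + b * ⟦ level J (suc i) u ⟧ ≤
                             ∑ Ss (λ S → ⟦ extend J i S u ⟧) + b * ⟦ common J (suc i) u ⟧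
        extend-depth i with common J i u | level J (suc i) u
        ... | true  | l     = +-monoˡ-≤ (b * ⟦ l ⟧) (≤-reflexive (constantly 1 (λ _ → refl)))
        ... | false | true  = ≤-trans (≤-reflexive (cong₂ _+_ (*-zeroʳ (length Ss)) (*-identityʳ b)))
                                      (≤-trans b≤ (m≤m+n _ _))
        ... | false | false = ≤-trans (≤-reflexive (cong (_+ b * 0) (*-zeroʳ (length Ss)))) (m≤n+m _ _)

        -- The two summands on the left are never both nonzero, by `common-empty`.
        top-depth : b * ⟦ J nothing ⟧ + length Ss * ⟦ common J R u ⟧ ≤ ∑ Ss (λ S → ⟦ top J S u ⟧)
        top-depth with J nothing in apex∈
        ... | false = ≤-trans (≤-reflexive (cong (_+ length Ss * ⟦ common J R u ⟧) (*-zeroʳ b)))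
                              (≤-reflexive (constantly ⟦ common J R u ⟧ (λ _ → refl)))
        ... | true rewrite common-empty apex∈ u =
          ≤-trans (≤-reflexive (trans (cong₂ _+_ (*-identityʳ b) (*-zeroʳ (length Ss))) (+-identityʳ b))) b≤

    module _ {K b q p : ℕ} (cG : Colouring E (K * b) b) (cJ : Colouring ConeAdj q p) where

      private
        Ss = classes (proj₁ (padded cG))
        Js = classes cJ

        length-Ss : length Ss ≡ K * b
        length-Ss = proj₂ (padded cG)

        b≤Ss : ∀ u → b ≤ depth Ss u
        b≤Ss = covers (proj₁ (padded cG))

        Ss-stable = stable (proj₁ (padded cG))

        -- `ι 0 u` is the full covering number of u on level 0. The values decrease with i, and
        -- their decrements are what the telescoping controls.
        ι : ℕ → V → ℕ
        ι i u = ∑ Js (λ J → ⟦ common J i u ⟧)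

        product : ((Vertex → Bool) → (V → Bool) → V → Bool) → List (V → Bool)
        product f = concatMap (λ J → map (f J) Ss) Js

        product-stable : ∀ {f} → (∀ {J S} → Stable ConeAdj J → Stable E S → Stable E (f J S)) →
                         All (Stable E) (product f)
        product-stable f-stable = All.concat⁺ (All.map⁺ (All.map (λ sJ →
          All.map⁺ (All.map (λ sS → f-stable sJ sS) Ss-stable)) (stable cJ)))

        length-product : ∀ f → length (product f) ≤ q * (b * K)
        length-product f = begin
          length (product f)                  ≡⟨ length-concatMap (λ J → map (f J) Ss) Js ⟩
          ∑ Js (λ J → length (map (f J) Ss))  ≡⟨ ∑-cong Js (λ J → length-map (f J) Ss) ⟩
          ∑ Js (λ _ → length Ss)              ≡⟨ ∑-const Js (length Ss) ⟩
          length Js * length Ss               ≤⟨ *-monoˡ-≤ (length Ss) (size cJ) ⟩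
          q * length Ss                       ≡⟨ cong (q *_) (trans length-Ss (*-comm K b)) ⟩
          q * (b * K)                         ∎
          where open ≤-Reasoning

        depth-product : ∀ f u → depth (product f) u ≡ ∑ Js (λ J → ∑ Ss (λ S → ⟦ f J S u ⟧))
        depth-product f u = trans (∑-concatMap (λ J → map (f J) Ss) Js (λ J → ⟦ J u ⟧))
          (∑-cong Js (λ J → ∑-map (f J) Ss (λ J → ⟦ J u ⟧)))

        ∑-* : ∀ c (f : (Vertex → Bool) → ℕ) → ∑ Js (λ J → c * f J) ≡ c * ∑ Js f
        ∑-* c f = sym (*-distribˡ-∑ c Js f)

        extended : ∀ i u → K * b * ι i u + b * p ≤ depth (product (λ J → extend J i)) u + b * ι (suc i) u
        extended i u = begin
          K * b * ι i u + b * p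
            ≤⟨ +-monoʳ-≤ _ (*-monoʳ-≤ b (covers cJ (just (clamp R (suc i) , u)))) ⟩
          K * b * ι i u + b * ∑ Js (λ J → ⟦ level J (suc i) u ⟧)
            ≡⟨ cong (λ a → a * ι i u + b * ∑ Js (λ J → ⟦ level J (suc i) u ⟧)) (sym length-Ss) ⟩
          length Ss * ι i u + b * ∑ Js (λ J → ⟦ level J (suc i) u ⟧)
            ≡⟨ sym (trans (∑-distrib-+ Js _ _) (cong₂ _+_ (∑-* (length Ss) _) (∑-* b _))) ⟩
          ∑ Js (λ J → length Ss * ⟦ common J i u ⟧ + b * ⟦ level J (suc i) u ⟧)
            ≤⟨ ∑-monoᴬ (All.map (λ s → extend-depth s {Ss} {b} {u} (b≤Ss u) i) (stable cJ)) ⟩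
          ∑ Js (λ J → ∑ Ss (λ S → ⟦ extend J i S u ⟧) + b * ⟦ common J (suc i) u ⟧)
            ≡⟨ trans (∑-distrib-+ Js _ _) (cong₂ _+_ (sym (depth-product _ u)) (∑-* b _)) ⟩
          depth (product (λ J → extend J i)) u + b * ι (suc i) u ∎
          where open ≤-Reasoning

        topped : ∀ u → b * K * ι R u + b * 1 * p ≤ depth (product top) u
        topped u = begin
          b * K * ι R u + b * 1 * p
            ≡⟨ trans (+-comm (b * K * ι R u) (b * 1 * p)) (cong₂ (λ x y → x * p + y * ι R u) (*-identityʳ b) (*-comm b K)) ⟩
          b * p + K * b * ι R u
            ≤⟨ +-monoˡ-≤ _ (*-monoʳ-≤ b (covers cJ nothing)) ⟩
          b * depth Js nothing + K * b * ι R u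
            ≡⟨ cong (λ a → b * depth Js nothing + a * ι R u) (sym length-Ss) ⟩
          b * depth Js nothing + length Ss * ι R u
            ≡⟨ sym (trans (∑-distrib-+ Js _ _) (cong₂ _+_ (∑-* b _) (∑-* (length Ss) _))) ⟩
          ∑ Js (λ J → b * ⟦ J nothing ⟧ + length Ss * ⟦ common J R u ⟧)
            ≤⟨ ∑-monoᴬ (All.map (λ s → top-depth s {Ss} {b} {u} (b≤Ss u)) (stable cJ)) ⟩
          ∑ Js (λ J → ∑ Ss (λ S → ⟦ top J S u ⟧))
            ≡⟨ sym (depth-product top u) ⟩
          depth (product top) u ∎
          where open ≤-Reasoning

        -- Here `μ d` is 1 + K + ... + K^d. At distance d below level R, κ and μ are the
        -- coefficients of `ι i u` and of p in the telescoped inequality.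
        κ μ : ℕ → ℕ
        κ = powers K
        μ zero    = 1
        μ (suc d) = μ d + κ d

        -- The sets extend J i S cover u as often as common J i does, plus 1 / K of the times
        -- that level i + 1 covers u while common J (i + 1) does not. Descending from level R
        -- these losses telescope, and the sets J containing the apex, for which common J R
        -- is empty, leave a net gain.
        record Partial (i k m n : ℕ) : Set where
          field
            sets        : List (V → Bool)
            sets-stable : All (Stable E) sets
            sets-size   : length sets ≤ q * (b * n)
            sets-depth  : ∀ u → b * k * ι i u + b * m * p ≤ depth sets u

        open Partial

        partial : ∀ d {i} → d + i ≡ R → Partial i (κ d) (μ d) (gain K d)
        partial zero refl = record
          { sets        = product top
          ; sets-stable = product-stable (λ sJ → top-stable sJ)
          ; sets-size   = length-product top
          ; sets-depth  = topped
          }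
        partial (suc d) {i} d+i≡R = record
          -- The loss in `extended` is b · `ι (suc i) u` per copy. Exactly κ d copies make the total
          -- loss equal to the term b · κ d · `ι (suc i) u` that `P` supplies, so the two cancel.
          { sets        = copies k L ++ sets P
          ; sets-stable = All.++⁺ (All-copies k (product-stable (λ sJ → extend-stable sJ i<R))) (sets-stable P)
          ; sets-size   = begin
              length (copies k L ++ sets P)            ≡⟨ length-++ (copies k L) ⟩
              length (copies k L) + length (sets P)    ≡⟨ cong (_+ length (sets P)) (length-copies k L) ⟩
              k * length L + length (sets P)           ≤⟨ +-mono-≤ (*-monoʳ-≤ k (length-product _)) (sets-size P) ⟩
              k * (q * (b * K)) + q * (b * gain K d)     ≡⟨ sizes k q b K (gain K d) ⟩
              q * (b * (gain K d + k * K))               ∎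
          ; sets-depth  = λ u → +-cancelʳ-≤ (k * (b * ι (suc i) u)) _ _ (begin
              b * (k * K) * ι i u + b * (μ d + k) * p + k * (b * ι (suc i) u)
                ≡⟨ depths b k K (μ d) p (ι i u) (ι (suc i) u) ⟩
              k * (K * b * ι i u + b * p) + (b * k * ι (suc i) u + b * μ d * p)
                ≤⟨ +-mono-≤ (*-monoʳ-≤ k (extended i u)) (sets-depth P u) ⟩
              k * (depth L u + b * ι (suc i) u) + depth (sets P) u
                ≡⟨ shuffle k (depth L u) (b * ι (suc i) u) (depth (sets P) u) ⟩
              k * depth L u + depth (sets P) u + k * (b * ι (suc i) u)
                ≡⟨ cong (λ x → x + depth (sets P) u + k * (b * ι (suc i) u)) (sym (depth-copies k L u)) ⟩
              depth (copies k L) u + depth (sets P) u + k * (b * ι (suc i) u)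
                ≡⟨ cong (_+ k * (b * ι (suc i) u)) (sym (depth-++ (copies k L) (sets P) u)) ⟩
              depth (copies k L ++ sets P) u + k * (b * ι (suc i) u) ∎)
          }
          where
          open ≤-Reasoning
          k = κ d
          L = product (λ J → extend J i)
          P = partial d (trans (+-suc d i) d+i≡R)

          i<R : suc i ≤ R
          i<R = subst (suc i ≤_) d+i≡R (s≤s (m≤n+m i d))

          sizes : ∀ k q b K n → k * (q * (b * K)) + q * (b * n) ≡ q * (b * (n + k * K))
          sizes = solve 5 (λ k q b K n → k :* (q :* (b :* K)) :+ q :* (b :* n) := q :* (b :* (n :+ k :* K))) refl
            where open +-*-Solver

          depths : ∀ b k K m p x y → b * (k * K) * x + b * (m + k) * p + k * (b * y) ≡
                                     k * (K * b * x + b * p) + (b * k * y + b * m * p)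
          depths = solve 7 (λ b k K m p x y → b :* (k :* K) :* x :+ b :* (m :+ k) :* p :+ k :* (b :* y) :=
                                     k :* (K :* b :* x :+ b :* p) :+ (b :* k :* y :+ b :* m :* p)) refl
            where open +-*-Solver

          shuffle : ∀ k x y z → k * (x + y) + z ≡ k * x + z + k * y
          shuffle = solve 4 (λ k x y z → k :* (x :+ y) :+ z := k :* x :+ z :+ k :* y) refl
            where open +-*-Solver

        κ+μ : ∀ d → κ d + μ d ≡ suc (gain K d)
        κ+μ zero    = +-comm K 1
        κ+μ (suc d) = begin
          κ d * K + (μ d + κ d)   ≡⟨ cong (κ d * K +_) (trans (+-comm (μ d) (κ d)) (κ+μ d)) ⟩
          κ d * K + suc (gain K d)  ≡⟨ trans (+-suc _ _) (cong suc (+-comm (κ d * K) (gain K d))) ⟩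
          suc (gain K d + κ d * K)  ∎
          where open ≡-Reasoning

      -- Level 0 covers every vertex at least p times, so `Partial` at i = 0 gives depth at least b
      -- (κ R + μ R) p. With ν = `gain K R`, a colouring of the cone of value q / p yields one of
      -- the base whose value is smaller by the factor ν / (ν + 1).
      improved : Colouring E (q * (b * gain K R)) (p * (b * suc (gain K R)))
      improved = mkColouring (sets P) (sets-stable P) (sets-size P) λ u → begin
        p * (b * suc (gain K R))             ≡⟨ cong (λ s → p * (b * s)) (sym (κ+μ R)) ⟩
        p * (b * (κ R + μ R))              ≡⟨ split p b (κ R) (μ R) ⟩
        b * κ R * p + b * μ R * p          ≤⟨ +-monoˡ-≤ _ (*-monoʳ-≤ (b * κ R) (covers cJ (just (clamp R 0 , u)))) ⟩
        b * κ R * ι 0 u + b * μ R * p      ≤⟨ sets-depth P u ⟩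
        depth (sets P) u                   ∎
        where
        open ≤-Reasoning
        P = partial R (+-identityʳ R)

        split : ∀ p b k m → p * (b * (k + m)) ≡ b * k * p + b * m * p
        split = solve 4 (λ p b k m → p :* (b :* (k :+ m)) := b :* k :* p :+ b :* m :* p) refl
          where open +-*-Solver

-- Iterated cones and prescribed fractional chromatic numbers

module Towers where

  open ListSums
  open Colourings
  open FractionalChromatic
  open Cones
  open import Defs using (Graph; Adj; adj?; symm; irrefl; order; complete)
  open import Data.Fin.Base using (Fin; zero; suc; remQuot; combine)
  open import Data.Fin.Properties using (remQuot-combine)
  open import Data.List.Properties using (length-map)
  open import Data.List.Membership.Propositional.Properties using (∈-map⁺)
  open import Data.Maybe.Base using (just; nothing)
  open import Data.Nat.Base
  open import Data.Nat.Properties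
  open import Data.Nat.Solver using (module +-*-Solver)

  LB : Graph → ℕ → Set
  LB G = LocallyBipartite (Adj G)

  pullback-LB : ∀ {V W : Set} {E : V → V → Set} {s} (h : W → V) →
                LocallyBipartite E s → LocallyBipartite (λ u v → E (h u) (h v)) s
  pullback-LB h bip xs short =
    let c , proper = bip (map h xs) (subst (_≤ _) (sym (length-map h xs)) short)
    in (λ w → c (h w)) , λ u v u∈ v∈ → proper (h u) (h v) (∈-map⁺ h u∈) (∈-map⁺ h v∈)

  module _ (G : Graph) (R : ℕ) where
    private
      n = order G
      module C = Cone (Adj G) R

    decode : Fin (suc (suc R * n)) → C.Vertex
    decode zero    = nothing
    decode (suc i) = just (remQuot n i)

    encode : C.Vertex → Fin (suc (suc R * n))
    encode nothing        = zero
    encode (just (l , u)) = suc (combine l u)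

    decode∘encode : ∀ x → decode (encode x) ≡ x
    decode∘encode nothing        = refl
    decode∘encode (just (l , u)) = cong just (remQuot-combine l u)

    cone : Graph
    cone = record
      { order  = suc (suc R * n)
      ; Adj    = λ a b → C.ConeAdj (decode a) (decode b)
      ; adj?   = λ a b → C.coneAdj? (adj? G) (decode a) (decode b)
      ; symm   = C.coneAdj-sym (symm G)
      ; irrefl = λ a → C.coneAdj-irrefl (irrefl G) (decode a)
      }

    encoded : ∀ {q p} → Colouring C.ConeAdj q p → Colouring (Adj cone) q p
    encoded = pullback decode (λ e → e)

    decoded : ∀ {q p} → Colouring (Adj cone) q p → Colouring C.ConeAdj q p
    decoded = pullback encode λ {x} {y} → subst₂ C.ConeAdj (sym (decode∘encode x)) (sym (decode∘encode y))

    restricted : ∀ {q p} → Colouring (Adj cone) q p → Colouring (Adj G) q p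
    restricted c = pullback (λ u → just (zero , u)) (λ e → C.side (C.both-0 refl refl) e) (decoded c)

  tower : ℕ → ℕ → Graph
  tower R zero    = complete 1
  tower R (suc j) = cone (tower R j) R

  tower-LB : ∀ R j → LB (tower R j) R
  tower-LB R zero xs _ = (λ _ → false) , λ { zero zero _ _ 0≢0 → contradiction refl 0≢0 }
  tower-LB R (suc j) = pullback-LB (decode (tower R j) R)
    (Cone.cone-locallyBipartite (Adj (tower R j)) R ≤-refl (tower-LB R j))

  -- Bernoulli's inequality (1 + 1 / n)^j ≥ 1 + j / n, cleared of denominators; by induction on j.
  bernoulli : ∀ n j → (n + j) * n ^ j ≤ n * suc n ^ j
  bernoulli n zero    = ≤-reflexive (cong (_* 1) (+-identityʳ n))
  bernoulli n (suc j) = begin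
    (n + suc j) * (n * n ^ j)      ≡⟨ solve 3 (λ n j x → (n :+ (con 1 :+ j)) :* (n :* x) :=
                                        (n :* n :+ n :* j :+ n) :* x) refl n j (n ^ j) ⟩
    (n * n + n * j + n) * n ^ j    ≤⟨ *-monoˡ-≤ (n ^ j) (m≤m+n (n * n + n * j + n) j) ⟩
    (n * n + n * j + n + j) * n ^ j ≡⟨ solve 3 (λ n j x → (n :* n :+ n :* j :+ n :+ j) :* x :=
                                        (con 1 :+ n) :* ((n :+ j) :* x)) refl n j (n ^ j) ⟩
    suc n * ((n + j) * n ^ j)      ≤⟨ *-monoʳ-≤ (suc n) (bernoulli n j) ⟩
    suc n * (n * suc n ^ j)        ≡⟨ solve 3 (λ m n x → m :* (n :* x) := n :* (m :* x)) refl (suc n) n (suc n ^ j) ⟩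
    n * (suc n * suc n ^ j)        ∎
    where
    open ≤-Reasoning
    open +-*-Solver

  ^-distribʳ-* : ∀ j m n → (m * n) ^ j ≡ m ^ j * n ^ j
  ^-distribʳ-* zero    m n = refl
  ^-distribʳ-* (suc j) m n = trans (cong (m * n *_) (^-distribʳ-* j m n))
    (solve 4 (λ m n x y → m :* n :* (x :* y) := m :* x :* (n :* y)) refl m n (m ^ j) (n ^ j))
    where open +-*-Solver

  exponential-beats : ∀ K n .{{_ : NonZero n}} → K * n ^ (K * n) < suc n ^ (K * n)
  exponential-beats K n = *-cancelˡ-< n _ _ (begin-strict
    n * (K * n ^ j)          <⟨ *-monoʳ-< n (*-monoˡ-< (n ^ j) (n<1+n K)) ⟩
    n * (suc K * n ^ j)      ≡⟨ solve 3 (λ n K x → n :* ((con 1 :+ K) :* x) := (n :+ K :* n) :* x) refl n K (n ^ j) ⟩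
    (n + j) * n ^ j          ≤⟨ bernoulli n j ⟩
    n * suc n ^ j            ∎)
    where
    open ≤-Reasoning
    open +-*-Solver
    j = K * n
    instance _ = m^n≢0 n j

  gain>0 : ∀ K d → 0 < gain (suc K) d
  gain>0 K zero    = z<s
  gain>0 K (suc d) = ≤-trans (gain>0 K d) (m≤m+n _ _)

  module _ {R K b : ℕ} where

    private ν = gain K R

    -- Two colourings are carried along: `c′` is improved at every cone, while `c` is merely
    -- restricted and certifies the same bound K for every base, so that the factor ν / (ν + 1) is
    -- the same throughout.
    descend : ∀ j {q p} → Colouring (Adj (tower R j)) (K * b) b → Colouring (Adj (tower R j)) q p →
              Colouring (Adj (tower R 0)) (q * (b * ν) ^ j) (p * (b * suc ν) ^ j)
    descend zero {q} {p} _ c = subst₂ (Colouring (Adj (tower R 0))) (sym (*-identityʳ q)) (sym (*-identityʳ p)) c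
    descend (suc j) {q} {p} c c′ =
      subst₂ (Colouring (Adj (tower R 0))) (*-assoc q (b * ν) _) (*-assoc p (b * suc ν) _)
        (descend j cʲ (Cone.improved (Adj (tower R j)) R cʲ (decoded (tower R j) R c′)))
      where cʲ = restricted (tower R j) R c

  colouring-≤ : ∀ {V : Set} {E : V → V → Set} {q p} → V → Colouring E q p → p ≤ q
  colouring-≤ v c = ≤-trans (covers c v) (≤-trans (∑-mono (classes c) (λ J → ⟦⟧≤1 (J v)))
    (≤-trans (≤-reflexive (sym (length-∑ (classes c)))) (size c)))
    where
    ⟦⟧≤1 : ∀ b → ⟦ b ⟧ ≤ 1
    ⟦⟧≤1 true  = ≤-refl
    ⟦⟧≤1 false = z≤n

  -- Suppose that the j-th graph had value at most K. Descending to the single vertex would leave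
  -- value at most K (ν / (ν + 1))^j, which is less than 1 for j = K ν by Bernoulli; but a colouring
  -- of a nonempty graph has value at least 1.
  tower-unbounded : ∀ R K → ∃ λ j → ¬ Colourable (Adj (tower R j)) (suc K)
  tower-unbounded R K-1 = j , λ (p , c) → <⇒≱ (exponential-beats K ν)
    (bound (suc p) (colouring-≤ zero (descend {R} {K} {suc p} j c c)))
    where
    K = suc K-1
    ν = gain K R
    instance _ = >-nonZero (gain>0 K-1 R)
    j = K * ν
    bound : ∀ b .{{_ : NonZero b}} → b * (b * suc ν) ^ j ≤ K * b * (b * ν) ^ j → suc ν ^ j ≤ K * ν ^ j
    bound b le = *-cancelˡ-≤ (b * b ^ j) (begin
      b * b ^ j * suc ν ^ j     ≡⟨ *-assoc b (b ^ j) _ ⟩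
      b * (b ^ j * suc ν ^ j)   ≡⟨ cong (b *_) (sym (^-distribʳ-* j b (suc ν))) ⟩
      b * (b * suc ν) ^ j       ≤⟨ le ⟩
      K * b * (b * ν) ^ j       ≡⟨ cong (K * b *_) (^-distribʳ-* j b ν) ⟩
      K * b * (b ^ j * ν ^ j)   ≡⟨ solve 4 (λ K b x y → K :* b :* (x :* y) := b :* x :* (K :* y)) refl K b (b ^ j) (ν ^ j) ⟩
      b * b ^ j * (K * ν ^ j)   ∎)
      where
      open ≤-Reasoning
      open +-*-Solver
      instance
        _ = m^n≢0 b j
        _ = m*n≢0 b (b ^ j)

  colourable-mono : ∀ {V : Set} {E : V → V → Set} {k k′} → k ≤ k′ → Colourable E k → Colourable E k′
  colourable-mono k≤k′ (p , c) = p , enlarge (*-monoˡ-≤ (suc p) k≤k′) c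

  point-colourable : ∀ R → Colourable (Adj (tower R 0)) 1
  point-colourable R = 0 , mkColouring ((λ _ → true) ∷ []) (stable′ ∷ []) ≤-refl (λ _ → ≤-refl)
    where
    stable′ : Stable (Adj (tower R 0)) (λ _ → true)
    stable′ zero zero _ _ 0≢0 = 0≢0 refl

  record Between (s M : ℕ) : Set₁ where
    field
      graph      : Graph
      local      : LB graph s
      upper      : Colourable (Adj graph) (suc M)
      lower      : ¬ Colourable (Adj graph) M

  abstract
    -- A cone raises χ_f by at most 1, so the tower cannot jump over a unit interval. Going down
    -- from a graph that is too expensive, stop at the first cone whose base is affordable.
    between : ∀ s M → Between s (suc M)
    between s M = let j , ¬c = tower-unbounded s M in search j ¬c
      where
      search : ∀ j → ¬ Colourable (Adj (tower s j)) (suc M) → Between s (suc M)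
      search zero    ¬c = contradiction (colourable-mono {k′ = suc M} (s≤s z≤n) (point-colourable s)) ¬c
      search (suc j) ¬c with FractionalColourings.colourable? (tower s j) (suc M)
      ... | no ¬c′ = search j ¬c′
      ... | yes c  =
        let p , cᶜ = Cone.cone-colourable (Adj (tower s j)) s {suc M} c in record
        { graph = tower s (suc j)
        ; local = tower-LB s (suc j)
        ; upper = p , encoded (tower s j) s cᶜ
        ; lower = ¬c
        }

-- Lexicographic sums

module LexicographicSums where

  open ListSums
  open Colourings
  open Cones using (LocallyBipartite)
  open Towers using (LB)
  open import Defs using (Graph; Adj; adj?; symm; irrefl; order; CliqueFree; _⊆ᴳ_)
  import Data.Bool.Properties as Bool
  open import Data.Empty using (⊥)
  open import Data.Fin.Base using (Fin; zero; suc; toℕ; splitAt; _↑ˡ_; _↑ʳ_)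
  open import Data.Fin.Patterns using (0F; 1F; 2F; 3F; 4F)
  open import Data.Fin.Properties
    using (splitAt-↑ˡ; splitAt-↑ʳ; splitAt⁻¹-↑ˡ; splitAt⁻¹-↑ʳ; toℕ-↑ˡ; toℕ-↑ʳ; toℕ<n; any?)
  import Data.Fin.Properties as Fin
  open import Data.List.Properties using (length-map)
  import Data.List.Relation.Unary.All as All
  import Data.List.Relation.Unary.All.Properties as All
  open import Data.Nat.Base
  open import Data.Nat.Properties
  open import Relation.Nullary.Decidable using (dec-true)

  Block : ∀ {k} → (Fin k → Graph) → Set
  Block {k} 𝒢 = Σ (Fin k) λ i → Fin (order (𝒢 i))

  size-Σ : ∀ k → (Fin k → Graph) → ℕ
  size-Σ zero    𝒢 = 0
  size-Σ (suc k) 𝒢 = order (𝒢 zero) + size-Σ k (𝒢 ∘ suc)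

  before : ∀ {k} → (Fin k → Graph) → Fin k → ℕ
  before 𝒢 zero    = 0
  before 𝒢 (suc i) = order (𝒢 zero) + before (𝒢 ∘ suc) i

  shift : ∀ {k} {𝒢 : Fin (suc k) → Graph} → Block (𝒢 ∘ suc) → Block 𝒢
  shift (i , w) = suc i , w

  block : ∀ {k} (𝒢 : Fin k → Graph) → Fin (size-Σ k 𝒢) → Block 𝒢
  block {suc k} 𝒢 v = [ zero ,_ , (λ w → shift {𝒢 = 𝒢} (block (𝒢 ∘ suc) w)) ]′ (splitAt (order (𝒢 zero)) v)

  unblock : ∀ {k} (𝒢 : Fin k → Graph) → Block 𝒢 → Fin (size-Σ k 𝒢)
  unblock 𝒢 (zero  , w) = w ↑ˡ _
  unblock 𝒢 (suc i , w) = order (𝒢 zero) ↑ʳ unblock (𝒢 ∘ suc) (i , w)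

  block∘unblock : ∀ {k} (𝒢 : Fin k → Graph) x → block 𝒢 (unblock 𝒢 x) ≡ x
  block∘unblock {suc k} 𝒢 (zero  , w) rewrite splitAt-↑ˡ (order (𝒢 zero)) w (size-Σ k (𝒢 ∘ suc)) = refl
  block∘unblock {suc k} 𝒢 (suc i , w)
    rewrite splitAt-↑ʳ (order (𝒢 zero)) _ (unblock (𝒢 ∘ suc) (i , w)) | block∘unblock (𝒢 ∘ suc) (i , w) = refl

  -- Vertices are numbered block by block. Hence counting the vertices of a subgraph in the earlier
  -- blocks reduces to counting distinct numbers below `before 𝒢 i`.
  block-before : ∀ {k} (𝒢 : Fin k → Graph) i v → toℕ (proj₁ (block 𝒢 v)) < toℕ i → toℕ v < before 𝒢 i
  block-before {suc k} 𝒢 (suc i) v lt with splitAt (order (𝒢 zero)) v in eq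
  ... | inj₁ w = begin-strict
    toℕ v           ≡⟨ cong toℕ (sym (splitAt⁻¹-↑ˡ {i = v} eq)) ⟩
    toℕ (w ↑ˡ _)    ≡⟨ toℕ-↑ˡ w (size-Σ k (𝒢 ∘ suc)) ⟩
    toℕ w           <⟨ toℕ<n w ⟩
    order (𝒢 zero)  ≤⟨ m≤m+n _ _ ⟩
    before 𝒢 (suc i) ∎
    where open ≤-Reasoning
  ... | inj₂ w = begin-strict
    toℕ v                                   ≡⟨ cong toℕ (sym (splitAt⁻¹-↑ʳ {i = v} eq)) ⟩
    toℕ (order (𝒢 zero) ↑ʳ w)               ≡⟨ toℕ-↑ʳ (order (𝒢 zero)) w ⟩
    order (𝒢 zero) + toℕ w                  <⟨ +-monoʳ-< (order (𝒢 zero)) (block-before (𝒢 ∘ suc) i w (s<s⁻¹ lt)) ⟩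
    before 𝒢 (suc i)                        ∎
    where open ≤-Reasoning

  triangle-free : ∀ {V : Set} {E : V → V → Set} {s} → 3 ≤ s → LocallyBipartite E s →
                  ∀ {u v w} → E u v → E v w → E u w → ⊥
  triangle-free 3≤s bip {u} {v} {w} uv vw uw =
    let c , proper = bip (u ∷ v ∷ w ∷ []) 3≤s in
    three (proper u v (here refl) (there (here refl)) uv)
          (proper v w (there (here refl)) (there (there (here refl))) vw)
          (proper u w (here refl) (there (there (here refl))) uw)
    where
    three : ∀ {a b c : Bool} → a ≢ b → b ≢ c → a ≢ c → ⊥
    three {true}  {true}          ab bc ac = ab refl
    three {true}  {false} {true}  ab bc ac = ac refl
    three {true}  {false} {false} ab bc ac = bc refl
    three {false} {false}         ab bc ac = ab refl
    three {false} {true}  {true}  ab bc ac = bc refl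
    three {false} {true}  {false} ab bc ac = ac refl

  module Lexicographic (F : Graph) (𝒢 : Fin (order F) → Graph) where

    data LexAdj : Block 𝒢 → Block 𝒢 → Set where
      outer : ∀ {i j v w} → Adj F i j → LexAdj (i , v) (j , w)
      inner : ∀ {i v w} → Adj (𝒢 i) v w → LexAdj (i , v) (i , w)

    lexAdj? : ∀ x y → Dec (LexAdj x y)
    lexAdj? (i , v) (j , w) with adj? F i j | i Fin.≟ j
    ... | yes e | _     = yes (outer e)
    ... | no ¬e | no i≢j = no λ { (outer e) → ¬e e ; (inner _) → i≢j refl }
    ... | no ¬e | yes refl with adj? (𝒢 i) v w
    ...   | yes e′ = yes (inner e′)
    ...   | no ¬e′ = no λ { (outer e) → ¬e e ; (inner e′) → ¬e′ e′ }

    lexAdj-sym : ∀ {x y} → LexAdj x y → LexAdj y x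
    lexAdj-sym (outer e)         = outer (symm F e)
    lexAdj-sym (inner {i = i} e) = inner (symm (𝒢 i) e)

    lexAdj-irrefl : ∀ x → ¬ LexAdj x x
    lexAdj-irrefl (i , v) (outer e) = irrefl F i e
    lexAdj-irrefl (i , v) (inner e) = irrefl (𝒢 i) v e

    lexAdj-inner : ∀ {i v w} → LexAdj (i , v) (i , w) → Adj (𝒢 i) v w
    lexAdj-inner {i} (outer e) = contradiction e (irrefl F i)
    lexAdj-inner     (inner e) = e

    lexAdj-outer : ∀ {x y} → LexAdj x y → proj₁ x ≢ proj₁ y → Adj F (proj₁ x) (proj₁ y)
    lexAdj-outer (outer e) _   = e
    lexAdj-outer (inner e) i≢i = contradiction refl i≢i

    lex : Graph
    lex = record
      { order  = size-Σ (order F) 𝒢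
      ; Adj    = λ u v → LexAdj (block 𝒢 u) (block 𝒢 v)
      ; adj?   = λ u v → lexAdj? (block 𝒢 u) (block 𝒢 v)
      ; symm   = lexAdj-sym
      ; irrefl = λ v → lexAdj-irrefl (block 𝒢 v)
      }

    module _ {s : ℕ} (3≤s : 3 ≤ s) (F-local : LB F s) (𝒢-local : ∀ i → LB (𝒢 i) s) where

      private
        monochromatic : ∀ {x y z} → LexAdj x y → LexAdj y z → LexAdj x z →
                        proj₁ x ≡ proj₁ y → proj₁ x ≡ proj₁ z → ⊥
        monochromatic {i , _} {_ , _} {_ , _} xy yz xz refl refl =
          triangle-free 3≤s (𝒢-local i) (lexAdj-inner xy) (lexAdj-inner yz) (lexAdj-inner xz)

        rainbow : ∀ {x y z} → LexAdj x y → LexAdj y z → LexAdj x z →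
                  proj₁ x ≢ proj₁ y → proj₁ y ≢ proj₁ z → proj₁ x ≢ proj₁ z → ⊥
        rainbow xy yz xz x≢y y≢z x≢z = triangle-free 3≤s F-local
          (lexAdj-outer xy x≢y) (lexAdj-outer yz y≢z) (lexAdj-outer xz x≢z)

      -- Three clique vertices in one block would be a triangle of that block, and three in distinct
      -- blocks a triangle of F. So there are at most two blocks with at most two vertices each.
      lex-K₅-free : CliqueFree 5 lex
      lex-K₅-free K = no-five
        where
        open _⊆ᴳ_ K
        c : Fin 5 → Fin (order F)
        c a = proj₁ (block 𝒢 (vertex a))

        same : ∀ a b d → a ≢ b → b ≢ d → a ≢ d → c a ≡ c b → c a ≢ c d
        same a b d ab bd ad = monochromatic (edge ab) (edge bd) (edge ad)

        two : ∀ a b d → a ≢ b → b ≢ d → a ≢ d → c a ≢ c b → c a ≡ c d ⊎ c b ≡ c d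
        two a b d ab bd ad a≢b with c a Fin.≟ c d | c b Fin.≟ c d
        ... | yes a≡d | _       = inj₁ a≡d
        ... | no  _   | yes b≡d = inj₂ b≡d
        ... | no  a≢d | no b≢d  = contradiction (rainbow (edge ab) (edge bd) (edge ad) a≢b b≢d) λ f → f a≢d

        no-five : ⊥
        no-five with c 0F Fin.≟ c 1F
        ... | no 0≢1 = pigeon (two 0F 1F 2F (λ ()) (λ ()) (λ ()) 0≢1)
                              (two 0F 1F 3F (λ ()) (λ ()) (λ ()) 0≢1)
                              (two 0F 1F 4F (λ ()) (λ ()) (λ ()) 0≢1)
          where
          pigeon : c 0F ≡ c 2F ⊎ c 1F ≡ c 2F → c 0F ≡ c 3F ⊎ c 1F ≡ c 3F → c 0F ≡ c 4F ⊎ c 1F ≡ c 4F → ⊥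
          pigeon (inj₁ 2≡) (inj₁ 3≡) _         = same 0F 2F 3F (λ ()) (λ ()) (λ ()) 2≡ 3≡
          pigeon (inj₂ 2≡) (inj₂ 3≡) _         = same 1F 2F 3F (λ ()) (λ ()) (λ ()) 2≡ 3≡
          pigeon (inj₁ 2≡) (inj₂ _)  (inj₁ 4≡) = same 0F 2F 4F (λ ()) (λ ()) (λ ()) 2≡ 4≡
          pigeon (inj₁ _)  (inj₂ 3≡) (inj₂ 4≡) = same 1F 3F 4F (λ ()) (λ ()) (λ ()) 3≡ 4≡
          pigeon (inj₂ _)  (inj₁ 3≡) (inj₁ 4≡) = same 0F 3F 4F (λ ()) (λ ()) (λ ()) 3≡ 4≡
          pigeon (inj₂ 2≡) (inj₁ _)  (inj₂ 4≡) = same 1F 2F 4F (λ ()) (λ ()) (λ ()) 2≡ 4≡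
        ... | yes 0≡1 = absurd (two 0F 2F 3F (λ ()) (λ ()) (λ ()) (0≢ 2F (λ ()) (λ ())))
                               (two 0F 2F 4F (λ ()) (λ ()) (λ ()) (0≢ 2F (λ ()) (λ ())))
          where
          0≢ : ∀ a → 1F ≢ a → 0F ≢ a → c 0F ≢ c a
          0≢ a 1≢a 0≢a = same 0F 1F a (λ ()) 1≢a 0≢a 0≡1

          absurd : c 0F ≡ c 3F ⊎ c 2F ≡ c 3F → c 0F ≡ c 4F ⊎ c 2F ≡ c 4F → ⊥
          absurd (inj₁ 3≡) _         = 0≢ 3F (λ ()) (λ ()) 3≡
          absurd (inj₂ _)  (inj₁ 4≡) = 0≢ 4F (λ ()) (λ ()) 4≡
          absurd (inj₂ 3≡) (inj₂ 4≡) = same 2F 3F 4F (λ ()) (λ ()) (λ ()) 3≡ 4≡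

    module _ {M-1 : ℕ} (F-lower : ¬ Colourable (Adj F) (suc M-1))
             (𝒢-lower : ∀ i → ¬ Colourable (Adj (𝒢 i)) (suc M-1)) where

      private
        M = suc M-1

      -- The classes that meet block i give a P-fold colouring of `𝒢 i`; as χ_f of the block exceeds
      -- M, there are at least M P of them. The blocks met by a given class are pairwise nonadjacent
      -- in F. So the M² P classes, read as sets of blocks, form an M P-fold colouring of F of value
      -- M, which F does not admit.
      lex-lower : ¬ Colourable (Adj lex) (M * M)
      -- The successor of `p + M-1 * P` computes to M · P, the multiplicity of `cF`.
      lex-lower (p , cˡ) = F-lower (p + M-1 * P , cF)
        where
        P = suc p

        c : Colouring LexAdj (M * M * P) P
        c = pullback (unblock 𝒢)
          (λ {x} {y} → subst₂ LexAdj (sym (block∘unblock 𝒢 x)) (sym (block∘unblock 𝒢 y))) cˡ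

        hit? : ∀ i (J : Block 𝒢 → Bool) → Dec (∃ λ w → J (i , w) ≡ true)
        hit? i J = any? (λ w → J (i , w) Bool.≟ true)

        hits : Fin (order F) → ℕ
        hits i = ∑ (classes c) (λ J → ⟦ does (hit? i J) ⟧)

        part : ∀ i → Colouring (Adj (𝒢 i)) (hits i) P
        part i = mkColouring (map (λ J w → J (i , w)) hitting)
          (All.map⁺ (All.filter⁺ (hit? i) (All.map (λ s u v u∈ v∈ e → s (i , u) (i , v) u∈ v∈ (inner e)) (stable c))))
          (≤-reflexive (trans (length-map _ hitting) (trans (length-∑ hitting) (∑-filter (hit? i) (classes c) (λ _ → 1)))))
          λ w → begin
            P                                                    ≤⟨ covers c (i , w) ⟩
            ∑ (classes c) (λ J → ⟦ J (i , w) ⟧)                  ≤⟨ ∑-mono (classes c) (kept w) ⟩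
            ∑ (classes c) (λ J → if does (hit? i J) then ⟦ J (i , w) ⟧ else 0)
                                                                 ≡⟨ sym (∑-filter (hit? i) (classes c) _) ⟩
            ∑ hitting (λ J → ⟦ J (i , w) ⟧)                      ≡⟨ sym (∑-map _ hitting _) ⟩
            depth (map (λ J w → J (i , w)) hitting) w            ∎
          where
          open ≤-Reasoning
          hitting = filter (hit? i) (classes c)

          kept : ∀ w J → ⟦ J (i , w) ⟧ ≤ (if does (hit? i J) then ⟦ J (i , w) ⟧ else 0)
          kept w J with J (i , w) in eq
          ... | false = z≤n
          ... | true rewrite dec-true (hit? i J) (w , eq) = ≤-refl

        MP≤hits : ∀ i → M * P ≤ hits i
        MP≤hits i with M * P ≤? hits i
        ... | yes le = le
        ... | no  ≰  = contradiction (p , enlarge (<⇒≤ (≰⇒> ≰)) (part i)) (𝒢-lower i)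

        cF : Colouring (Adj F) (M * (M * P)) (M * P)
        cF = mkColouring (map (λ J i → does (hit? i J)) (classes c))
          (All.map⁺ (All.map stable-F (stable c)))
          (≤-trans (≤-reflexive (length-map _ (classes c)))
            (≤-trans (size c) (≤-reflexive (*-assoc M M P))))
          (λ i → ≤-trans (MP≤hits i) (≤-reflexive (sym (∑-map _ (classes c) _))))
          where
          stable-F : ∀ {J} → Stable LexAdj J → Stable (Adj F) (λ i → does (hit? i J))
          stable-F {J} s i j i∈ j∈ e with hit? i J | hit? j J
          ... | yes (v , v∈) | yes (w , w∈) = s (i , v) (j , w) v∈ w∈ (outer e)

-- Large independent sets in subgraphs of a lexicographic sum

module LargeStableSets where

  open ListSums
  open Colourings
  open Cones using (∈-mapMaybe; ∧-true)
  open Towers using (LB)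
  open LexicographicSums
  open import Defs using (Graph; Adj; order; Independent; α; independent?; ∈-subsets)
  import Data.Bool.Properties as Bool
  open import Data.Fin.Base using (Fin; zero; suc; toℕ; fromℕ<)
  open import Data.Fin.Properties using (toℕ-fromℕ<; toℕ<n; toℕ-injective)
  import Data.Fin.Properties as Fin
  open import Data.Fin.Subset using (Subset; ∣_∣)
  import Data.Fin.Subset as Subset
  import Data.List.Base as List
  open import Data.List.Extrema.Nat using (v≤max⁺)
  open import Data.List.Properties using (length-map; length-tabulate; length-upTo)
  open import Data.List.Membership.Propositional using (_∈_)
  open import Data.List.Membership.Propositional.Properties
    using (∈-map⁺; ∈-allFin; ∈-upTo⁺; ∈-filter⁺)
  import Data.List.Relation.Unary.All as All
  import Data.List.Relation.Unary.All.Properties as All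
  import Data.List.Relation.Unary.Any as Any
  import Data.List.Relation.Unary.Unique.Propositional.Properties as Unique
  open import Data.Maybe.Base using (Maybe; just; nothing; maybe′)
  open import Data.Nat.Base
  open import Data.Nat.Properties
  open import Data.Nat.Solver using (module +-*-Solver)
  open import Data.Unit.Base using (tt)
  open import Data.Vec.Base as Vec using (tabulate)
  open import Data.Vec.Properties using (lookup∘tabulate; []=⇒lookup)
  open import Relation.Binary.Definitions using (tri<; tri≈; tri>)
  open import Relation.Nullary.Decidable using (dec-true)

  card : ∀ {m} → (Fin m → Bool) → ℕ
  card {m} A = ∑ (allFin m) (λ u → ⟦ A u ⟧)

  length-allFin : ∀ m → length (allFin m) ≡ m
  length-allFin m = length-tabulate {n = m} (λ u → u)

  -- Averaging: the sizes of at most k P classes sum to at least P · `card A`, so some class has at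
  -- least `card A` / k vertices. Only A has to be covered, which allows lists that ignore the rest
  -- of the subgraph.
  dense : ∀ {m} {E : Fin m → Fin m → Set} k p {A : Fin m → Bool} (L : List (Fin m → Bool)) →
          All (Stable E) L → length L ≤ k * suc p → (∀ u → A u ≡ true → suc p ≤ depth L u) →
          ∃ λ J → Stable E J × card A ≤ k * card J
  dense {m} k p {A} L L-stable size covers = choose L L-stable total size
    where
    open ≤-Reasoning
    P = suc p

    weighted : ∀ u → P * ⟦ A u ⟧ ≤ depth L u
    weighted u with A u in Au
    ... | false = ≤-trans (≤-reflexive (*-zeroʳ P)) z≤n
    ... | true  = ≤-trans (≤-reflexive (*-identityʳ P)) (covers u Au)

    total : P * card A ≤ ∑ L card
    total = begin
      P * card A                              ≡⟨ *-distribˡ-∑ P (allFin m) _ ⟩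
      ∑ (allFin m) (λ u → P * ⟦ A u ⟧)        ≤⟨ ∑-mono (allFin m) weighted ⟩
      ∑ (allFin m) (depth L)                  ≡⟨ ∑-swap (allFin m) L (λ u J → ⟦ J u ⟧) ⟩
      ∑ L card                                ∎

    choose : ∀ L → All (Stable _) L → P * card A ≤ ∑ L card → length L ≤ k * P →
             ∃ λ J → Stable _ J × card A ≤ k * card J
    choose [] _ tot _ = (λ _ → false) , (λ _ _ ()) , ≤-trans
      (≤-reflexive (m*n≡0⇒m≡0 (card A) P (trans (*-comm (card A) P) (n≤0⇒n≡0 tot)))) z≤n
    choose L@(J₀ ∷ L′) st tot sz =
      let J , J∈ , le = average≤max J₀ L′ (λ J → k * P * card J) (P * card A) (begin
            length L * (P * card A)            ≤⟨ *-mono-≤ sz tot ⟩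
            k * P * ∑ L card                   ≡⟨ *-distribˡ-∑ (k * P) L card ⟩
            ∑ L (λ J → k * P * card J)         ∎)
      in J , All.lookup st J∈ , *-cancelˡ-≤ P (≤-trans le (≤-reflexive
           (trans (cong (_* card J) (*-comm k P)) (*-assoc P k (card J)))))

  injective-below : ∀ {m} (g : Fin m → ℕ) → (∀ {u v} → g u ≡ g v → u ≡ v) → ∀ B →
                    card (λ u → does (g u <? B)) ≤ B
  injective-below {m} g g-inj B = begin
    card (λ u → does (g u <? B))                                      ≤⟨ ∑-mono (allFin m) hit ⟩
    ∑ (allFin m) (λ u → ∑ (upTo B) (λ b → ⟦ does (g u ≟ b) ⟧))        ≡⟨ ∑-swap (allFin m) (upTo B) _ ⟩
    ∑ (upTo B) (λ b → ∑ (allFin m) (λ u → ⟦ does (g u ≟ b) ⟧))        ≤⟨ ∑-mono (upTo B) once ⟩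
    ∑ (upTo B) (λ _ → 1)                                              ≡⟨ trans (∑-const (upTo B) 1) (*-identityʳ _) ⟩
    length (upTo B)                                                   ≡⟨ length-upTo B ⟩
    B                                                                 ∎
    where
    open ≤-Reasoning
    once : ∀ b → ∑ (allFin m) (λ u → ⟦ does (g u ≟ b) ⟧) ≤ 1
    once b = ≤-trans (≤-reflexive (sym (∑-map g (allFin m) _)))
      (∑-δ≤1 _≟_ b (Unique.map⁺ g-inj (Unique.allFin⁺ m)))

    member : ∀ {c} {bs : List ℕ} → c ∈ bs → 1 ≤ ∑ bs (λ b → ⟦ does (c ≟ b) ⟧)
    member {c} (here refl) rewrite dec-true (c ≟ c) refl = s≤s z≤n
    member (there c∈) = ≤-trans (member c∈) (m≤n+m _ _)

    hit : ∀ u → ⟦ does (g u <? B) ⟧ ≤ ∑ (upTo B) (λ b → ⟦ does (g u ≟ b) ⟧)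
    hit u with g u <ᵇ B in u<B
    ... | false = z≤n
    ... | true  = member (∈-upTo⁺ (<ᵇ⇒< (g u) B (subst T (sym u<B) tt)))

  ∣tabulate∣ : ∀ {m} (J : Fin m → Bool) → ∣ tabulate J ∣ ≡ card J
  ∣tabulate∣ {zero}  J = refl
  ∣tabulate∣ {suc m} J = trans (cons (J zero)) (cong (⟦ J zero ⟧ +_)
    (trans (∣tabulate∣ (J ∘ suc)) (sym (shifted m (λ u → u)))))
    where
    cons : ∀ b → ∣ b Vec.∷ tabulate (J ∘ suc) ∣ ≡ ⟦ b ⟧ + ∣ tabulate (J ∘ suc) ∣
    cons true  = refl
    cons false = refl
    shifted : ∀ n (h : Fin n → Fin m) → ∑ (List.tabulate (suc ∘ h)) (λ u → ⟦ J u ⟧) ≡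
              ∑ (List.tabulate h) (λ u → ⟦ J (suc u) ⟧)
    shifted zero    h = refl
    shifted (suc n) h = cong (⟦ J (suc (h zero)) ⟧ +_) (shifted n (h ∘ suc))

  stable⇒card≤α : ∀ H {J : Fin (order H) → Bool} → Stable (Adj H) J → card J ≤ α H
  stable⇒card≤α H {J} s = subst (_≤ α H) (∣tabulate∣ J)
    (v≤max⁺ 0 _ (inj₂ (Any.map ≤-reflexive (∈-map⁺ ∣_∣
      (∈-filter⁺ (independent? H) (∈-subsets (tabulate J)) ind)))))
    where
    member : ∀ {u} → u Subset.∈ tabulate J → J u ≡ true
    member {u} u∈ = trans (sym (lookup∘tabulate J u)) ([]=⇒lookup u∈)

    ind : Independent H (tabulate J)
    ind u v u∈ v∈ = s u v (member u∈) (member v∈)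

  -- The blocks grow so fast that only one of them, the last one of which a subgraph
  -- contains more than s i vertices, needs more than locally bipartite behaviour.
  module Hall (F : Graph) (𝒢 : Fin (order F) → Graph) (s : Fin (order F) → ℕ) (N : ℕ)
    (F-upper : Colourable (Adj F) N) (𝒢-upper : ∀ i → Colourable (Adj (𝒢 i)) N)
    (local : ∀ i → LB (𝒢 i) (s i)) (before≤s : ∀ i → before 𝒢 i ≤ s i)
    {m : ℕ} (f : Fin m → Fin (order (Lexicographic.lex F 𝒢))) (f-inj : ∀ {u v} → f u ≡ f v → u ≡ v) where

    open Lexicographic F 𝒢

    private
      d : Fin m → Block 𝒢
      d u = block 𝒢 (f u)

      b : Fin m → Fin (order F)
      b u = proj₁ (d u)

      E : Fin m → Fin m → Set
      E u v = LexAdj (d u) (d v)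

      pick : ∀ i → Block 𝒢 → Maybe (Fin (order (𝒢 i)))
      pick i (j , w) with j Fin.≟ i
      ... | yes refl = just w
      ... | no  _    = nothing

      pick-just : ∀ {i x w} → pick i x ≡ just w → x ≡ (i , w)
      pick-just {i} {j , v} eq with j Fin.≟ i
      pick-just {i} {.i , v} refl | yes refl = refl

      pick-≡ : ∀ i w → pick i (i , w) ≡ just w
      pick-≡ i w with i Fin.≟ i
      ... | yes refl = refl
      ... | no  i≢i  = contradiction refl i≢i

      inBlock : Fin (order F) → Fin m → Bool
      inBlock i u = does (b u Fin.≟ i)

      length-pick : ∀ i us → length (mapMaybe (pick i) (map d us)) ≡ ∑ us (λ u → ⟦ inBlock i u ⟧)
      length-pick i [] = refl
      length-pick i (u ∷ us) with proj₁ (d u) Fin.≟ i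
      ... | yes refl = cong suc (length-pick i us)
      ... | no  _    = length-pick i us

      Large : ℕ → (Fin m → Bool) → Set
      Large k A = ∃ λ J → Stable E J × card A ≤ k * card J

      blockLarge : ∀ i → Large N (inBlock i)
      blockLarge i = dense N (proj₁ (𝒢-upper i)) (map lift (classes c))
        (All.map⁺ (All.map lift-stable (stable c)))
        (≤-trans (≤-reflexive (length-map lift (classes c))) (size c))
        covers′
        where
        c = proj₂ (𝒢-upper i)

        lift : (Fin (order (𝒢 i)) → Bool) → Fin m → Bool
        lift J u = maybe′ J false (pick i (d u))

        lift⁻ : ∀ {J} u → lift J u ≡ true → ∃ λ w → d u ≡ (i , w) × J w ≡ true
        lift⁻ u u∈ with pick i (d u) in eq
        ... | just w = w , pick-just eq , u∈

        lift-stable : ∀ {J} → Stable (Adj (𝒢 i)) J → Stable E (lift J)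
        lift-stable {J} st u v u∈ v∈ e with lift⁻ {J} u u∈ | lift⁻ {J} v v∈
        ... | w , du , w∈ | x , dv , x∈ = st w x w∈ x∈ (lexAdj-inner (subst₂ LexAdj du dv e))

        covers′ : ∀ u → inBlock i u ≡ true → suc (proj₁ (𝒢-upper i)) ≤ depth (map lift (classes c)) u
        covers′ u u∈ with b u Fin.≟ i
        ... | yes refl = begin
          suc (proj₁ (𝒢-upper i))             ≤⟨ covers c (proj₂ (d u)) ⟩
          depth (classes c) (proj₂ (d u))     ≡⟨ ∑-cong (classes c) (λ J → cong (λ x → ⟦ maybe′ J false x ⟧)
                                                   (sym (pick-≡ i (proj₂ (d u))))) ⟩
          ∑ (classes c) (λ J → ⟦ lift J u ⟧)  ≡⟨ sym (∑-map lift (classes c) (λ J → ⟦ J u ⟧)) ⟩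
          depth (map lift (classes c)) u      ∎
          where open ≤-Reasoning

      from : ℕ → Fin m → Bool
      from t u = does (t ≤? toℕ (b u))

      Small : ℕ → Set
      Small t = ∀ i → t ≤ toℕ i → card (inBlock i) ≤ s i

      -- Every block from t on meets the subgraph in a bipartite graph. A class of F therefore
      -- splits into two stable sets of the subgraph, one for each colour, used simultaneously in
      -- all blocks of the class. The number of classes doubles and the multiplicity stays.
      upperLarge : ∀ t → Small t → Large (2 * N) (from t)
      upperLarge t small = dense (2 * N) p (concatMap halves (classes c))
        (All.concat⁺ (All.map⁺ (All.map (λ st → half-stable st ∷ half-stable st ∷ []) (stable c))))
        (begin
          length (concatMap halves (classes c))      ≡⟨ length-concatMap halves (classes c) ⟩
          ∑ (classes c) (λ _ → 2)                    ≡⟨ ∑-const (classes c) 2 ⟩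
          length (classes c) * 2                     ≤⟨ *-monoˡ-≤ 2 (size c) ⟩
          N * suc p * 2                              ≡⟨ trans (*-comm (N * suc p) 2) (sym (*-assoc 2 N (suc p))) ⟩
          2 * N * suc p                              ∎)
        (λ u u∈ → begin
          suc p                                      ≤⟨ covers c (b u) ⟩
          depth (classes c) (b u)                    ≡⟨ ∑-cong (classes c) (λ J → sym (both J u u∈)) ⟩
          ∑ (classes c) (λ J → depth (halves J) u)   ≡⟨ sym (∑-concatMap halves (classes c) (λ J → ⟦ J u ⟧)) ⟩
          depth (concatMap halves (classes c)) u     ∎)
        where
        open ≤-Reasoning
        p = proj₁ F-upper
        c = proj₂ F-upper

        members : ∀ i → List (Fin (order (𝒢 i)))
        members i = mapMaybe (pick i) (map d (allFin m))

        member : ∀ u → proj₂ (d u) ∈ members (b u)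
        member u = ∈-mapMaybe (pick (b u)) (∈-map⁺ d (∈-allFin u)) (pick-≡ (b u) (proj₂ (d u)))

        side : ∀ i → t ≤ toℕ i → ∃ λ (κ : Fin (order (𝒢 i)) → Bool) → ∀ v w → v ∈ members i →
               w ∈ members i → Adj (𝒢 i) v w → κ v ≢ κ w
        side i t≤i = local i (members i) (≤-trans (≤-reflexive (length-pick i (allFin m))) (small i t≤i))

        -- Blocks before t get a default colour; the factor `upper` removes them from both halves.
        κ : Block 𝒢 → Bool
        κ (i , w) with t ≤? toℕ i
        ... | yes t≤i = proj₁ (side i t≤i) w
        ... | no  _   = false

        κ-proper : ∀ {i v w} → t ≤ toℕ i → v ∈ members i → w ∈ members i →
                   Adj (𝒢 i) v w → κ (i , v) ≢ κ (i , w)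
        κ-proper {i} {v} {w} t≤i v∈ w∈ e with t ≤? toℕ i
        ... | yes t≤i′ = proj₂ (side i t≤i′) v w v∈ w∈ e
        ... | no  t≰i  = contradiction t≤i t≰i

        upper : Block 𝒢 → Bool
        upper (i , _) = does (t ≤? toℕ i)

        half : (Fin (order F) → Bool) → Bool → Block 𝒢 → Bool
        half J ε x = J (proj₁ x) ∧ (upper x ∧ does (κ x Bool.≟ ε))

        half⁻ : ∀ J ε x → half J ε x ≡ true → J (proj₁ x) ≡ true × t ≤ toℕ (proj₁ x) × κ x ≡ ε
        half⁻ J ε x x∈ =
          let J∈ , rest = ∧-true {J (proj₁ x)} x∈
              t≤ , κ≡ = ∧-true {upper x} rest
          in J∈ , ≤ᵇ⇒≤ t (toℕ (proj₁ x)) (subst T (sym t≤) tt) , decided (κ x Bool.≟ ε) κ≡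
          where
          decided : ∀ {A : Set} (a? : Dec A) → does a? ≡ true → A
          decided (yes a) _ = a

        halves : (Fin (order F) → Bool) → List (Fin m → Bool)
        halves J = half J true ∘ d ∷ half J false ∘ d ∷ []

        both : ∀ J u → from t u ≡ true → depth (halves J) u ≡ ⟦ J (b u) ⟧
        both J u u∈ = split (J (b u)) (κ (d u)) u∈
          where
          split : ∀ j {a} k → a ≡ true → ⟦ j ∧ (a ∧ does (k Bool.≟ true)) ⟧ +
                  (⟦ j ∧ (a ∧ does (k Bool.≟ false)) ⟧ + 0) ≡ ⟦ j ⟧
          split false _     _    = refl
          split true  true  refl = refl
          split true  false refl = refl

        half-stable : ∀ {J ε} → Stable (Adj F) J → Stable E (half J ε ∘ d)
        half-stable {J} {ε} st u v u∈ v∈ e = apart (d u) (d v) (member u) (member v)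
          (half⁻ J ε (d u) u∈) (half⁻ J ε (d v) v∈) e
          where
          Member : Block 𝒢 → Set
          Member x = J (proj₁ x) ≡ true × t ≤ toℕ (proj₁ x) × κ x ≡ ε

          apart : ∀ x y → proj₂ x ∈ members (proj₁ x) → proj₂ y ∈ members (proj₁ y) →
                  Member x → Member y → ¬ LexAdj x y
          apart (i , _) (j , _) _ _ (i∈ , _) (j∈ , _) (outer e) = st i j i∈ j∈ e
          apart _ _ v∈ w∈ (_ , t≤ , κv) (_ , _ , κw) (inner e) = κ-proper t≤ v∈ w∈ e (trans κv (sym κw))

      lower : ℕ → Fin m → Bool
      lower t u = does (toℕ (b u) <? t)

      lowerSmall : ∀ i → card (lower (toℕ i)) ≤ before 𝒢 i
      lowerSmall i = ≤-trans (∑-mono (allFin m) numbered)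
        (injective-below (toℕ ∘ f) (f-inj ∘ toℕ-injective) (before 𝒢 i))
        where
        numbered : ∀ u → ⟦ lower (toℕ i) u ⟧ ≤ ⟦ does (toℕ (f u) <? before 𝒢 i) ⟧
        numbered u with toℕ (b u) <ᵇ toℕ i in lt
        ... | false = z≤n
        ... | true rewrite dec-true (toℕ (f u) <? before 𝒢 i)
                     (block-before 𝒢 i (f u) (<ᵇ⇒< (toℕ (b u)) (toℕ i) (subst T (sym lt) tt))) = ≤-refl

      trichotomy : ∀ i → m ≤ card (lower (toℕ i)) + card (inBlock i) + card (from (suc (toℕ i)))
      trichotomy i = begin
        m                                              ≡⟨ sym (trans (∑-const (allFin m) 1)
                                                            (trans (*-identityʳ _) (length-allFin m))) ⟩
        ∑ (allFin m) (λ _ → 1)                         ≤⟨ ∑-mono (allFin m) one ⟩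
        ∑ (allFin m) (λ u → (⟦ lower (toℕ i) u ⟧ + ⟦ inBlock i u ⟧) + ⟦ from (suc (toℕ i)) u ⟧)
                                                       ≡⟨ trans (∑-distrib-+ (allFin m) _ _)
                                                            (cong (_+ card (from (suc (toℕ i)))) (∑-distrib-+ (allFin m) _ _)) ⟩
        card (lower (toℕ i)) + card (inBlock i) + card (from (suc (toℕ i))) ∎
        where
        open ≤-Reasoning
        one : ∀ u → 1 ≤ (⟦ lower (toℕ i) u ⟧ + ⟦ inBlock i u ⟧) + ⟦ from (suc (toℕ i)) u ⟧
        one u with <-cmp (toℕ (b u)) (toℕ i)
        ... | tri< lt _ _ rewrite dec-true (toℕ (b u) <? toℕ i) lt = s≤s z≤n
        ... | tri≈ _ eq _ rewrite dec-true (b u Fin.≟ i) (toℕ-injective eq) =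
          ≤-trans (m≤n+m 1 ⟦ lower (toℕ i) u ⟧) (m≤m+n _ _)
        ... | tri> _ _ gt rewrite dec-true (suc (toℕ i) ≤? toℕ (b u)) gt = m≤n+m 1 _

      Dense : Set
      Dense = ∃ λ J → Stable E J × m ≤ 4 * N * card J

      -- Here x is a large block and y the union of the later ones. The first `card x` stands for
      -- the earlier blocks, which together have no more vertices than x. Thus 4 = 1 + 1 + 2.
      combined : ∀ {x y : Fin m → Bool} c → card x ≤ N * c → card y ≤ 2 * N * c →
                 m ≤ card x + card x + card y → m ≤ 4 * N * c
      combined c x≤ y≤ m≤ = ≤-trans m≤ (≤-trans (+-mono-≤ (+-mono-≤ x≤ x≤) y≤) (≤-reflexive
        (solve 2 (λ N c → N :* c :+ N :* c :+ con 2 :* N :* c := con 4 :* N :* c) refl N c)))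
        where open +-*-Solver

      larger : ∀ {x y} → Large N x → Large (2 * N) y → m ≤ card x + card x + card y → Dense
      larger {x} {y} (J , sJ , x≤) (K , sK , y≤) m≤ with ≤-total (card J) (card K)
      ... | inj₁ J≤K = K , sK , combined {x} {y} (card K) (≤-trans x≤ (*-monoʳ-≤ N J≤K)) y≤ m≤
      ... | inj₂ K≤J = J , sJ , combined {x} {y} (card J) x≤ (≤-trans y≤ (*-monoʳ-≤ (2 * N) K≤J)) m≤

      -- The search runs down from the last block, with all blocks from t on known to be small. At
      -- the first block i exceeding `s i`, the earlier blocks contain at most `before 𝒢 i` ≤ `s i`
      -- vertices, fewer than block i does. If none exceeds its bound, the factor 2 N suffices for
      -- the whole subgraph.
      search : ∀ t → t ≤ order F → Small t → Dense
      search zero _ small =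
        let J , sJ , le = upperLarge 0 small in J , sJ , (begin
          m                    ≡⟨ sym (trans (∑-const (allFin m) 1) (trans (*-identityʳ _) (length-allFin m))) ⟩
          card (from 0)        ≤⟨ le ⟩
          2 * N * card J       ≤⟨ *-monoˡ-≤ (card J) (*-monoˡ-≤ N (s≤s (s≤s (z≤n {2})))) ⟩
          4 * N * card J       ∎)
        where open ≤-Reasoning
      search (suc t) t<k small with card (inBlock (fromℕ< t<k)) ≤? s (fromℕ< t<k)
      ... | yes le = search t (<⇒≤ t<k) extended
        where
        extended : Small t
        extended j t≤j with t ≟ toℕ j
        ... | yes refl = subst (λ i → card (inBlock i) ≤ s i)
                           (toℕ-injective (toℕ-fromℕ< t<k)) le
        ... | no  t≢j  = small j (≤∧≢⇒< t≤j t≢j)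
      ... | no  ≰  = larger (blockLarge i) (upperLarge (suc (toℕ i)) (subst (Small ∘ suc) (sym (toℕ-fromℕ< t<k)) small))
          (≤-trans (trichotomy i) (+-monoˡ-≤ _ (+-monoˡ-≤ _
            (≤-trans (lowerSmall i) (≤-trans (before≤s i) (<⇒≤ (≰⇒> ≰)))))))
        where i = fromℕ< t<k

    large-stable-set : ∃ λ J → Stable E J × m ≤ 4 * N * card J
    large-stable-set = search (order F) ≤-refl λ i k≤i → contradiction (toℕ<n i) (≤⇒≯ k≤i)

-- Assembly of the extremal graphs

module ExtremalGraphs where

  open ListSums
  open Colourings
  open Cones
  open Towers
  open LexicographicSums
  open LargeStableSets
  open import Defs using (Graph; Adj; order; CliqueFree)
  open import Data.Fin.Base using (Fin; zero; suc)
  open import Data.Nat.Base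
  open import Data.Nat.Properties

  -- An injection f stands for the subgraph induced on its image, so `hall` amounts to ρ ≤ 4 (M +
  -- 1), while `lower` is χ_f > M².
  record Extremal (M : ℕ) : Set₁ where
    field
      graph   : Graph
      K₅-free : CliqueFree 5 graph
      lower   : ¬ Colourable (Adj graph) (M * M)
      hall    : ∀ {m} (f : Fin m → Fin (order graph)) → (∀ {u v} → f u ≡ f v → u ≡ v) →
                ∃ λ J → Stable (λ u v → Adj graph (f u) (f v)) J × m ≤ 4 * suc M * card J

  module _ (M-1 : ℕ) where

    open Between

    private
      M = suc M-1

    -- The accumulator s is the initial value plus the orders of the blocks chosen so far, so each
    -- block is bipartite on that many vertices. The initial value 3 used in `extremal` makes the
    -- first block triangle-free too.
    family : ∀ k → ℕ → Fin k → Graph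
    family (suc k) s zero    = graph (between s M-1)
    family (suc k) s (suc i) = family k (s + order (graph (between s M-1))) i

    family-local : ∀ k s i → LB (family k s i) (s + before (family k s) i)
    family-local (suc k) s zero    =
      subst (LB (graph (between s M-1))) (sym (+-identityʳ s)) (local (between s M-1))
    family-local (suc k) s (suc i) =
      subst (LB (family (suc k) s (suc i))) (+-assoc s _ _) (family-local k _ i)

    family-upper : ∀ k s i → Colourable (Adj (family k s i)) (suc M)
    family-upper (suc k) s zero    = upper (between s M-1)
    family-upper (suc k) s (suc i) = family-upper k _ i

    family-lower : ∀ k s i → ¬ Colourable (Adj (family k s i)) M
    family-lower (suc k) s zero    = lower (between s M-1)
    family-lower (suc k) s (suc i) = family-lower k _ i

    LB-mono : ∀ {G s t} → s ≤ t → LB G t → LB G s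
    LB-mono s≤t bip xs short = bip xs (≤-trans short s≤t)

    extremal : Extremal M
    extremal = record
      { graph   = lex
      ; K₅-free = lex-K₅-free ≤-refl (local F) (λ i → LB-mono {𝒢 i} (m≤m+n 3 _) (family-local k 3 i))
      ; lower   = lex-lower {M-1} (lower F) (family-lower k 3)
      ; hall    = λ f → Hall.large-stable-set (graph F) 𝒢 (λ i → 3 + before 𝒢 i) (suc M)
                          (upper F) (family-upper k 3) (family-local k 3) (λ i → m≤n+m _ 3) f
      }
      where
      F = between 3 M-1
      k = order (graph F)
      𝒢 = family k 3
      open Lexicographic (graph F) 𝒢

-- Hall ratios and real values

module HallRatios where

  open ListSums
  open NaturalsInℚ
  open Colourings
  open LargeStableSets using (card; stable⇒card≤α)
  open import Defs
    using (Graph; Adj; adj?; symm; irrefl; order; independent?; ∈-subsets; subsets; α;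
           α-nonZero; vertexIndependenceRatio; SubgraphRatio; IsHallRatio; _⊆ᴳ_; seq; fromℚ)
  import Defs as D
  open import Data.Fin.Base using (Fin; zero; suc)
  open import Data.Fin.Properties using (all?; injective⇒≤)
  import Data.Fin.Properties as Fin
  open import Data.Integer.Base using (+_)
  import Data.List.Extrema
  open import Data.List.Extrema.Nat using (v≤max⁺; max≤v⁺)
  open import Data.List.Membership.Propositional using (_∈_)
  open import Data.List.Membership.Propositional.Properties
    using (∈-map⁺; ∈-cartesianProductWith⁺; ∈-allFin; ∈-concatMap⁺; ∈-filter⁺; ∈-filter⁻;
           ∈-upTo⁺)
  import Data.List.Relation.Unary.All as All
  import Data.List.Relation.Unary.All.Properties as All
  import Data.List.Relation.Unary.Any as Any
  open import Data.Nat.Base as ℕ using (ℕ; suc; zero; pred)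
  import Data.Nat.Properties as ℕ
  open import Data.Rational.Base as ℚ using (ℚ; _/_)
  import Data.Rational.Properties as ℚ
  open import Data.Vec.Base using (Vec; []; _∷_; lookup; tabulate)
  open import Data.Vec.Properties using (lookup∘tabulate)
  open import Relation.Binary.Bundles using (DecTotalOrder)
  open import Relation.Nullary.Decidable using (_×-dec_; _→-dec_)

  open Data.List.Extrema (DecTotalOrder.totalOrder ℚ.≤-decTotalOrder) using (argmax; f[xs]≤f[argmax]; argmax-all)

  ≤⇒≤ℝ : ∀ x y → (∃ λ N → ∀ n → N ℕ.≤ n → seq x n ℚ.≤ seq y n) → x D.≤ y
  ≤⇒≤ℝ x y (N , le) ε 0<ε = N , λ n N≤n → ℚ.≤-trans (le n N≤n)
    (subst (ℚ._≤ seq y n ℚ.+ ε) (ℚ.+-identityʳ (seq y n)) (ℚ.+-monoʳ-≤ (seq y n) (ℚ.<⇒≤ 0<ε)))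

  fromℚ-mono : ∀ {p q} → p ℚ.≤ q → fromℚ p D.≤ fromℚ q
  fromℚ-mono {p} {q} p≤q = ≤⇒≤ℝ (fromℚ p) (fromℚ q) (0 , λ _ _ → p≤q)

  vecs : ∀ n m → List (Vec (Fin n) m)
  vecs n zero    = [] ∷ []
  vecs n (suc m) = cartesianProductWith _∷_ (allFin n) (vecs n m)

  ∈-vecs : ∀ {n m} (v : Vec (Fin n) m) → v ∈ vecs n m
  ∈-vecs []      = here refl
  ∈-vecs (x ∷ v) = ∈-cartesianProductWith⁺ _∷_ (∈-allFin x) (∈-vecs v)

  α-antimono : ∀ {H K} (eq : order H ≡ order K) →
               (∀ {u v} → Adj H u v → Adj K (subst Fin eq u) (subst Fin eq v)) → α K ℕ.≤ α H
  α-antimono {H} {record { order = _ ; Adj = E ; adj? = E? ; symm = sy ; irrefl = ir }} refl hom =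
    max≤v⁺ ℕ.z≤n (All.map⁺ (All.tabulate λ {I} I∈ →
      v≤max⁺ 0 _ (inj₂ (Any.map ℕ.≤-reflexive (∈-map⁺ _ (∈-filter⁺ (independent? H) (∈-subsets I)
        (λ u v u∈ v∈ e → proj₂ (∈-filter⁻ (independent? K) {xs = subsets (order K)} I∈) u v u∈ v∈ (hom e))))))))
    where K = record { order = _ ; Adj = E ; adj? = E? ; symm = sy ; irrefl = ir }

  module HallRatio (G : Graph) where

    private
      n = order G

    -- Repetition-free vectors of vertices name the induced subgraphs, with an ordering of their
    -- vertices. Their length is at most n, so finitely many candidates remain and the maximum is
    -- attained.
    Sub : Set
    Sub = Σ ℕ (Vec (Fin n))

    induced : Sub → Graph
    induced (m , v) = record
      { order  = m
      ; Adj    = λ a b → Adj G (lookup v a) (lookup v b)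
      ; adj?   = λ a b → adj? G (lookup v a) (lookup v b)
      ; symm   = symm G
      ; irrefl = λ a → irrefl G (lookup v a)
      }

    Proper : Sub → Set
    Proper (m , v) = ℕ.NonZero m × (∀ a b → lookup v a ≡ lookup v b → a ≡ b)

    private
      proper? : ∀ S → Dec (Proper S)
      proper? (m , v) = ℕ.nonZero? m ×-dec
        all? λ a → all? λ b → (lookup v a Fin.≟ lookup v b) →-dec (a Fin.≟ b)

      -- The independence ratio, made total: α is positive on nonempty graphs.
      ratio : Sub → ℚ
      ratio S = + proj₁ S / suc (pred (α (induced S)))

      candidates : List Sub
      candidates = filter proper? (concatMap (λ m → map (m ,_) (vecs n m)) (upTo (suc n)))

      ∈-candidates : ∀ S → Proper S → S ∈ candidates
      ∈-candidates S@(m , v) S-proper@(_ , inj) = ∈-filter⁺ proper?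
        (∈-concatMap⁺ (λ m → map (m ,_) (vecs n m)) (Any.map (λ { refl → ∈-map⁺ (m ,_) (∈-vecs v) })
          (∈-upTo⁺ (ℕ.s≤s (injective⇒≤ (λ {a} {b} → inj a b))))))
        S-proper

      ratio-correct : ∀ S (nz : ℕ.NonZero (proj₁ S)) →
                      vertexIndependenceRatio (induced S) {{nz}} ≡ ratio S
      ratio-correct S nz = /-cong (sym (ℕ.suc-pred (α (induced S))))
        where
        instance
          _ = nz
          _ = α-nonZero (induced S)
        /-cong : ∀ {a b} .{{_ : ℕ.NonZero a}} .{{_ : ℕ.NonZero b}} → a ≡ b → + proj₁ S / a ≡ + proj₁ S / b
        /-cong refl = refl

      -- Filling in the missing edges of G on the same vertices can only lower α, hence only raise
      -- the ratio. So induced subgraphs realise the maximum.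
      subgraph-ratio : ∀ H (nz : ℕ.NonZero (order H)) → H ⊆ᴳ G →
        ∃ λ S → Proper S × vertexIndependenceRatio H {{nz}} ℚ.≤ ratio S
      subgraph-ratio H nz H⊆G = S , (nz , inj)
        , ℚ.≤-trans (/-mono-≤ (order H) (α-antimono {H} {induced S} refl adj)) (ℚ.≤-reflexive (ratio-correct S nz))
        where
        open _⊆ᴳ_ H⊆G
        instance
          _ = nz
          _ = α-nonZero H
        S : Sub
        S = order H , tabulate vertex
        instance _ = α-nonZero (induced S)
        inj : ∀ a b → lookup (tabulate vertex) a ≡ lookup (tabulate vertex) b → a ≡ b
        inj a b eq = injective (trans (sym (lookup∘tabulate vertex a)) (trans eq (lookup∘tabulate vertex b)))
        adj : ∀ {a b} → Adj H a b → Adj G (lookup (tabulate vertex) a) (lookup (tabulate vertex) b)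
        adj {a} {b} e = subst₂ (Adj G) (sym (lookup∘tabulate vertex a)) (sym (lookup∘tabulate vertex b)) (edge e)

      abstract
        densest : Fin n → ∃ λ best → Proper best × (∀ S → Proper S → ratio S ℚ.≤ ratio best)
        densest v₀ = argmax ratio point candidates
          , argmax-all ratio {P = Proper} {point} {candidates} point-proper
              (All.all-filter proper? (concatMap (λ m → map (m ,_) (vecs n m)) (upTo (suc n))))
          , λ S S-proper → All.lookup (f[xs]≤f[argmax] {f = ratio} point candidates) (∈-candidates S S-proper)
          where
          -- A single vertex is the default of `argmax`, so that the maximiser is a nonempty
          -- subgraph.
          point : Sub
          point = 1 , v₀ ∷ []

          point-proper : Proper point
          point-proper = _ , λ { zero zero _ → refl }

    hallRatio : Fin n → ∀ k →
      (∀ {m} (f : Fin m → Fin n) → (∀ {u v} → f u ≡ f v → u ≡ v) →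
        ∃ λ J → Stable (λ u v → Adj G (f u) (f v)) J × m ℕ.≤ k ℕ.* card J) →
      ∃ λ ρ → IsHallRatio G (fromℚ ρ) × ρ ℚ.≤ cast k
    hallRatio v₀ k dense = ratio best , ((induced best , nz , best⊆G , attained , attained′) , maximal) , bounded
      where
      best : Sub
      best = proj₁ (densest v₀)

      best-proper : Proper best
      best-proper = proj₁ (proj₂ (densest v₀))

      best-ratio : ∀ S → Proper S → ratio S ℚ.≤ ratio best
      best-ratio = proj₂ (proj₂ (densest v₀))

      nz : ℕ.NonZero (proj₁ best)
      nz = proj₁ best-proper

      best⊆G : induced best ⊆ᴳ G
      best⊆G = record { vertex = lookup (proj₂ best) ; injective = λ {a} {b} → proj₂ best-proper a b ; edge = λ e → e }

      attained : fromℚ (ratio best) D.≤ fromℚ (vertexIndependenceRatio (induced best) {{nz}})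
      attained = fromℚ-mono (ℚ.≤-reflexive (sym (ratio-correct best nz)))

      attained′ : fromℚ (vertexIndependenceRatio (induced best) {{nz}}) D.≤ fromℚ (ratio best)
      attained′ = fromℚ-mono (ℚ.≤-reflexive (ratio-correct best nz))

      maximal : ∀ x → SubgraphRatio G x → x D.≤ fromℚ (ratio best)
      maximal x (H , nzH , H⊆G , x≤ , _) ε 0<ε =
        let N , le = x≤ ε 0<ε
            S , S-proper , ≤S = subgraph-ratio H nzH H⊆G
        in N , λ n N≤n → ℚ.≤-trans (le n N≤n) (ℚ.+-monoˡ-≤ ε (ℚ.≤-trans ≤S (best-ratio S S-proper)))

      bounded : ratio best ℚ.≤ cast k
      bounded =
        let J , stable , m≤ = dense (lookup (proj₂ best)) (λ {a} {b} → proj₂ best-proper a b)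
        in /-≤-cast (proj₁ best) (suc (pred (α (induced best)))) k (ℕ.≤-trans m≤ (ℕ.*-monoʳ-≤ k
             (ℕ.≤-trans (stable⇒card≤α (induced best) stable) (ℕ.≤-reflexive (sym (ℕ.suc-pred (α (induced best)) {{α-nonZero (induced best) {{nz}}}}))))))

-- The rational optimum among real fractional colourings

module RealValues where

  open ListSums
  open LinearProgramming
  open NaturalsInℚ
  open FractionalChromatic
  open HallRatios
  open import Defs
    using (Graph; order; Independent; independentSets; ℝ; seq; fromℚ; total;
           IsFractionalColouring; FractionalColouringValue; IsFractionalChromaticNumber)
  import Defs as D
  open import Data.Fin.Subset using (Subset)
  open import Data.Integer.Base using (+_)
  import Data.List.Membership.Propositional as List
  open import Data.List.Membership.Propositional.Properties using (∈-allFin)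
  import Data.List.Relation.Unary.All as All
  open import Data.Nat.Base as ℕ using (ℕ; suc)
  import Data.Nat.Properties as ℕ
  open import Data.Rational.Base
  open import Data.Rational.Properties
  open import Data.Rational.Solver using (module +-*-Solver)

  eventually-all : ∀ {A : Set} {P : A → ℕ → Set} {xs} →
    All (λ a → ∃ λ N → ∀ n → N ℕ.≤ n → P a n) xs → ∃ λ N → ∀ n → N ℕ.≤ n → All (λ a → P a n) xs
  eventually-all []              = 0 , λ _ _ → []
  eventually-all ((M , p) ∷ ps) =
    let N , q = eventually-all ps
    in M ℕ.⊔ N , λ n ≤n → p n (ℕ.m⊔n≤o⇒m≤o M N ≤n) ∷ q n (ℕ.m⊔n≤o⇒n≤o M N ≤n)

  ∑ℚ-const : ∀ {A : Set} (xs : List A) δ → ∑ℚ xs (λ _ → δ) ≡ cast (length xs) * δ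
  ∑ℚ-const []       δ = sym (*-zeroˡ δ)
  ∑ℚ-const (x ∷ xs) δ = begin
    δ + ∑ℚ xs (λ _ → δ)            ≡⟨ cong₂ _+_ (sym (*-identityˡ δ)) (∑ℚ-const xs δ) ⟩
    1ℚ * δ + cast (length xs) * δ  ≡⟨ sym (*-distribʳ-+ δ 1ℚ (cast (length xs))) ⟩
    (1ℚ + cast (length xs)) * δ    ≡⟨ cong (_* δ) (sym (cast-+ 1 (length xs))) ⟩
    cast (suc (length xs)) * δ     ∎
    where open ≡-Reasoning

  seq-total : ∀ G x Js n → seq (total G x Js) n ≡ ∑ℚ Js (λ I → seq (x I) n)
  seq-total G x []       n = refl
  seq-total G x (I ∷ Js) n = cong (λ s → seq (x I) n + s) (seq-total G x Js n)

  module _ (G : Graph) where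

    open FractionalColourings G

    private
      Is = independentSets G

      module _ (x : Subset (order G) → ℝ) (x-colouring : IsFractionalColouring G x)
               (δ : ℚ) (0<δ : 0ℚ < δ) where

        -- Real inequalities hold at a late index only up to δ. Adding δ to every weight repairs
        -- nonnegativity, and also covering because the singleton of a vertex is among the sets
        -- containing it. Each late index thus yields an exact rational fractional colouring.
        perturbed : ∃ λ N → ∀ n → N ℕ.≤ n → Fractional (λ I → seq (x I) n + δ)
        perturbed =
          let M , nonneg = eventually-all {xs = Is} (All.tabulate λ {I} I∈ → proj₁ x-colouring I (∈-Is⁻ I∈) δ 0<δ)
              N , covers = eventually-all {xs = allFin (order G)} (All.tabulate λ {v} _ → proj₂ x-colouring v δ 0<δ)
          in M ℕ.⊔ N , λ n ≤n → mkFractional (nonneg n (ℕ.m⊔n≤o⇒m≤o M N ≤n))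
               λ v → cover n v (All.lookup (covers n (ℕ.m⊔n≤o⇒n≤o M N ≤n)) (∈-allFin v))
          where
          open ≤-Reasoning
          1≤length : ∀ {A : Set} {a : A} {as} → a List.∈ as → 1 ℕ.≤ length as
          1≤length (here _)  = ℕ.s≤s ℕ.z≤n
          1≤length (there _) = ℕ.s≤s ℕ.z≤n

          cover : ∀ n v → 1ℚ ≤ seq (total G x (at v)) n + δ → 1ℚ ≤ ∑ℚ (at v) (λ I → seq (x I) n + δ)
          cover n v 1≤ = begin
            1ℚ                                                ≤⟨ 1≤ ⟩
            seq (total G x (at v)) n + δ                      ≡⟨ cong₂ _+_ (seq-total G x (at v) n) (sym (*-identityˡ δ)) ⟩
            ∑ℚ (at v) (λ I → seq (x I) n) + 1ℚ * δ            ≤⟨ +-monoʳ-≤ (∑ℚ (at v) (λ I → seq (x I) n))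
                                                                   (*-monoʳ-≤-nonNeg δ {{nonNegative (<⇒≤ 0<δ)}}
                                                                     (cast-mono (1≤length (singleton∈at v)))) ⟩
            ∑ℚ (at v) (λ I → seq (x I) n) + cast (length (at v)) * δ
                                                              ≡⟨ cong (λ s → ∑ℚ (at v) (λ I → seq (x I) n) + s) (sym (∑ℚ-const (at v) δ)) ⟩
            ∑ℚ (at v) (λ I → seq (x I) n) + ∑ℚ (at v) (λ _ → δ)
                                                              ≡⟨ sym (ℚ-sum.∑-distrib-+ (at v) _ _) ⟩
            ∑ℚ (at v) (λ I → seq (x I) n + δ)                 ∎

    fractionalChromaticNumber : IsFractionalChromaticNumber G (fromℚ χ)
    fractionalChromaticNumber = (x* , (nonneg , covers) , fromTo) , minimal
      where
      x : Subset (order G) → ℚ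
      x = proj₁ optimum

      x-fractional : Fractional x
      x-fractional = proj₁ (proj₂ optimum)

      x* : Subset (order G) → ℝ
      x* I = fromℚ (x I)

      nonneg : ∀ I → Independent G I → D.0ℝ D.≤ x* I
      nonneg I ind = fromℚ-mono (All.lookup (Fractional.nonneg x-fractional) (∈-Is⁺ ind))

      covers : ∀ v → D.1ℝ D.≤ total G x* (at v)
      covers v = ≤⇒≤ℝ D.1ℝ (total G x* (at v)) (0 , λ n _ →
        subst (1ℚ ≤_) (sym (seq-total G x* (at v) n)) (Fractional.covers x-fractional v))

      fromTo : fromℚ χ D.≃ total G x* Is
      fromTo = ≤⇒≤ℝ (fromℚ χ) (total G x* Is) (0 , λ n _ → ≤-reflexive (sym (seq-total G x* Is n)))
             , ≤⇒≤ℝ (total G x* Is) (fromℚ χ) (0 , λ n _ → ≤-reflexive (seq-total G x* Is n))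

      minimal : ∀ r → FractionalColouringValue G r → fromℚ χ D.≤ r
      minimal r (y , y-colouring , _ , total≤r) ε 0<ε =
        let c , 0<c , c*l≡1 = recip {cast (suc (length Is))} (positive⁻¹ _)
            -- With c the reciprocal of `length Is` + 1, the `length Is` perturbations and the δ
            -- lost in comparing the total with r add up to ε.
            δ = ε * c
            0<δ = subst (_< δ) (*-zeroʳ ε) (*-monoʳ-<-pos ε {{positive 0<ε}} 0<c)
            M , fractional = perturbed y y-colouring δ 0<δ
            N , close = total≤r δ 0<δ
        in M ℕ.⊔ N , λ n ≤n → begin
             χ                                                 ≤⟨ proj₂ (proj₂ optimum) _ (fractional n (ℕ.m⊔n≤o⇒m≤o M N ≤n)) ⟩
             ∑ℚ Is (λ I → seq (y I) n + δ)                     ≡⟨ ℚ-sum.∑-distrib-+ Is _ _ ⟩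
             ∑ℚ Is (λ I → seq (y I) n) + ∑ℚ Is (λ _ → δ)       ≡⟨ cong₂ _+_ (sym (seq-total G y Is n)) (∑ℚ-const Is δ) ⟩
             seq (total G y Is) n + cast (length Is) * δ       ≤⟨ +-monoˡ-≤ (cast (length Is) * δ) (close n (ℕ.m⊔n≤o⇒n≤o M N ≤n)) ⟩
             seq r n + δ + cast (length Is) * δ                ≡⟨ +-assoc (seq r n) δ (cast (length Is) * δ) ⟩
             seq r n + (δ + cast (length Is) * δ)              ≡⟨ cong (λ s → seq r n + s) (sum≡ε c c*l≡1) ⟩
             seq r n + ε                                       ∎
        where
        open ≤-Reasoning
        l = cast (length Is)
        sum≡ε : ∀ c → c * cast (suc (length Is)) ≡ 1ℚ → ε * c + l * (ε * c) ≡ ε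
        sum≡ε c c*l≡1 = begin-equality
          ε * c + l * (ε * c)           ≡⟨ cong (_+ l * (ε * c)) (sym (*-identityˡ (ε * c))) ⟩
          1ℚ * (ε * c) + l * (ε * c)    ≡⟨ sym (*-distribʳ-+ (ε * c) 1ℚ l) ⟩
          (1ℚ + l) * (ε * c)            ≡⟨ solve 3 (λ s ε c → s :* (ε :* c) := ε :* (c :* s)) refl (1ℚ + l) ε c ⟩
          ε * (c * (1ℚ + l))            ≡⟨ cong (λ s → ε * (c * s)) (sym (cast-+ 1 (length Is))) ⟩
          ε * (c * cast (suc (length Is))) ≡⟨ cong (ε *_) c*l≡1 ⟩
          ε * 1ℚ                        ≡⟨ *-identityʳ ε ⟩
          ε                             ∎
          where open +-*-Solver

-- From real P to an integer parameter

module Conclusion where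

  open ListSums
  open LinearProgramming
  open NaturalsInℚ
  open Colourings
  open FractionalChromatic
  open ExtremalGraphs
  open HallRatios
  open RealValues
  open import Defs
    using (Graph; order; ℝ; seq; cauchy; fromℚ; CliqueFree; IsHallRatio;
           IsFractionalChromaticNumber)
  import Defs as D
  open import Data.Fin.Base using (Fin; zero)
  open import Data.Integer.Base using (+_)
  open import Data.Nat.Base as ℕ using (ℕ; suc; zero)
  import Data.Nat.Properties as ℕ
  import Data.Nat.Solver as ℕ
  open import Data.Rational.Base
  open import Data.Rational.Properties
  open import Data.Rational.Solver using (module +-*-Solver)

  -- A graph without vertices is coloured by the empty list. Non-colourability thus supplies the
  -- vertex that the Hall ratio needs.
  somewhere : ∀ n {E : Fin n → Fin n → Set} {k} → ¬ Colourable E k → Fin n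
  somewhere zero    {k = k} ¬c = contradiction (0 , mkColouring [] [] ℕ.z≤n (λ ())) ¬c
  somewhere (suc n) ¬c = zero

  p≤∣p∣ : ∀ p → p ≤ ∣ p ∣
  p≤∣p∣ p with ≤-total 0ℚ p
  ... | inj₁ 0≤p = ≤-reflexive (sym (0≤p⇒∣p∣≡p 0≤p))
  ... | inj₂ p≤0 = ≤-trans p≤0 (0≤∣p∣ p)

  ∣p-q∣≤r⇒p≤q+r : ∀ p q r → ∣ p - q ∣ ≤ r → p ≤ q + r
  ∣p-q∣≤r⇒p≤q+r p q r le = begin
    p            ≡⟨ solve 2 (λ p q → p := q :+ (p :- q)) refl p q ⟩
    q + (p - q)  ≤⟨ +-monoʳ-≤ q (≤-trans (p≤∣p∣ (p - q)) le) ⟩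
    q + r        ∎
    where
    open ≤-Reasoning
    open +-*-Solver

  quarter-floor : ∀ z → 0ℚ ≤ z → ∃ λ t → cast (4 ℕ.* t) ≤ z × z ≤ cast (4 ℕ.* t ℕ.+ 4)
  quarter-floor z 0≤z =
    let b , z≤b = archimedean z
    in search b (≤-trans z≤b (cast-mono (ℕ.m≤n*m b 4)))
    where
    search : ∀ b → z ≤ cast (4 ℕ.* b) → ∃ λ t → cast (4 ℕ.* t) ≤ z × z ≤ cast (4 ℕ.* t ℕ.+ 4)
    search zero    z≤ = 0 , 0≤z , ≤-trans z≤ (cast-mono ℕ.z≤n)
    search (suc b) z≤ with z ≤? cast (4 ℕ.* b)
    ... | yes z≤′ = search b z≤′
    ... | no  z≰  = b , <⇒≤ (≰⇒> z≰) ,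
      subst (λ k → z ≤ cast k) (trans (ℕ.*-suc 4 b) (ℕ.+-comm 4 (4 ℕ.* b))) z≤

  -- The floor of P / 4 is not computable from a Cauchy sequence, so t comes from a term q with all
  -- later terms within 1 of it. Rounding q - 1 down to a multiple of 4 keeps 4 t below these terms,
  -- and q + 1 is at most 4 t + 6. From P ≥ 30 follow q ≥ 29 and 4 t + 4 ≥ 28, hence t ≥ 6.
  eventually-between : ∀ P → fromℚ (cast 30) D.≤ P → ∃ λ t → 6 ℕ.≤ t ×
    ∃ λ N → ∀ n → N ℕ.≤ n → cast (4 ℕ.* t) ≤ seq P n × seq P n ≤ cast (4 ℕ.* t ℕ.+ 6)
  eventually-between P 30≤P =
    let K , close = cauchy P 1ℚ (positive⁻¹ 1ℚ)
        L , large = 30≤P 1ℚ (positive⁻¹ 1ℚ)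
        N = K ℕ.⊔ L
        q = seq P N
        29≤q : cast 29 ≤ q
        29≤q = subst₂ _≤_ refl (cancel q) (+-monoˡ-≤ (- 1ℚ) (large N (ℕ.m≤n⊔m K L)))
        28≤q-1 : cast 28 ≤ q - 1ℚ
        28≤q-1 = +-monoˡ-≤ (- 1ℚ) 29≤q
        t , t≤ , ≤t = quarter-floor (q - 1ℚ) (≤-trans (0≤cast 28) 28≤q-1)
    in t
     , ℕ.*-cancelˡ-≤ 4 (ℕ.+-cancelʳ-≤ 4 24 (4 ℕ.* t) (cast-cancel (≤-trans 28≤q-1 ≤t)))
     , N , λ n N≤n →
       let near = close n N (ℕ.≤-trans (ℕ.m≤m⊔n K L) N≤n) (ℕ.m≤m⊔n K L)
           near′ = close N n (ℕ.m≤m⊔n K L) (ℕ.≤-trans (ℕ.m≤m⊔n K L) N≤n)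
       in ≤-trans t≤ (subst (q - 1ℚ ≤_) (cancel (seq P n))
            (+-monoˡ-≤ (- 1ℚ) (∣p-q∣≤r⇒p≤q+r q (seq P n) 1ℚ near′)))
        , ≤-trans (∣p-q∣≤r⇒p≤q+r (seq P n) q 1ℚ near)
            (subst (_≤ cast (4 ℕ.* t ℕ.+ 6)) (shift q)
              (subst (q - 1ℚ + cast 2 ≤_) (trans (sym (cast-+ (4 ℕ.* t ℕ.+ 4) 2)) (cong cast (ℕ.+-assoc (4 ℕ.* t) 4 2)))
                (+-monoˡ-≤ (cast 2) ≤t)))
    where
    open +-*-Solver
    cancel : ∀ q → q + 1ℚ + - 1ℚ ≡ q
    cancel q = trans (+-assoc q 1ℚ (- 1ℚ)) (+-identityʳ q)
    shift : ∀ q → q - 1ℚ + cast 2 ≡ q + 1ℚ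
    shift q = +-assoc q (- 1ℚ) (cast 2)

  -- Here t = 4 + e and M = 3 + e. After division by 82 the summand 82 becomes the margin 1 that
  -- witnesses the strict inequality between reals.
  square-bound : ∀ e → (4 ℕ.* (4 ℕ.+ e) ℕ.+ 6) ℕ.* (4 ℕ.* (4 ℕ.+ e) ℕ.+ 6) ℕ.+ 82 ℕ.≤ 82 ℕ.* ((3 ℕ.+ e) ℕ.* (3 ℕ.+ e))
  square-bound e = ℕ.≤-trans (ℕ.m≤m+n _ (172 ℕ.+ 316 ℕ.* e ℕ.+ 66 ℕ.* (e ℕ.* e))) (ℕ.≤-reflexive
    (solve 1 (λ e → (con 4 :* (con 4 :+ e) :+ con 6) :* (con 4 :* (con 4 :+ e) :+ con 6) :+ con 82 :+
        (con 172 :+ con 316 :* e :+ con 66 :* (e :* e)) :=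
      con 82 :* ((con 3 :+ e) :* (con 3 :+ e))) refl e))
    where open ℕ.+-*-Solver

  strictly-below : ∀ {x b m : ℚ} → 0ℚ ≤ x → x ≤ b → b * b + cast 82 ≤ cast 82 * m → x * x * (+ 1 / 82) + 1ℚ ≤ m
  strictly-below {x} {b} {m} 0≤x x≤b le = begin
    x * x * c + 1ℚ           ≤⟨ +-monoˡ-≤ 1ℚ (*-monoʳ-≤-nonNeg c (≤-trans
                                  (*-monoˡ-≤-nonNeg x {{nonNegative 0≤x}} x≤b)
                                  (*-monoʳ-≤-nonNeg b {{nonNegative (≤-trans 0≤x x≤b)}} x≤b))) ⟩
    b * b * c + 1ℚ           ≡⟨⟩
    b * b * c + cast 82 * c  ≡⟨ sym (*-distribʳ-+ c (b * b) (cast 82)) ⟩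
    (b * b + cast 82) * c    ≤⟨ *-monoʳ-≤-nonNeg c le ⟩
    cast 82 * m * c          ≡⟨ trans (*-comm (cast 82 * m) c) (sym (*-assoc c (cast 82) m)) ⟩
    1ℚ * m                   ≡⟨ *-identityˡ m ⟩
    m                        ∎
    where
    open ≤-Reasoning
    c = + 1 / 82

  -- With M = t − 1 the extremal graph has ρ ≤ 4 t ≤ P and χ_f > M², and
  -- 82 M² ≥ (4 t + 6)² + 82 once t ≥ 4.
  conclusion : ∀ P → (∃ λ t → 6 ℕ.≤ t × ∃ λ N → ∀ n → N ℕ.≤ n →
      cast (4 ℕ.* t) ≤ seq P n × seq P n ≤ cast (4 ℕ.* t ℕ.+ 6)) →
    Σ Graph λ G → CliqueFree 5 G ×
    (∃ λ (ρ : ℝ) → IsHallRatio G ρ × ρ D.≤ P) ×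
    (∃ λ (χ : ℝ) → IsFractionalChromaticNumber G χ × P D.* P D.* fromℚ (+ 1 / 82) D.< χ)
  conclusion P (suc (suc (suc (suc e))) , ℕ.s≤s (ℕ.s≤s (ℕ.s≤s (ℕ.s≤s _))) , N , bounds) =
    G , K₅-free
    , (let ρ , isHall , ρ≤ = HallRatio.hallRatio G (somewhere (order G) {k = M ℕ.* M} lower) (4 ℕ.* (4 ℕ.+ e)) hall
       in fromℚ ρ , isHall , ≤⇒≤ℝ (fromℚ ρ) P (N , λ n N≤n → ≤-trans ρ≤ (proj₁ (bounds n N≤n))))
    , fromℚ χ , fractionalChromaticNumber G , 1ℚ , positive⁻¹ 1ℚ , N , λ n N≤n →
        let t≤ , ≤t = bounds n N≤n
        in ≤-trans (strictly-below {seq P n} {cast B} {cast (M ℕ.* M)} (≤-trans (0≤cast (4 ℕ.* (4 ℕ.+ e))) t≤) ≤t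
             (subst₂ _≤_ (trans (cast-+ (B ℕ.* B) 82) (cong (_+ cast 82) (cast-* B B)))
                         (cast-* 82 (M ℕ.* M)) (cast-mono {B ℕ.* B ℕ.+ 82} {82 ℕ.* (M ℕ.* M)} (square-bound e))))
           (<⇒≤ (≰⇒> λ χ≤ → lower (χ≤⇒colourable {M ℕ.* M} χ≤)))
    where
    M = 3 ℕ.+ e
    B = 4 ℕ.* (4 ℕ.+ e) ℕ.+ 6
    open Extremal (extremal (2 ℕ.+ e)) renaming (graph to G)
    open FractionalColourings G using (χ; χ≤⇒colourable)

open import Defs
open import Data.Integer.Base using (+_)
open import Data.Rational.Base using (_/_)
open NaturalsInℚ using (cast)
open Conclusion using (eventually-between; conclusion)

theorem3 : ∃ λ (P₀ : ℝ) → ∀ (P : ℝ) → P₀ ≤ P →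
    Σ Graph λ G → CliqueFree 5 G ×
    (∃ λ (ρ : ℝ) → IsHallRatio G ρ × ρ ≤ P) ×
    (∃ λ (χ : ℝ) → IsFractionalChromaticNumber G χ × P * P * fromℚ (+ 1 / 82) < χ)
theorem3 = fromℚ (cast 30) , λ P 30≤P → conclusion P (eventually-between P 30≤P)
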